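{- If $n>1$ is an odd integer such that the angle $2\pi/n$ can be constructed, then there exists a countable dense subset of the unit circle $S^1$ consisting of non-$n$-sectable angles.
   Context: Let $S\subseteq\mathbb{R}^2$ contain $(0,0)$ and $(1,0)$. A point is constructible over $S$ if it can be obtained from points of $S$ by a finite sequence of straightedge-and-compass steps: (1) given two distinct points already available, one may draw the line through them, or the circle centered at one of them and passing through the other; (2) given two lines, two circles, or a line and a circle already drawn, one may add their intersection points. $C(S)$ denotes the set of all points constructible over $S$. An angle is given by its radian measure $\alpha\in\mathbb{R}$ and is identified with the point $(\cos\alpha,\sin\alpha)\in S^1$. The angle $\alpha$ is constructible if $(\cos\alpha,\sin\alpha)\in C(\{(0,0),(1,0)\})$. The angle $\alpha$ is $n$-sectable if $(\cos(\alpha/n),\sin(\alpha/n))\in C(\{(0,0),(1,0),(\cos\alpha,\sin\alpha)\})$, and non-$n$-sectable otherwise; when $2\pi/n$ is constructible this depends only on $\alpha$ modulo $2\pi$. -}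

module Defs where

open import Algebra.Apartness.Bundles using (HeytingField)
open import Algebra.Bundles using (CommutativeRing)
import Algebra.Properties.Monoid.Mult
import Algebra.Properties.Semiring.Mult
import Algebra.Properties.Semiring.Exp
import Algebra.Properties.CommutativeSemiring.Exp
import Algebra.Properties.Ring
import Algebra.Properties.AbelianGroup
import Algebra.Properties.CommutativeSemigroup
import Algebra.Solver.Ring
open import Algebra.Solver.Ring.AlmostCommutativeRing
  using (AlmostCommutativeRing; fromCommutativeRing; _-Raw-AlmostCommutative⟶_)
open import Data.Empty using (⊥-elim)
open import Data.Integer.Base as ℤ using (ℤ; +_; -[1+_]; _⊖_; _◃_)
import Data.Integer.Properties as ℤₚ
open import Data.Maybe.Base using (Maybe; just; nothing)
open import Data.Nat.Base as ℕ using (ℕ; zero; suc; NonZero; _!)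
open import Data.Nat.Properties as ℕₚ using (_!≢0)
open import Data.Product.Base using (∃; _×_; _,_; proj₁; proj₂)
import Data.Sign.Base as Sign
open import Data.Sum.Base using (_⊎_; inj₁; inj₂)
open import Function.Bundles using (_⇔_; module Equivalence)
open import Level using (_⊔_) renaming (suc to lsuc)
open import Relation.Binary.Core using (Rel)
open import Relation.Binary.Structures using (IsStrictPartialOrder)
open import Relation.Binary.PropositionalEquality.Core as ≡ using (_≡_)
import Relation.Binary.Reasoning.Setoid
open import Relation.Nullary.Decidable using (yes; no)
open import Relation.Nullary.Negation using (¬_)
open import Relation.Unary using (Pred; _∈_; _≐_; _∪_)

-- The real numbers, as a Cauchy complete Archimedean ordered field:
-- classically these axioms determine ℝ up to isomorphism.  (Cauchy
-- completeness and the Archimedean property together amount to the least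
-- upper bound property.)

record RealNumbers c ℓ₁ ℓ₂ ℓ₃ : Set (lsuc (c ⊔ ℓ₁ ⊔ ℓ₂ ⊔ ℓ₃)) where
  infix 4 _<_
  field
    heytingField : HeytingField c ℓ₁ ℓ₂

  open HeytingField heytingField public

  commutativeRing : CommutativeRing c ℓ₁
  commutativeRing = record { isCommutativeRing = isCommutativeRing }

  open CommutativeRing commutativeRing public
    using (ring; semiring; commutativeSemiring; +-monoid; +-abelianGroup)

  open Algebra.Properties.Monoid.Mult +-monoid public
    using () renaming (_×_ to _·_)

  field
    _<_                  : Rel Carrier ℓ₃
    isStrictPartialOrder : IsStrictPartialOrder _≈_ _<_
    #⇔<⊎>                : ∀ x y → x # y ⇔ (x < y ⊎ y < x)
    +-monoˡ-<            : ∀ z {x y} → x < y → x + z < y + z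
    *-pos                : ∀ {x y} → 0# < x → 0# < y → 0# < x * y
    archimedean          : ∀ x → ∃ λ n → x < n · 1#

  -- Stands for an inequality ∣ x ∣ < b: no absolute value function is assumed.
  ∣_∣<_ : Rel Carrier ℓ₃
  ∣ x ∣< b = (x < b) × (- x < b)

  Cauchy : (ℕ → Carrier) → Set (c ⊔ ℓ₃)
  Cauchy u = ∀ ε → 0# < ε →
    ∃ λ N → ∀ m n → N ℕ.≤ m → N ℕ.≤ n → ∣ u m - u n ∣< ε

  _⟶_ : (ℕ → Carrier) → Carrier → Set (c ⊔ ℓ₃)
  u ⟶ l = ∀ ε → 0# < ε → ∃ λ N → ∀ n → N ℕ.≤ n → ∣ u n - l ∣< ε

  field
    complete : ∀ u → Cauchy u → ∃ λ l → u ⟶ l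

module RealProperties {c ℓ₁ ℓ₂ ℓ₃} (R : RealNumbers c ℓ₁ ℓ₂ ℓ₃) where

  open RealNumbers R
  open IsStrictPartialOrder isStrictPartialOrder public
    using (<-respʳ-≈; <-respˡ-≈)
    renaming (trans to <-trans; irrefl to <-irrefl)
  open Algebra.Properties.Semiring.Exp semiring public using (_^_)

  open Algebra.Properties.Semiring.Mult semiring
    using (×-homo-+; ×1-homo-*; ×-congˡ)
  open Algebra.Properties.Semiring.Exp semiring using (^-congˡ)
  open Algebra.Properties.CommutativeSemiring.Exp commutativeSemiring
    using (^-distrib-*)
  open Algebra.Properties.CommutativeSemigroup
    (CommutativeRing.*-commutativeSemigroup commutativeRing)
    using () renaming (interchange to *-interchange)
  open Algebra.Properties.Ring ring
    using (-‿distribˡ-*; -‿distribʳ-*; -0#≈0#; -‿involutive)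
  open Algebra.Properties.AbelianGroup +-abelianGroup
    using () renaming (⁻¹-∙-comm to -‿+-comm)
  open Relation.Binary.Reasoning.Setoid setoid

  fromℤ : ℤ → Carrier
  fromℤ (+ n)    = n · 1#
  fromℤ -[1+ n ] = - (suc n · 1#)

  cancel₁ : ∀ x y → x - y ≈ (1# + x) - (1# + y)
  cancel₁ x y = sym (begin
    (1# + x) + - (1# + y)     ≈⟨ +-cong (+-comm 1# x) (sym (-‿+-comm 1# y)) ⟩
    (x + 1#) + (- 1# + - y)   ≈⟨ +-assoc x 1# _ ⟩
    x + (1# + (- 1# + - y))   ≈⟨ +-congˡ (sym (+-assoc 1# (- 1#) (- y))) ⟩
    x + ((1# + - 1#) + - y)   ≈⟨ +-congˡ (+-congʳ (-‿inverseʳ 1#)) ⟩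
    x + (0# + - y)            ≈⟨ +-congˡ (+-identityˡ (- y)) ⟩
    x + - y                   ∎)

  fromℤ-⊖ : ∀ m n → fromℤ (m ⊖ n) ≈ m · 1# - n · 1#
  fromℤ-⊖ zero    zero    = sym (-‿inverseʳ 0#)
  fromℤ-⊖ zero    (suc n) = sym (+-identityˡ _)
  fromℤ-⊖ (suc m) zero    = sym (trans (+-congˡ -0#≈0#) (+-identityʳ _))
  fromℤ-⊖ (suc m) (suc n) = begin
    fromℤ (suc m ⊖ suc n)     ≡⟨ ≡.cong fromℤ (ℤₚ.[1+m]⊖[1+n]≡m⊖n m n) ⟩
    fromℤ (m ⊖ n)             ≈⟨ fromℤ-⊖ m n ⟩
    m · 1# - n · 1#           ≈⟨ cancel₁ _ _ ⟩
    suc m · 1# - suc n · 1#   ∎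

  fromℤ-+ : ∀ i j → fromℤ (i ℤ.+ j) ≈ fromℤ i + fromℤ j
  fromℤ-+ (+ m)    (+ n)    = ×-homo-+ 1# m n
  fromℤ-+ (+ m)    -[1+ n ] = fromℤ-⊖ m (suc n)
  fromℤ-+ -[1+ m ] (+ n)    = trans (fromℤ-⊖ n (suc m)) (+-comm _ _)
  fromℤ-+ -[1+ m ] -[1+ n ] = begin
    - (suc (suc (m ℕ.+ n)) · 1#)
      ≈⟨ -‿cong (×-congˡ (≡.cong suc (≡.sym (ℕₚ.+-suc m n)))) ⟩
    - ((suc m ℕ.+ suc n) · 1#)        ≈⟨ -‿cong (×-homo-+ 1# (suc m) (suc n)) ⟩
    - (suc m · 1# + suc n · 1#)       ≈⟨ sym (-‿+-comm _ _) ⟩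
    - (suc m · 1#) + - (suc n · 1#)   ∎

  fromℤ-◃⁻ : ∀ n → fromℤ (Sign.- ◃ n) ≈ - (n · 1#)
  fromℤ-◃⁻ zero    = sym -0#≈0#
  fromℤ-◃⁻ (suc n) = refl

  fromℤ-◃⁺ : ∀ n → fromℤ (Sign.+ ◃ n) ≈ n · 1#
  fromℤ-◃⁺ zero    = refl
  fromℤ-◃⁺ (suc n) = refl

  fromℤ-* : ∀ i j → fromℤ (i ℤ.* j) ≈ fromℤ i * fromℤ j
  fromℤ-* (+ m)    (+ n)    = trans (fromℤ-◃⁺ (m ℕ.* n)) (×1-homo-* m n)
  fromℤ-* (+ m)    -[1+ n ] = trans (fromℤ-◃⁻ (m ℕ.* suc n))
    (trans (-‿cong (×1-homo-* m (suc n))) (-‿distribʳ-* _ _))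
  fromℤ-* -[1+ m ] (+ n)    = trans (fromℤ-◃⁻ (suc m ℕ.* n))
    (trans (-‿cong (×1-homo-* (suc m) n)) (-‿distribˡ-* _ _))
  fromℤ-* -[1+ m ] -[1+ n ] = begin
    (suc m ℕ.* suc n) · 1#              ≈⟨ ×1-homo-* (suc m) (suc n) ⟩
    (suc m · 1#) * (suc n · 1#)         ≈⟨ sym (-‿involutive _) ⟩
    - - ((suc m · 1#) * (suc n · 1#))   ≈⟨ -‿cong (-‿distribˡ-* _ _) ⟩
    - (- (suc m · 1#) * (suc n · 1#))   ≈⟨ -‿distribʳ-* _ _ ⟩
    - (suc m · 1#) * - (suc n · 1#)     ∎

  fromℤ-neg : ∀ i → fromℤ (ℤ.- i) ≈ - fromℤ i
  fromℤ-neg (+ zero)  = sym -0#≈0#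
  fromℤ-neg (+ suc n) = refl
  fromℤ-neg -[1+ n ]  = sym (-‿involutive _)

  almostCommutativeRing : AlmostCommutativeRing c ℓ₁
  almostCommutativeRing = fromCommutativeRing commutativeRing

  morphism : ℤ.+-*-rawRing -Raw-AlmostCommutative⟶ almostCommutativeRing
  morphism = record
    { ⟦_⟧    = fromℤ
    ; +-homo = fromℤ-+
    ; *-homo = fromℤ-*
    ; -‿homo = fromℤ-neg
    ; 0-homo = refl
    ; 1-homo = +-identityʳ 1#
    }

  fromℤ≟ : ∀ i j → Maybe (fromℤ i ≈ fromℤ j)
  fromℤ≟ i j with i ℤₚ.≟ j
  ... | yes i≡j = just (reflexive (≡.cong fromℤ i≡j))
  ... | no  _   = nothing

  open Algebra.Solver.Ring ℤ.+-*-rawRing almostCommutativeRing morphism fromℤ≟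
    using (solve; _:=_; _:+_; _:*_; _:-_; :-_; con)

  abstract
    <⇒0<- : ∀ {x y} → x < y → 0# < y - x
    <⇒0<- {x} {y} x<y = <-respˡ-≈ (-‿inverseʳ x) (+-monoˡ-< (- x) x<y)

    0<-⇒< : ∀ {x y} → 0# < y - x → x < y
    0<-⇒< {x} {y} p = <-respʳ-≈ (solve 2 (λ x y → (y :- x) :+ x := y) refl x y)
      (<-respˡ-≈ (+-identityˡ x) (+-monoˡ-< x p))

    +-mono-< : ∀ {x y u v} → x < y → u < v → x + u < y + v
    +-mono-< {x} {y} {u} {v} x<y u<v = <-trans (+-monoˡ-< u x<y)
      (<-respʳ-≈ (+-comm v y) (<-respˡ-≈ (+-comm u y) (+-monoˡ-< y u<v)))

    +-pos : ∀ {x y} → 0# < x → 0# < y → 0# < x + y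
    +-pos p q = <-respˡ-≈ (+-identityˡ 0#) (+-mono-< p q)

    <-+ʳ : ∀ {x y z} → x < y → 0# < z → x < y + z
    <-+ʳ {x} p q = <-respˡ-≈ (+-identityʳ x) (+-mono-< p q)

    *-monoˡ-< : ∀ {z x y} → 0# < z → x < y → z * x < z * y
    *-monoˡ-< {z} {x} {y} 0<z x<y = 0<-⇒< (<-respʳ-≈
      (solve 3 (λ x y z → z :* (y :- x) := z :* y :- z :* x) refl x y z)
      (*-pos 0<z (<⇒0<- x<y)))

    0<x+x⇒0<x : ∀ {x} → 0# < x + x → 0# < x
    0<x+x⇒0<x {x} 0<2x with #-cotrans (Equivalence.from (#⇔<⊎> _ _) (inj₁ 0<2x)) x
    ... | inj₁ 0#x with Equivalence.to (#⇔<⊎> _ _) 0#x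
    ...   | inj₁ 0<x = 0<x
    ...   | inj₂ x<0 = ⊥-elim (<-irrefl refl (<-trans 0<2x
                         (<-respʳ-≈ (+-identityˡ 0#) (+-mono-< x<0 x<0))))
    0<x+x⇒0<x {x} 0<2x | inj₂ x#2x with Equivalence.to (#⇔<⊎> _ _) x#2x
    ...   | inj₁ x<2x = <-respʳ-≈ (solve 1 (λ x → x :+ x :- x := x) refl x) (<⇒0<- x<2x)
    ...   | inj₂ 2x<x = ⊥-elim (<-irrefl refl (<-trans 0<2x
                          (<-respʳ-≈ (+-identityˡ 0#) (+-mono-< x<0 x<0))))
      where
      x<0 : x < 0#
      x<0 = <-respˡ-≈ (solve 1 (λ x → x :+ x :- x := x) refl x)
              (<-respʳ-≈ (-‿inverseʳ x) (+-monoˡ-< (- x) 2x<x))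

    0#-0#≈ : ∀ x → x - 0# ≈ x
    0#-0#≈ x = trans (+-congˡ -0#≈0#) (+-identityʳ x)

    0<1 : 0# < 1#
    0<1 with Equivalence.to (#⇔<⊎> _ _) (invertible⇒# {0#} {1#} (- 1# , inv , trans (*-comm _ _) inv))
      where
      inv : - 1# * (0# - 1#) ≈ 1#
      inv = begin
        - 1# * (0# - 1#)   ≈⟨ *-congˡ (+-identityˡ (- 1#)) ⟩
        - 1# * - 1#        ≈⟨ solve 1 (λ o → :- o :* :- o := o :* o) refl 1# ⟩
        1# * 1#            ≈⟨ *-identityˡ 1# ⟩
        1#                 ∎
    ... | inj₁ 0<1′ = 0<1′
    ... | inj₂ 1<0  = <-respʳ-≈
      (trans (solve 1 (λ o → (con (+ 0) :- o) :* (con (+ 0) :- o) := o :* o) refl 1#)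
             (*-identityˡ 1#))
      (*-pos (<⇒0<- 1<0) (<⇒0<- 1<0))

    0<suc : ∀ n → 0# < suc n · 1#
    0<suc zero    = <-respʳ-≈ (sym (+-identityʳ 1#)) 0<1
    0<suc (suc n) = +-pos 0<1 (0<suc n)

    0<⇒#0 : ∀ {x} → 0# < x → x # 0#
    0<⇒#0 0<x = Equivalence.from (#⇔<⊎> _ _) (inj₂ 0<x)

    inverse : ∀ x → 0# < x → ∃ λ y → y * x ≈ 1#
    inverse x 0<x with #⇒invertible (0<⇒#0 0<x)
    ... | y , yx≈1 , _ = y , trans (*-congˡ (sym (0#-0#≈ x))) yx≈1

    inverse-pos : ∀ {x y} → 0# < x → y * x ≈ 1# → 0# < y
    inverse-pos {x} {y} 0<x yx≈1 with Equivalence.to (#⇔<⊎> _ _)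
      (invertible⇒# {y} {0#} (x , trans (*-comm _ _) inv , inv))
      where
      inv : (y - 0#) * x ≈ 1#
      inv = trans (*-congʳ (0#-0#≈ y)) yx≈1
    ... | inj₂ 0<y = 0<y
    ... | inj₁ y<0 = ⊥-elim (<-irrefl refl (<-trans 0<1 (<-respˡ-≈ (trans (*-comm x y) yx≈1)
                       (<-respʳ-≈ (zeroʳ x) (*-monoˡ-< 0<x y<0)))))

  1/_ : ∀ n .{{_ : NonZero n}} → Carrier
  1/ suc n = proj₁ (inverse (suc n · 1#) (0<suc n))

  infixl 7 _/_
  _/_ : Carrier → ∀ n .{{_ : NonZero n}} → Carrier
  x / n = x * 1/ n

  1/-inverse : ∀ n .{{_ : NonZero n}} → 1/ n * (n · 1#) ≈ 1#
  1/-inverse (suc n) = proj₂ (inverse (suc n · 1#) (0<suc n))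

  partialSum : (ℕ → Carrier) → ℕ → Carrier
  partialSum t zero    = 0#
  partialSum t (suc n) = partialSum t n + t n

  expTerm : Carrier → ℕ → Carrier
  expTerm x k = (x ^ k / (k !)) {{k !≢0}}

  cosTerm : Carrier → ℕ → Carrier
  cosTerm x k = (- 1#) ^ k * expTerm x (2 ℕ.* k)

  sinTerm : Carrier → ℕ → Carrier
  sinTerm x k = (- 1#) ^ k * expTerm x (suc (2 ℕ.* k))

  abs-resp : ∀ {x y a b} → x ≈ y → a ≈ b → ∣ x ∣< a → ∣ y ∣< b
  abs-resp x≈y a≈b (p , q) =
    <-respˡ-≈ x≈y (<-respʳ-≈ a≈b p) , <-respˡ-≈ (-‿cong x≈y) (<-respʳ-≈ a≈b q)

  abs-<-trans : ∀ {x a b} → ∣ x ∣< a → a < b → ∣ x ∣< b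
  abs-<-trans (p , q) a<b = <-trans p a<b , <-trans q a<b

  abs-neg : ∀ {x a} → ∣ x ∣< a → ∣ - x ∣< a
  abs-neg {x} (p , q) = q , <-respˡ-≈ (sym (-‿involutive x)) p

  abs-+ : ∀ {x y a b} → ∣ x ∣< a → ∣ y ∣< b → ∣ x + y ∣< (a + b)
  abs-+ {x} {y} (p , q) (r , s) =
    +-mono-< p r , <-respˡ-≈ (-‿+-comm x y) (+-mono-< q s)

  abs-* : ∀ {x y a b} → ∣ x ∣< a → ∣ y ∣< b → ∣ x * y ∣< (a * b)
  abs-* {x} {y} {a} {b} (p , q) (r , s) =
      0<-⇒< (0<x+x⇒0<x (<-respʳ-≈
        (solve 4 (λ x y a b → (a :- x) :* (b :- :- y) :+ (a :- :- x) :* (b :- y)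
                            := (a :* b :- x :* y) :+ (a :* b :- x :* y)) refl x y a b)
        (+-pos (*-pos (<⇒0<- p) (<⇒0<- s)) (*-pos (<⇒0<- q) (<⇒0<- r)))))
    , 0<-⇒< (0<x+x⇒0<x (<-respʳ-≈
        (solve 4 (λ x y a b → (a :- x) :* (b :- y) :+ (a :- :- x) :* (b :- :- y)
                            := (a :* b :- :- (x :* y)) :+ (a :* b :- :- (x :* y))) refl x y a b)
        (+-pos (*-pos (<⇒0<- p) (<⇒0<- r)) (*-pos (<⇒0<- q) (<⇒0<- s)))))

  abs-pos : ∀ {a} → 0# < a → ∣ 0# ∣< a
  abs-pos 0<a = 0<a , <-respˡ-≈ (sym -0#≈0#) 0<a

  abs-sign : ∀ k {x a} → ∣ x ∣< a → ∣ (- 1#) ^ k * x ∣< a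
  abs-sign zero    {x} p = abs-resp (sym (*-identityˡ x)) refl p
  abs-sign (suc k) {x} p = abs-resp
    (begin
      - ((- 1#) ^ k * x)         ≈⟨ sym (*-identityˡ _) ⟩
      1# * - ((- 1#) ^ k * x)    ≈⟨ solve 3 (λ o s x → o :* :- (s :* x) := (:- o :* s) :* x)
                                       refl 1# ((- 1#) ^ k) x ⟩
      (- 1# * (- 1#) ^ k) * x    ∎)
    refl (abs-neg (abs-sign k p))

  archimedean≥ : ∀ k x → ∃ λ n → k ℕ.≤ n × x < n · 1#
  archimedean≥ k x = k ℕ.+ proj₁ (archimedean x) , ℕₚ.m≤m+n k _ , go k
    where
    go : ∀ k → x < (k ℕ.+ proj₁ (archimedean x)) · 1#
    go zero    = proj₂ (archimedean x)
    go (suc k) = <-respʳ-≈ (+-comm _ _) (<-+ʳ (go k) 0<1)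

  abs-bound : ∀ k x → ∃ λ n → k ℕ.≤ n × ∣ x ∣< (n · 1#)
  abs-bound k x with archimedean≥ k x
  ... | m , k≤m , x<m with archimedean≥ m (- x)
  ...   | n , m≤n , -x<n = n , ℕₚ.≤-trans k≤m m≤n , <-weaken (ℕₚ.≤⇒≤′ m≤n) , -x<n
    where
    <-weaken : ∀ {n} → m ℕ.≤′ n → x < n · 1#
    <-weaken (ℕ.≤′-reflexive ≡.refl) = x<m
    <-weaken (ℕ.≤′-step p)           = <-respʳ-≈ (+-comm _ _) (<-+ʳ (<-weaken p) 0<1)

  2# ½ : Carrier
  2# = 1# + 1#
  ½  = 1/ 2

  0<2 : 0# < 2#
  0<2 = +-pos 0<1 0<1

  0<½ : 0# < ½
  0<½ = inverse-pos (0<suc 1) (1/-inverse 2)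

  ½*2≈1 : ½ * 2# ≈ 1#
  ½*2≈1 = trans (*-congˡ (+-congˡ (sym (+-identityʳ 1#)))) (1/-inverse 2)

  1<2 : 1# < 2#
  1<2 = <-respˡ-≈ (+-identityˡ 1#) (+-monoˡ-< 1# 0<1)

  ½^-pos : ∀ n → 0# < ½ ^ n
  ½^-pos zero    = 0<1
  ½^-pos (suc n) = *-pos 0<½ (½^-pos n)

  ½*-< : ∀ {x} → x < 2# → ½ * x < 1#
  ½*-< p = <-respʳ-≈ ½*2≈1 (*-monoˡ-< 0<½ p)

  ½^-<2 : ∀ n → ½ ^ n < 2#
  ½^-<2 zero    = 1<2
  ½^-<2 (suc n) = <-trans (½*-< (½^-<2 n)) 1<2

  suc*½^-<2 : ∀ n → (suc n · 1#) * ½ ^ n < 2#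
  suc*½^-<2 zero    = <-respˡ-≈ (sym (trans (*-identityʳ _) (+-identityʳ _))) 1<2
  suc*½^-<2 (suc n) = <-respʳ-≈
    (begin
      ½ * (2# + 2#)      ≈⟨ distribˡ ½ 2# 2# ⟩
      ½ * 2# + ½ * 2#    ≈⟨ +-cong ½*2≈1 ½*2≈1 ⟩
      2#                 ∎)
    (<-respˡ-≈
      (begin
        ½ * (½ ^ n + m * ½ ^ n)         ≈⟨ *-congˡ (+-congʳ (sym (*-identityˡ _))) ⟩
        ½ * (1# * ½ ^ n + m * ½ ^ n)    ≈⟨ solve 4 (λ o m h p → h :* (o :* p :+ m :* p)
                                              := (o :+ m) :* (h :* p)) refl 1# m ½ (½ ^ n) ⟩
        (1# + m) * (½ * ½ ^ n)          ∎)
      (*-monoˡ-< 0<½ (+-mono-< (½^-<2 n) (suc*½^-<2 n))))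
    where
    m : Carrier
    m = suc n · 1#

  ½^-antitone : ∀ {k j} → k ℕ.≤′ j → ½ ^ j < 2# * ½ ^ k
  ½^-antitone {k} (ℕ.≤′-reflexive ≡.refl) = <-respʳ-≈ (*-comm _ _)
    (<-respˡ-≈ (*-identityʳ _) (*-monoˡ-< (½^-pos k) 1<2))
  ½^-antitone {k} (ℕ.≤′-step {j} p) = <-trans
    (<-respʳ-≈
      (begin
        ½ * (2# * ½ ^ k)    ≈⟨ sym (*-assoc ½ 2# _) ⟩
        (½ * 2#) * ½ ^ k    ≈⟨ *-congʳ ½*2≈1 ⟩
        1# * ½ ^ k          ≈⟨ *-identityˡ _ ⟩
        ½ ^ k               ∎)
      (*-monoˡ-< 0<½ (½^-antitone p)))
    (½^-antitone {k} {k} (ℕ.≤′-reflexive ≡.refl))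

  below : ∀ n a {ε i} → 0# < ε → i * ε ≈ 1# → (2# * i) * a < n · 1# → a * ½ ^ n < ε
  below n a {ε} {i} 0<ε iε≈1 2ia<n = <-respʳ-≈ half-double
    (<-respˡ-≈ regroup (*-monoˡ-< (*-pos 0<½ 0<ε) scaled))
    where
    half-double : (½ * ε) * 2# ≈ ε
    half-double = begin
      (½ * ε) * 2#    ≈⟨ *-assoc ½ ε 2# ⟩
      ½ * (ε * 2#)    ≈⟨ *-congˡ (*-comm ε 2#) ⟩
      ½ * (2# * ε)    ≈⟨ *-assoc ½ 2# ε ⟨
      (½ * 2#) * ε    ≈⟨ *-congʳ ½*2≈1 ⟩
      1# * ε          ≈⟨ *-identityˡ ε ⟩
      ε               ∎

    regroup : (½ * ε) * (½ ^ n * ((2# * i) * a)) ≈ a * ½ ^ n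
    regroup = begin
      (½ * ε) * (½ ^ n * ((2# * i) * a))    ≈⟨ *-congˡ (*-comm _ _) ⟩
      (½ * ε) * (((2# * i) * a) * ½ ^ n)    ≈⟨ *-congˡ (*-assoc (2# * i) a _) ⟩
      (½ * ε) * ((2# * i) * (a * ½ ^ n))    ≈⟨ *-assoc (½ * ε) (2# * i) _ ⟨
      ((½ * ε) * (2# * i)) * (a * ½ ^ n)    ≈⟨ *-congʳ (*-interchange ½ ε 2# i) ⟩
      ((½ * 2#) * (ε * i)) * (a * ½ ^ n)    ≈⟨ *-congʳ (*-cong ½*2≈1 (trans (*-comm ε i) iε≈1)) ⟩
      (1# * 1#) * (a * ½ ^ n)               ≈⟨ *-congʳ (*-identityˡ 1#) ⟩
      1# * (a * ½ ^ n)                      ≈⟨ *-identityˡ _ ⟩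
      a * ½ ^ n                             ∎

    scaled : ½ ^ n * ((2# * i) * a) < 2#
    scaled = <-trans (*-monoˡ-< (½^-pos n) 2ia<n)
      (<-trans (*-monoˡ-< (½^-pos n) (<-respˡ-≈ (+-identityˡ _) (+-monoˡ-< (n · 1#) 0<1)))
        (<-respˡ-≈ (*-comm _ _) (suc*½^-<2 n)))

  ½^-vanishes : ∀ k a {ε} → 0# < ε → ∃ λ n → k ℕ.≤ n × a * ½ ^ n < ε
  ½^-vanishes k a {ε} 0<ε = choose (inverse ε 0<ε)
    where
    choose : (∃ λ i → i * ε ≈ 1#) → ∃ λ n → k ℕ.≤ n × a * ½ ^ n < ε
    choose (i , iε≈1) with archimedean≥ k ((2# * i) * a)
    ... | n , k≤n , 2ia<n = n , k≤n , below n a 0<ε iε≈1 2ia<n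

  geometric⇒Cauchy : ∀ t a k → 0# < a → (∀ j → k ℕ.≤ j → ∣ t j ∣< (a * ½ ^ j)) →
                     Cauchy (partialSum t)
  geometric⇒Cauchy t a k 0<a t< ε 0<ε with ½^-vanishes k (4# * (a + a)) 0<ε
    where
    4# : Carrier
    4# = 2# + 2#
  ... | N , k≤N , T<ε = N , λ m n N≤m N≤n → abs-<-trans
          (abs-resp
            (solve 3 (λ x y z → (x :- z) :+ :- (y :- z) := x :- y) refl (S m) (S n) (S N))
            (begin
              (T N + T N) + (T N + T N)        ≈⟨ +-cong double double ⟩
              2# * T N + 2# * T N              ≈⟨ sym (distribʳ (T N) 2# 2#) ⟩
              (2# + 2#) * T N                  ≈⟨ sym (*-assoc _ _ _) ⟩
              ((2# + 2#) * (a + a)) * ½ ^ N    ∎)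
            (abs-+ (near m N≤m) (abs-neg (near n N≤n))))
          T<ε
    where
    S T : ℕ → Carrier
    S = partialSum t
    T n = (a + a) * ½ ^ n

    double : T N + T N ≈ 2# * T N
    double = sym (trans (distribʳ (T N) 1# 1#) (+-cong (*-identityˡ _) (*-identityˡ _)))

    T-step : ∀ n → a * ½ ^ n ≈ T n - T (suc n)
    T-step n = begin
      a * ½ ^ n
        ≈⟨ solve 2 (λ a p → a :* p := (a :+ a) :* p :- a :* p) refl a (½ ^ n) ⟩
      (a + a) * ½ ^ n - a * ½ ^ n
        ≈⟨ +-congˡ (-‿cong (trans (sym (*-identityˡ _)) (*-congʳ (sym ½*2≈1)))) ⟩
      (a + a) * ½ ^ n - (½ * 2#) * (a * ½ ^ n)
        ≈⟨ +-congˡ (-‿cong (trans (*-congʳ (trans (distribˡ ½ 1# 1#)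
             (+-cong (*-identityʳ ½) (*-identityʳ ½))))
             (solve 3 (λ h a p → (h :+ h) :* (a :* p) := (a :+ a) :* (h :* p)) refl ½ a (½ ^ n)))) ⟩
      (a + a) * ½ ^ n - (a + a) * (½ * ½ ^ n) ∎

    T-pos : ∀ n → 0# < T n
    T-pos n = *-pos (+-pos 0<a 0<a) (½^-pos n)

    near′ : ∀ {m} → N ℕ.≤′ m → ∣ S m - S N ∣< ((T N + T N) - T m)
    near′ (ℕ.≤′-reflexive ≡.refl) = abs-resp (sym (-‿inverseʳ (S N)))
      (solve 1 (λ x → x := (x :+ x) :- x) refl (T N)) (abs-pos (T-pos N))
    near′ (ℕ.≤′-step {m} p) = abs-resp
      (solve 3 (λ x y z → (x :- y) :+ z := (x :+ z) :- y) refl (S m) (S N) (t m))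
      (trans (+-congˡ (T-step m))
        (solve 3 (λ x y z → (x :- y) :+ (y :- z) := x :- z) refl (T N + T N) (T m) (T (suc m))))
      (abs-+ (near′ p) (t< m (ℕₚ.≤-trans k≤N (ℕₚ.≤′⇒≤ p))))

    near : ∀ m → N ℕ.≤ m → ∣ S m - S N ∣< (T N + T N)
    near m N≤m = abs-<-trans (near′ (ℕₚ.≤⇒≤′ N≤m)) (0<-⇒< (<-respʳ-≈
      (solve 2 (λ x y → y := x :- (x :- y)) refl (T N + T N) (T m)) (T-pos m)))

  recip-unique : ∀ {x y z} → x * z ≈ 1# → y * z ≈ 1# → x ≈ y
  recip-unique {x} {y} {z} xz yz = begin
    x              ≈⟨ sym (trans (*-congˡ yz) (*-identityʳ x)) ⟩
    x * (y * z)    ≈⟨ solve 3 (λ x y z → x :* (y :* z) := y :* (x :* z)) refl x y z ⟩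
    y * (x * z)    ≈⟨ trans (*-congˡ xz) (*-identityʳ y) ⟩
    y              ∎

  expTerm-suc : ∀ x k → expTerm x (suc k) ≈ expTerm x k * (x / suc k)
  expTerm-suc x k = begin
    (x * x ^ k) * r            ≈⟨ *-congˡ r≈ ⟩
    (x * x ^ k) * (p * q)      ≈⟨ trans (*-congʳ (*-comm x (x ^ k))) (*-interchange (x ^ k) x p q) ⟩
    (x ^ k * p) * (x * q)      ∎
    where
    p q r : Carrier
    p = (1/ (k !)) {{k !≢0}}
    q = 1/ suc k
    r = (1/ (suc k !)) {{suc k !≢0}}

    r≈ : r ≈ p * q
    r≈ = recip-unique (1/-inverse (suc k !) {{suc k !≢0}}) (begin
      (p * q) * ((suc k ℕ.* k !) · 1#)
        ≈⟨ *-congˡ (×1-homo-* (suc k) (k !)) ⟩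
      (p * q) * ((suc k · 1#) * ((k !) · 1#))
        ≈⟨ trans (*-congʳ (*-comm p q)) (*-interchange q p _ _) ⟩
      (q * (suc k · 1#)) * (p * ((k !) · 1#))
        ≈⟨ *-cong (1/-inverse (suc k)) (1/-inverse (k !) {{k !≢0}}) ⟩
      1# * 1#
        ≈⟨ *-identityˡ 1# ⟩
      1# ∎)

  expTerm-bounded : ∀ y → ∃ λ a → ∃ λ k →
    0# < a × (∀ j → k ℕ.≤ j → ∣ expTerm y j ∣< a)
  expTerm-bounded y with abs-bound 0 y
  ... | k , _ , y<k with abs-bound 1 (expTerm y k)
  ...   | suc m , _ , e<m = suc m · 1# , k , 0<suc m , λ j k≤j → go (ℕₚ.≤⇒≤′ k≤j)
    where
    suc-mono : ∀ {j} → k ℕ.≤′ j → k · 1# < suc j · 1#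
    suc-mono (ℕ.≤′-reflexive ≡.refl) = <-respˡ-≈ (+-identityˡ _) (+-monoˡ-< _ 0<1)
    suc-mono (ℕ.≤′-step p)           = <-trans (suc-mono p)
      (<-respˡ-≈ (+-identityˡ _) (+-monoˡ-< _ 0<1))

    1/-pos : ∀ j → 0# < 1/ suc j
    1/-pos j = inverse-pos (0<suc j) (1/-inverse (suc j))

    ratio : ∀ {j} → k ℕ.≤′ j → ∣ y / suc j ∣< 1#
    ratio {j} p = abs-resp (*-comm _ y) (1/-inverse (suc j)) (bound (abs-<-trans y<k (suc-mono p)))
      where
      bound : ∣ y ∣< (suc j · 1#) → ∣ 1/ suc j * y ∣< (1/ suc j * (suc j · 1#))
      bound (u , v) = *-monoˡ-< (1/-pos j) u
                    , <-respˡ-≈ (sym (-‿distribʳ-* _ y)) (*-monoˡ-< (1/-pos j) v)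

    go : ∀ {j} → k ℕ.≤′ j → ∣ expTerm y j ∣< (suc m · 1#)
    go (ℕ.≤′-reflexive ≡.refl) = e<m
    go (ℕ.≤′-step {j} p)       =
      abs-resp (sym (expTerm-suc y j)) (*-identityʳ _) (abs-* (go p) (ratio p))

  expTerm-double : ∀ x k → expTerm (2# * x) k * ½ ^ k ≈ expTerm x k
  expTerm-double x k = begin
    ((2# * x) ^ k * r) * ½ ^ k    ≈⟨ solve 3 (λ y r h → (y :* r) :* h := (y :* h) :* r)
                                       refl ((2# * x) ^ k) r (½ ^ k) ⟩
    ((2# * x) ^ k * ½ ^ k) * r    ≈⟨ *-congʳ (sym (^-distrib-* (2# * x) ½ k)) ⟩
    ((2# * x) * ½) ^ k * r        ≈⟨ *-congʳ (^-congˡ k 2x½≈x) ⟩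
    x ^ k * r                     ∎
    where
    r : Carrier
    r = (1/ (k !)) {{k !≢0}}

    2x½≈x : (2# * x) * ½ ≈ x
    2x½≈x = begin
      (2# * x) * ½    ≈⟨ solve 3 (λ t x h → (t :* x) :* h := (h :* t) :* x) refl 2# x ½ ⟩
      (½ * 2#) * x    ≈⟨ *-congʳ ½*2≈1 ⟩
      1# * x          ≈⟨ *-identityˡ x ⟩
      x               ∎

  alternating-Cauchy : ∀ x (f : ℕ → ℕ) → (∀ k → k ℕ.≤ f k) →
                       Cauchy (partialSum (λ k → (- 1#) ^ k * expTerm x (f k)))
  alternating-Cauchy x f k≤fk with expTerm-bounded (2# * x)
  ... | a , k , 0<a , e<a = geometric⇒Cauchy _ (a * 2#) k (*-pos 0<a 0<2) λ j k≤j →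
          abs-sign j (abs-resp (expTerm-double x (f j)) (sym (*-assoc a 2# (½ ^ j)))
            (abs-* (e<a (f j) (ℕₚ.≤-trans k≤j (k≤fk j)))
                   ( ½^-antitone (ℕₚ.≤⇒≤′ (k≤fk j))
                   , <-trans (neg (½^-pos (f j))) (*-pos 0<2 (½^-pos j)))))
    where
    neg : ∀ {z} → 0# < z → - z < 0#
    neg {z} 0<z = <-respˡ-≈ (+-identityˡ (- z)) (<-respʳ-≈ (-‿inverseʳ z) (+-monoˡ-< (- z) 0<z))

  k≤2k : ∀ k → k ℕ.≤ 2 ℕ.* k
  k≤2k k = ℕₚ.m≤m+n k _

  cos-series : ∀ x → ∃ λ l → partialSum (cosTerm x) ⟶ l
  cos-series x = complete _ (alternating-Cauchy x (2 ℕ.*_) k≤2k)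

  sin-series : ∀ x → ∃ λ l → partialSum (sinTerm x) ⟶ l
  sin-series x = complete _
    (alternating-Cauchy x (λ k → suc (2 ℕ.* k)) (λ k → ℕₚ.m≤n⇒m≤1+n (k≤2k k)))

  cos sin : Carrier → Carrier
  cos x = proj₁ (cos-series x)
  sin x = proj₁ (sin-series x)

  -- π is the least positive zero of the sine.
  IsPi : Carrier → Set (c ⊔ ℓ₁ ⊔ ℓ₃)
  IsPi π = 0# < π × sin π ≈ 0# × (∀ x → 0# < x → x < π → ¬ sin x ≈ 0#)

module Plane {c ℓ₁ ℓ₂ ℓ₃} (R : RealNumbers c ℓ₁ ℓ₂ ℓ₃) where

  open RealNumbers R public
  open RealProperties R public

  Point : Set c
  Point = Carrier × Carrier

  infix 4 _≋_
  _≋_ : Rel Point ℓ₁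
  (x , y) ≋ (x′ , y′) = (x ≈ x′) × (y ≈ y′)

  dist² : Point → Point → Carrier
  dist² (x , y) (x′ , y′) = (x - x′) * (x - x′) + (y - y′) * (y - y′)

  data Curve : Set c where
    line   : Point → Point → Curve
    circle : Point → Point → Curve   -- centre, and a point on the circle

  ⟦_⟧ : Curve → Pred Point ℓ₁
  ⟦ line (a₁ , a₂) (b₁ , b₂) ⟧ (x , y) = (x - a₁) * (b₂ - a₂) ≈ (y - a₂) * (b₁ - a₁)
  ⟦ circle A B ⟧ P                     = dist² P A ≈ dist² B A

  -- Only distinct curves are intersected: otherwise every point of a drawn
  -- curve would count as an intersection point.
  module _ {ℓ} (S : Pred Point ℓ) where
    mutual
      data C : Pred Point (c ⊔ ℓ₁ ⊔ ℓ) where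
        given : ∀ {P} → P ∈ S → C P
        meet  : ∀ {k l P} → Drawn k → Drawn l → ¬ (⟦ k ⟧ ≐ ⟦ l ⟧) →
                P ∈ ⟦ k ⟧ → P ∈ ⟦ l ⟧ → C P

      data Drawn : Pred Curve (c ⊔ ℓ₁ ⊔ ℓ) where
        line   : ∀ {A B} → C A → C B → ¬ A ≋ B → Drawn (line A B)
        circle : ∀ {A B} → C A → C B → ¬ A ≋ B → Drawn (circle A B)

  ｛_｝ : Point → Pred Point ℓ₁
  ｛ P ｝ Q = Q ≋ P

  base : Pred Point ℓ₁
  base = ｛ 0# , 0# ｝ ∪ ｛ 1# , 0# ｝

  ∠ : Carrier → Point
  ∠ α = cos α , sin α

  Constructible : Pred Carrier (c ⊔ ℓ₁)
  Constructible α = ∠ α ∈ C base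

  infix 4 _-Sectable_
  _-Sectable_ : ∀ n .{{_ : NonZero n}} → Pred Carrier (c ⊔ ℓ₁)
  n -Sectable α = ∠ (α / n) ∈ C (base ∪ ｛ ∠ α ｝)

  S¹ : Pred Point ℓ₁
  S¹ (x , y) = x * x + y * y ≈ 1#

  -- An angle, viewed as a point of the circle, has many radian measures; all
  -- of them are required to be non-n-sectable.
  NonSectable : ∀ n .{{_ : NonZero n}} → Pred Point (c ⊔ ℓ₁)
  NonSectable n P = (∃ λ α → P ≋ ∠ α) × (∀ α → P ≋ ∠ α → ¬ n -Sectable α)

  Countable : ∀ {ℓ} → Pred Point ℓ → Set (c ⊔ ℓ₁ ⊔ ℓ)
  Countable D = ∃ λ (f : ℕ → Point) → ∀ P → P ∈ D ⇔ (∃ λ k → P ≋ f k)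

  DenseInS¹ : ∀ {ℓ} → Pred Point ℓ → Set (c ⊔ ℓ₁ ⊔ ℓ₃ ⊔ ℓ)
  DenseInS¹ D = ∀ Q → Q ∈ S¹ → ∀ ε → 0# < ε → ∃ λ P → P ∈ D × dist² P Q < ε * ε

-- Let R = (m + i) / (m - i) with m ≡ 2 mod 25, and z = R ^ (1 + n b): the prime 2 + i of ℤ[i]
-- has multiplicity 1 + n b in z.  If wⁿ = z with w constructible from z, then taking norms
-- down a tower of quadratic extensions yields an n-th root of z ^ (2 ^ k) in ℚ(i) for some k,
-- so n divides (1 + n b) 2 ^ k, hence 2 ^ k, which is absurd for an odd n > 1.  Whatever its
-- measure, z is therefore not n-sectable.  For large m the angle of R is small, so the
-- points z are dense in the circle as m and b vary.
--
-- That points of the circle have angles at all is proved near 1 by iterating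
-- α ↦ α + Im (z / cis α), and elsewhere by the addition theorem.

module Submission where

open import Defs using (RealNumbers; module Plane; module RealProperties)
open import Algebra.Bundles using (CommutativeRing)
import Algebra.Properties.CommutativeSemigroup
import Algebra.Properties.CommutativeSemiring.Exp
import Algebra.Properties.Monoid.Mult
import Algebra.Properties.Semiring.Exp
import Algebra.Solver.Ring
open import Algebra.Solver.Ring.AlmostCommutativeRing
  using (fromCommutativeRing; _-Raw-AlmostCommutative⟶_; -raw-almostCommutative⟶)
open import Data.Empty using (⊥; ⊥-elim)
open import Data.Integer.Base as ℤ using (ℤ; +_; -[1+_]; ∣_∣)
open import Data.Integer.Divisibility.Signed as ℤ∣ using (divides)
import Data.Integer.Properties as ℤₚ
open import Data.Maybe.Base using (Maybe; just; nothing)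
open import Data.Nat.Base as ℕ using (ℕ; zero; suc; NonZero)
open import Data.Nat.Coprimality using (Coprime; coprime-divisor)
open import Data.Nat.Divisibility as ℕ∣ using (_∣_)
open import Data.Nat.Primality using (prime?; euclidsLemma; prime⇒irreducible)
import Data.Nat.Properties as ℕₚ
open import Data.Product.Base using (Σ; ∃; _×_; _,_; proj₁; proj₂)
open import Data.Sum.Base using (_⊎_; inj₁; inj₂; [_,_]′)
open import Function.Bundles using (mk⇔; module Equivalence)
open import Level using (_⊔_; Lift; lift) renaming (suc to lsuc)
open import Relation.Binary.PropositionalEquality as ≡ using (_≡_)
open import Relation.Nullary.Decidable using (Dec; yes; no; from-yes; from-no)
open import Relation.Nullary.Negation using (¬_)
open import Relation.Unary using (Pred; _∈_; _⊆_; _≐_; _∪_)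

-- Two demands meet in the exponents `1 + n b`. They are prime to `n`, so the multiplicity of
-- `2 + i` is never a multiple of `n`; and for a rotation of small angle `α` they give the
-- progression `α + b (n α)`, which passes close to every angle without any appeal to the
-- irrationality of `α / π`. Equality of reals is undecidable: whether a square root is new, a
-- coefficient vanishes or two centres agree cannot be decided. Non-sectability is a negation, so
-- such questions are settled under a double negation, and fields are `¬¬`-stable predicates. The
-- tower consists of real fields `F`, with pairs as elements of `F(i)`. Since `s` may already lie in
-- `F`, the conjugation `s ↦ -s` need not be well defined; it is performed on chosen representatives
-- `a + b s`. Each norm squares the right-hand side, so the invariant speaks of all powers
-- `z ^ (2 ^ k)`. Cosine and sine are bare limits of series. The addition theorem is derived from
-- the Cauchy product, and what is needed about angles follows from it together with one estimate of
-- `cis h - 1 - i h`.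

ℤ-Algebra : ∀ {a ℓ} → CommutativeRing a ℓ → Set _
ℤ-Algebra A = ℤ.+-*-rawRing -Raw-AlmostCommutative⟶ fromCommutativeRing A

-- Polynomial identities with integer coefficients, and the ring A[i]

module IntegerSolver {a ℓ} (A : CommutativeRing a ℓ) (hom : ℤ-Algebra A) where

  open CommutativeRing A
  open _-Raw-AlmostCommutative⟶_ hom

  ⟦⟧≟ : ∀ i j → Maybe (⟦ i ⟧ ≈ ⟦ j ⟧)
  ⟦⟧≟ i j with i ℤₚ.≟ j
  ... | yes i≡j = just (reflexive (≡.cong ⟦_⟧ i≡j))
  ... | no  _   = nothing

  open Algebra.Solver.Ring ℤ.+-*-rawRing (fromCommutativeRing A) hom ⟦⟧≟ public
    using (solve; _:=_; _:+_; _:*_; _:-_; :-_; con)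

-- Used twice: over the integers for ℤ[i], and over the reals, where points of the plane become
-- complex numbers.
module Gaussian {a ℓ} (A : CommutativeRing a ℓ) (hom : ℤ-Algebra A) where

  private module A = CommutativeRing A
  open A using (Carrier; _≈_; _+_; _*_; -_; 0#; 1#)
  open _-Raw-AlmostCommutative⟶_ hom
  open IntegerSolver A hom

  infix  4 _≋_
  infixl 6 _⊕_
  infixl 7 _⊗_

  _≋_ : Carrier × Carrier → Carrier × Carrier → Set ℓ
  (a , b) ≋ (c , d) = a ≈ c × b ≈ d

  _⊕_ _⊗_ : Carrier × Carrier → Carrier × Carrier → Carrier × Carrier
  (a , b) ⊕ (c , d) = a + c , b + d
  (a , b) ⊗ (c , d) = a * c + - (b * d) , a * d + b * c

  ⊝ conj : Carrier × Carrier → Carrier × Carrier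
  ⊝ (a , b) = - a , - b
  conj (a , b) = a , - b

  normSq : Carrier × Carrier → Carrier
  normSq (a , b) = a * a + b * b

  private
    -0≈0 : - 0# ≈ 0#
    -0≈0 = A.trans (A.sym (A.+-identityˡ _)) (A.-‿inverseʳ 0#)

    ⊗-cong : ∀ {z z′ w w′} → z ≋ z′ → w ≋ w′ → z ⊗ w ≋ z′ ⊗ w′
    ⊗-cong (p , q) (r , s) =
      A.+-cong (A.*-cong p r) (A.-‿cong (A.*-cong q s)) , A.+-cong (A.*-cong p s) (A.*-cong q r)

    ⊗-assoc : ∀ z w v → (z ⊗ w) ⊗ v ≋ z ⊗ (w ⊗ v)
    ⊗-assoc (a , b) (c , d) (e , f) =
      solve 6 (λ a b c d e f → (a :* c :+ :- (b :* d)) :* e :+ :- ((a :* d :+ b :* c) :* f)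
        := a :* (c :* e :+ :- (d :* f)) :+ :- (b :* (c :* f :+ d :* e))) A.refl a b c d e f ,
      solve 6 (λ a b c d e f → (a :* c :+ :- (b :* d)) :* f :+ (a :* d :+ b :* c) :* e
        := a :* (c :* f :+ d :* e) :+ b :* (c :* e :+ :- (d :* f))) A.refl a b c d e f

    ⊗-comm : ∀ z w → z ⊗ w ≋ w ⊗ z
    ⊗-comm (a , b) (c , d) =
      solve 4 (λ a b c d → a :* c :+ :- (b :* d) := c :* a :+ :- (d :* b)) A.refl a b c d ,
      solve 4 (λ a b c d → a :* d :+ b :* c := c :* b :+ d :* a) A.refl a b c d

    ⊗-identityˡ : ∀ z → (1# , 0#) ⊗ z ≋ z
    ⊗-identityˡ (a , b) =
      A.trans (A.+-cong (A.*-identityˡ a) (A.trans (A.-‿cong (A.zeroˡ b)) -0≈0)) (A.+-identityʳ a) ,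
      A.trans (A.+-cong (A.*-identityˡ b) (A.zeroˡ a)) (A.+-identityʳ b)

    distribˡ : ∀ z w v → z ⊗ (w ⊕ v) ≋ z ⊗ w ⊕ z ⊗ v
    distribˡ (a , b) (c , d) (e , f) =
      solve 6 (λ a b c d e f → a :* (c :+ e) :+ :- (b :* (d :+ f))
        := (a :* c :+ :- (b :* d)) :+ (a :* e :+ :- (b :* f))) A.refl a b c d e f ,
      solve 6 (λ a b c d e f → a :* (d :+ f) :+ b :* (c :+ e)
        := (a :* d :+ b :* c) :+ (a :* f :+ b :* e)) A.refl a b c d e f

    ≋-trans : ∀ {z w v} → z ≋ w → w ≋ v → z ≋ v
    ≋-trans (p , q) (r , s) = A.trans p r , A.trans q s

  gaussianRing : CommutativeRing a ℓ
  gaussianRing = record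
    { Carrier = Carrier × Carrier
    ; _≈_     = _≋_
    ; _+_     = _⊕_
    ; _*_     = _⊗_
    ; -_      = ⊝
    ; 0#      = 0# , 0#
    ; 1#      = 1# , 0#
    ; isCommutativeRing = record
      { isRing = record
        { +-isAbelianGroup = record
          { isGroup = record
            { isMonoid = record
              { isSemigroup = record
                { isMagma = record
                  { isEquivalence = record
                    { refl  = A.refl , A.refl
                    ; sym   = λ (p , q) → A.sym p , A.sym q
                    ; trans = ≋-trans
                    }
                  ; ∙-cong = λ (p , q) (r , s) → A.+-cong p r , A.+-cong q s
                  }
                ; assoc = λ z w v → A.+-assoc _ _ _ , A.+-assoc _ _ _
                }
              ; identity = (λ z → A.+-identityˡ _ , A.+-identityˡ _)
                         , (λ z → A.+-identityʳ _ , A.+-identityʳ _)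
              }
            ; inverse = (λ z → A.-‿inverseˡ _ , A.-‿inverseˡ _)
                      , (λ z → A.-‿inverseʳ _ , A.-‿inverseʳ _)
            ; ⁻¹-cong = λ (p , q) → A.-‿cong p , A.-‿cong q
            }
          ; comm = λ z w → A.+-comm _ _ , A.+-comm _ _
          }
        ; *-cong     = ⊗-cong
        ; *-assoc    = ⊗-assoc
        ; *-identity = ⊗-identityˡ , λ z → ≋-trans (⊗-comm z _) (⊗-identityˡ z)
        ; distrib    = distribˡ , λ z w v → ≋-trans (⊗-comm _ z)
            (≋-trans (distribˡ z w v) (A.+-cong (proj₁ (⊗-comm z w)) (proj₁ (⊗-comm z v)) ,
                                       A.+-cong (proj₂ (⊗-comm z w)) (proj₂ (⊗-comm z v))))
        }
      ; *-comm = ⊗-comm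
      }
    }

  gaussianHom : ℤ-Algebra gaussianRing
  gaussianHom = record
    { ⟦_⟧    = λ i → ⟦ i ⟧ , 0#
    ; +-homo = λ i j → +-homo i j , A.sym (A.+-identityʳ 0#)
    ; *-homo = λ i j →
        A.trans (*-homo i j) (A.sym (A.trans (A.+-congˡ (A.trans (A.-‿cong (A.zeroˡ 0#)) -0≈0))
                                             (A.+-identityʳ _))) ,
        A.sym (A.trans (A.+-cong (A.zeroʳ _) (A.zeroˡ _)) (A.+-identityʳ 0#))
    ; -‿homo = λ i → -‿homo i , A.sym -0≈0
    ; 0-homo = 0-homo , A.refl
    ; 1-homo = 1-homo , A.refl
    }

  module G = CommutativeRing gaussianRing
  open Algebra.Properties.Semiring.Exp G.semiring using () renaming (_^_ to _⊗^_) public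

  normSq-⊗ : ∀ z w → normSq (z ⊗ w) ≈ normSq z * normSq w
  normSq-⊗ (a , b) (c , d) = solve 4 (λ a b c d →
      (a :* c :+ :- (b :* d)) :* (a :* c :+ :- (b :* d)) :+ (a :* d :+ b :* c) :* (a :* d :+ b :* c)
      := (a :* a :+ b :* b) :* (c :* c :+ d :* d)) A.refl a b c d

  conj-⊗ : ∀ z w → conj (z ⊗ w) ≋ conj z ⊗ conj w
  conj-⊗ (a , b) (c , d) =
    solve 4 (λ a b c d → a :* c :+ :- (b :* d) := a :* c :+ :- (:- b :* :- d)) A.refl a b c d ,
    solve 4 (λ a b c d → :- (a :* d :+ b :* c) := a :* :- d :+ :- b :* c) A.refl a b c d

-- Multiplicities of a prime element; the prime 2 + i of ℤ[i]

-- Divisibility by `π` is an abstract predicate, so that in ℤ[i] it can be a decidable congruence.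
-- The axioms ask only that multiples of `π` satisfy it; the converse enters later, for the
-- existence of valuations.
record PrimeElement {a ℓ} p (A : CommutativeRing a ℓ) : Set (a ⊔ ℓ ⊔ lsuc p) where
  open CommutativeRing A
  field
    π        : Carrier
    π∣_      : Carrier → Set p
    π∣-resp  : ∀ {x y} → x ≈ y → π∣ x → π∣ y
    π∤1      : ¬ π∣ 1#
    π∤-*     : ∀ x y → ¬ π∣ x → ¬ π∣ y → ¬ π∣ (x * y)
    π∣π*     : ∀ x → π∣ (π * x)
    π-cancel : ∀ {x y} → π * x ≈ π * y → x ≈ y

module Valuation {a ℓ p} {A : CommutativeRing a ℓ} (prime : PrimeElement p A) where

  open CommutativeRing A renaming (Carrier to ∣A∣)
  open PrimeElement prime

  open Algebra.Properties.Semiring.Exp semiring using (_^_; ^-homo-*; ^-congʳ)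
  open Algebra.Properties.CommutativeSemigroup *-commutativeSemigroup using (interchange)

  π^-cancel : ∀ e {x y} → π ^ e * x ≈ π ^ e * y → x ≈ y
  π^-cancel zero    p = trans (sym (*-identityˡ _)) (trans p (*-identityˡ _))
  π^-cancel (suc e) p = π^-cancel e (π-cancel (trans (sym (*-assoc π _ _)) (trans p (*-assoc π _ _))))

  infix 4 _isValuationOf_
  record _isValuationOf_ (e : ℕ) (x : ∣A∣) : Set (a ⊔ ℓ ⊔ p) where
    constructor factor
    field
      cofactor : ∣A∣
      splits   : x ≈ π ^ e * cofactor
      coprime  : ¬ π∣ cofactor

  valuation-resp : ∀ {e x y} → x ≈ y → e isValuationOf x → e isValuationOf y
  valuation-resp x≈y (factor u p π∤u) = factor u (trans (sym x≈y) p) π∤u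

  valuation-0 : ∀ {x} → ¬ π∣ x → 0 isValuationOf x
  valuation-0 {x} π∤x = factor x (sym (*-identityˡ x)) π∤x

  valuation-π* : ∀ {e x y} → x ≈ π * y → e isValuationOf y → suc e isValuationOf x
  valuation-π* {e} x≈πy (factor u p π∤u) =
    factor u (trans x≈πy (trans (*-congˡ p) (sym (*-assoc π (π ^ e) u)))) π∤u

  valuation-* : ∀ {d e x y} → d isValuationOf x → e isValuationOf y → d ℕ.+ e isValuationOf x * y
  valuation-* {d} {e} (factor u p π∤u) (factor v q π∤v) = factor (u * v)
    (trans (*-cong p q) (trans (interchange (π ^ d) u (π ^ e) v) (*-congʳ (sym (^-homo-* π d e)))))
    (π∤-* u v π∤u π∤v)

  valuation-^ : ∀ {e x} m → e isValuationOf x → m ℕ.* e isValuationOf x ^ m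
  valuation-^ zero    v = valuation-0 π∤1
  valuation-^ (suc m) v = valuation-* v (valuation-^ m v)

  -- If `d` exceeded `e`, cancelling `π ^ e` from the two factorizations would leave `v` divisible
  -- by `π`.
  valuation-≤ : ∀ {d e x} → d isValuationOf x → e isValuationOf x → d ℕ.≤ e
  valuation-≤ {d} {e} (factor u p _) (factor v q π∤v) with d ℕₚ.≤? e
  ... | yes d≤e = d≤e
  ... | no  d≰e = ⊥-elim (π∤v (π∣-resp (sym v≈) (π∣π* (π ^ k * u))))
    where
    k : ℕ
    k = proj₁ (ℕₚ.m≤n⇒∃[o]m+o≡n (ℕₚ.≰⇒> d≰e))

    d≡ : d ≡ e ℕ.+ suc k
    d≡ = ≡.trans (≡.sym (proj₂ (ℕₚ.m≤n⇒∃[o]m+o≡n (ℕₚ.≰⇒> d≰e)))) (≡.sym (ℕₚ.+-suc e k))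

    v≈ : v ≈ π * (π ^ k * u)
    v≈ = trans (π^-cancel e (trans (sym q) (trans p (trans
      (*-congʳ (trans (^-congʳ π d≡) (^-homo-* π e (suc k)))) (*-assoc (π ^ e) _ u)))))
      (*-assoc π (π ^ k) u)

  valuation-unique : ∀ {d e x} → d isValuationOf x → e isValuationOf x → d ≡ e
  valuation-unique p q = ℕₚ.≤-antisym (valuation-≤ p q) (valuation-≤ q p)

  valuation⇒≉0 : ∀ {e x} → e isValuationOf x → ¬ x ≈ 0#
  valuation⇒≉0 {e} (factor u p π∤u) x≈0 =
    π∤u (π∣-resp (trans (zeroʳ π) (sym u≈0)) (π∣π* 0#))
    where
    u≈0 : u ≈ 0#
    u≈0 = π^-cancel e (trans (sym p) (trans x≈0 (sym (zeroʳ (π ^ e)))))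

  -- Comparing the multiplicities of both sides gives `n v(x) = n v(y) + N`.
  valuation-balance : (∀ x → ¬ x ≈ 0# → ∃ λ e → e isValuationOf x) →
    ∀ {α β} → 1 isValuationOf α → 0 isValuationOf β →
    ∀ n N x y .{{_ : NonZero n}} → ¬ y ≈ 0# → x ^ n * β ^ N ≈ y ^ n * α ^ N → n ∣ N
  valuation-balance exists {α} {β} vα vβ n N x y y≉0 eq =
    ℕ∣.∣m+n∣m⇒∣n (≡.subst (n ∣_) (≡.sym exponents) (ℕ∣.m∣m*n (proj₁ vx))) (ℕ∣.m∣m*n (proj₁ vy))
    where
    vy = exists y y≉0

    right : n ℕ.* proj₁ vy ℕ.+ N ℕ.* 1 isValuationOf y ^ n * α ^ N
    right = valuation-* (valuation-^ n (proj₂ vy)) (valuation-^ N vα)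

    0^≈0 : ∀ n .{{_ : NonZero n}} → x ≈ 0# → x ^ n ≈ 0#
    0^≈0 (suc n) x≈0 = trans (*-congʳ x≈0) (zeroˡ _)

    -- The right-hand side has a valuation, hence is nonzero, and so `x` is nonzero too.
    vx = exists x λ x≈0 → valuation⇒≉0 right (trans (sym eq) (trans (*-congʳ (0^≈0 n x≈0)) (zeroˡ _)))

    left : n ℕ.* proj₁ vx ℕ.+ N ℕ.* 0 isValuationOf x ^ n * β ^ N
    left = valuation-* (valuation-^ n (proj₂ vx)) (valuation-^ N vβ)

    exponents : n ℕ.* proj₁ vy ℕ.+ N ≡ n ℕ.* proj₁ vx
    exponents = ≡.trans (≡.cong (n ℕ.* proj₁ vy ℕ.+_) (≡.sym (ℕₚ.*-identityʳ N)))
      (≡.trans (valuation-unique right (valuation-resp eq left))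
        (≡.trans (≡.cong (n ℕ.* proj₁ vx ℕ.+_) (ℕₚ.*-zeroʳ N)) (ℕₚ.+-identityʳ _)))

module GaussianIntegers where

  ℤ-hom : ℤ-Algebra ℤₚ.+-*-commutativeRing
  ℤ-hom = -raw-almostCommutative⟶ (fromCommutativeRing ℤₚ.+-*-commutativeRing)

  module ℤ[i] = Gaussian ℤₚ.+-*-commutativeRing ℤ-hom

  open ℤ[i] using (_≋_; _⊗_; _⊗^_; conj; normSq; gaussianRing; module G)
  open IntegerSolver ℤₚ.+-*-commutativeRing ℤ-hom
  open ≡ using (refl; sym; trans; cong; cong₂; subst)

  -- π = 2 + i divides a + b i exactly when 5 divides a - 2 b.
  π : ℤ × ℤ
  π = + 2 , + 1

  χ : ℤ × ℤ → ℤ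
  χ (a , b) = a ℤ.- + 2 ℤ.* b

  5∣_ : ℤ → Set
  5∣ i = + 5 ℤ∣.∣ i

  -- `χ` lifts the ring homomorphism from ℤ[i] to ℤ/5 with `i ↦ -2`. Since `(-2)² = -1 + 5`, the
  -- lift is multiplicative up to `5 b d`.
  χ-⊗ : ∀ z w → χ (z ⊗ w) ℤ.+ + 5 ℤ.* (proj₂ z ℤ.* proj₂ w) ≡ χ z ℤ.* χ w
  χ-⊗ (a , b) (c , d) = solve 4 (λ a b c d →
    ((a :* c :+ :- (b :* d)) :- con (+ 2) :* (a :* d :+ b :* c)) :+ con (+ 5) :* (b :* d)
    := (a :- con (+ 2) :* b) :* (c :- con (+ 2) :* d)) refl a b c d

  χ-cong : ∀ {z w} → z ≋ w → χ z ≡ χ w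
  χ-cong (p , q) = cong₂ (λ a b → a ℤ.- + 2 ℤ.* b) p q

  5∣*⇒ : ∀ i j → 5∣ (i ℤ.* j) → 5∣ i ⊎ 5∣ j
  5∣*⇒ i j 5∣ij = [ (λ p → inj₁ (ℤ∣.∣ᵤ⇒∣ p)) , (λ p → inj₂ (ℤ∣.∣ᵤ⇒∣ p)) ]′
    (euclidsLemma ∣ i ∣ ∣ j ∣ (from-yes (prime? 5)) (subst (5 ∣_) (ℤₚ.abs-* i j) (ℤ∣.∣⇒∣ᵤ 5∣ij)))

  5∤χ-⊗ : ∀ z w → ¬ 5∣ χ z → ¬ 5∣ χ w → ¬ 5∣ χ (z ⊗ w)
  5∤χ-⊗ z w p q r = [ p , q ]′ (5∣*⇒ (χ z) (χ w) (subst 5∣_ (χ-⊗ z w)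
    (ℤ∣.∣m∣n⇒∣m+n r (divides (proj₂ z ℤ.* proj₂ w) (ℤₚ.*-comm (+ 5) (proj₂ z ℤ.* proj₂ w))))))

  5∣χ-π⊗ : ∀ z → 5∣ χ (π ⊗ z)
  5∣χ-π⊗ (a , b) = divides (ℤ.- b) (solve 2 (λ a b →
    (con (+ 2) :* a :+ :- (con (+ 1) :* b)) :- con (+ 2) :* (con (+ 2) :* b :+ con (+ 1) :* a)
    := :- b :* con (+ 5)) refl a b)

  -- The quotient is `(a + b i) (2 - i) / 5`, evaluated with `a = 2 b + 5 t`.
  5∣χ⇒π⊗ : ∀ z → 5∣ χ z → ∃ λ w → z ≋ π ⊗ w
  5∣χ⇒π⊗ (a , b) (divides t a-2b≡5t) = (b ℤ.+ + 2 ℤ.* t , ℤ.- t) ,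
    trans (solve 2 (λ a b → a := (a :- con (+ 2) :* b) :+ con (+ 2) :* b) refl a b)
      (trans (cong (ℤ._+ + 2 ℤ.* b) a-2b≡5t)
        (solve 2 (λ b t → t :* con (+ 5) :+ con (+ 2) :* b
          := con (+ 2) :* (b :+ con (+ 2) :* t) :+ :- (con (+ 1) :* :- t)) refl b t)) ,
    solve 2 (λ b t → b := con (+ 2) :* :- t :+ con (+ 1) :* (b :+ con (+ 2) :* t)) refl b t

  -- Multiplication by the conjugate `2 - i` turns `π` into its norm 5, which cancels in ℤ.
  π-cancel : ∀ {z w} → π ⊗ z ≋ π ⊗ w → z ≋ w
  π-cancel {z} {w} (p , q) =
    ℤₚ.*-cancelˡ-≡ (+ 5) _ _ (trans (re z) (trans (cong₂ (λ x y → + 2 ℤ.* x ℤ.+ y) p q) (sym (re w)))) ,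
    ℤₚ.*-cancelˡ-≡ (+ 5) _ _ (trans (im z) (trans (cong₂ (λ x y → + 2 ℤ.* y ℤ.- x) p q) (sym (im w))))
    where
    re : ∀ z → + 5 ℤ.* proj₁ z ≡ + 2 ℤ.* proj₁ (π ⊗ z) ℤ.+ proj₂ (π ⊗ z)
    re (a , b) = solve 2 (λ a b → con (+ 5) :* a := con (+ 2) :* (con (+ 2) :* a :+ :- (con (+ 1) :* b))
      :+ (con (+ 2) :* b :+ con (+ 1) :* a)) refl a b

    im : ∀ z → + 5 ℤ.* proj₂ z ≡ + 2 ℤ.* proj₂ (π ⊗ z) ℤ.- proj₁ (π ⊗ z)
    im (a , b) = solve 2 (λ a b → con (+ 5) :* b := con (+ 2) :* (con (+ 2) :* b :+ con (+ 1) :* a)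
      :- (con (+ 2) :* a :+ :- (con (+ 1) :* b))) refl a b

  2+i-prime : PrimeElement _ gaussianRing
  2+i-prime = record
    { π        = π
    ; π∣_      = λ z → 5∣ χ z
    ; π∣-resp  = λ {z} {w} p → subst 5∣_ (χ-cong {z} {w} p)
    ; π∤1      = λ p → from-no (5 ℕ∣.∣? 1) (ℤ∣.∣⇒∣ᵤ p)
    ; π∤-*     = 5∤χ-⊗
    ; π∣π*     = 5∣χ-π⊗
    ; π-cancel = λ {z} {w} → π-cancel {z} {w}
    }

  open Valuation 2+i-prime

  normSqℕ : ℤ × ℤ → ℕ
  normSqℕ (a , b) = ∣ a ∣ ℕ.* ∣ a ∣ ℕ.+ ∣ b ∣ ℕ.* ∣ b ∣

  normSqℕ≡ : ∀ z → + normSqℕ z ≡ normSq z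
  normSqℕ≡ (a , b) = trans (ℤₚ.pos-+ _ (∣ b ∣ ℕ.* ∣ b ∣)) (cong₂ ℤ._+_ (square a) (square b))
    where
    square : ∀ i → + (∣ i ∣ ℕ.* ∣ i ∣) ≡ i ℤ.* i
    square (+ n)    = ℤₚ.pos-* n n
    square -[1+ n ] = refl

  normSqℕ≡0⇒≋0 : ∀ z → normSqℕ z ≡ 0 → z ≋ G.0#
  normSqℕ≡0⇒≋0 (a , b) p = zero-square a (ℕₚ.m+n≡0⇒m≡0 (∣ a ∣ ℕ.* ∣ a ∣) p) ,
                           zero-square b (ℕₚ.m+n≡0⇒n≡0 (∣ a ∣ ℕ.* ∣ a ∣) p)
    where
    zero-square : ∀ i → ∣ i ∣ ℕ.* ∣ i ∣ ≡ 0 → i ≡ + 0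
    zero-square i q = ℤₚ.∣i∣≡0⇒i≡0 ([ (λ r → r) , (λ r → r) ]′ (ℕₚ.m*n≡0⇒m≡0∨n≡0 ∣ i ∣ q))

  normSqℕ-π⊗ : ∀ {z w} → z ≋ π ⊗ w → normSqℕ z ≡ 5 ℕ.* normSqℕ w
  normSqℕ-π⊗ {z} {w} (p , q) = ℤₚ.+-injective (trans (normSqℕ≡ z) (trans
    (cong₂ (λ a b → a ℤ.* a ℤ.+ b ℤ.* b) p q) (trans (ℤ[i].normSq-⊗ π w) (trans
    (cong (λ i → + 5 ℤ.* i) (sym (normSqℕ≡ w))) (sym (ℤₚ.pos-* 5 (normSqℕ w)))))))

  π-division : ∀ z → ¬ 5∣ χ z ⊎ (∃ λ w → z ≋ π ⊗ w)
  π-division z = decide (+ 5 ℤ∣.∣? χ z)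
    where
    decide : Dec (5∣ χ z) → ¬ 5∣ χ z ⊎ (∃ λ w → z ≋ π ⊗ w)
    decide (yes 5∣z) = inj₂ (5∣χ⇒π⊗ z 5∣z)
    decide (no  5∤z) = inj₁ 5∤z

  -- Descent on the norm: dividing out `π` divides `normSqℕ` by 5, and `fuel` bounds the norm.
  valuation-exists : ∀ z → ¬ z ≋ G.0# → ∃ λ e → e isValuationOf z
  valuation-exists z = go (normSqℕ z) z ℕₚ.≤-refl
    where
    fifth : ∀ fuel m → 5 ℕ.* m ℕ.≤ suc fuel → m ℕ.≤ fuel
    fifth fuel zero    _ = ℕ.z≤n
    fifth fuel (suc m) p = ℕₚ.≤-trans (ℕₚ.≤-trans (ℕ.s≤s (ℕₚ.m≤m+n m _)) (ℕₚ.m≤n+m _ m)) (ℕₚ.≤-pred p)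

    go : ∀ fuel z → normSqℕ z ℕ.≤ fuel → ¬ z ≋ G.0# → ∃ λ e → e isValuationOf z
    go zero       z N≤ z≢0 = ⊥-elim (z≢0 (normSqℕ≡0⇒≋0 z (ℕₚ.n≤0⇒n≡0 N≤)))
    go (suc fuel) z N≤ z≢0 = [ (λ 5∤z → 0 , valuation-0 5∤z) , descend ]′ (π-division z)
      where
      descend : (∃ λ w → z ≋ π ⊗ w) → ∃ λ e → e isValuationOf z
      descend (w , z≋πw) = suc (proj₁ vw) , valuation-π* {x = z} {y = w} z≋πw (proj₂ vw)
        where
        vw : ∃ λ e → e isValuationOf w
        vw = go fuel w (fifth fuel (normSqℕ w) (subst (ℕ._≤ suc fuel) (normSqℕ-π⊗ {z} {w} z≋πw) N≤))
          (λ w≋0 → z≢0 (G.trans {z} z≋πw (G.trans {π ⊗ w} (G.*-congˡ {π} {w} w≋0) (G.zeroʳ π))))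

  ∣2^⇒≡1 : ∀ {n} k → ¬ 2 ∣ n → n ∣ 2 ℕ.^ k → n ≡ 1
  ∣2^⇒≡1     zero    2∤n n∣1   = ℕ∣.∣1⇒≡1 n∣1
  ∣2^⇒≡1 {n} (suc k) 2∤n n∣2^k = ∣2^⇒≡1 k 2∤n (coprime-divisor coprime n∣2^k)
    where
    coprime : Coprime n 2
    coprime (d∣n , d∣2) = [ (λ d≡1 → d≡1) , (λ d≡2 → ⊥-elim (2∤n (subst (_∣ n) d≡2 d∣n))) ]′
      (prime⇒irreducible (from-yes (prime? 2)) d∣2)

  -- m ≡ 2 mod 25 makes m + i divisible by 2 + i exactly once, and m - i not at all.
  centre : ℕ → ℕ
  centre j = 2 ℕ.+ 25 ℕ.* j

  centre≡ : ∀ j → + centre j ≡ + 2 ℤ.+ + 25 ℤ.* + j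
  centre≡ j = trans (ℤₚ.pos-+ 2 (25 ℕ.* j)) (cong (λ i → + 2 ℤ.+ i) (ℤₚ.pos-* 25 j))

  upper : ℕ → ℤ × ℤ
  upper j = + centre j , + 1

  valuation-upper : ∀ j → 1 isValuationOf upper j
  valuation-upper j = valuation-π* {x = upper j} {y = w}
    ( trans (centre≡ j) (solve 1 (λ j → con (+ 2) :+ con (+ 25) :* j
        := con (+ 2) :* (con (+ 1) :+ con (+ 10) :* j) :+ :- (con (+ 1) :* :- (con (+ 5) :* j))) refl (+ j))
    , solve 1 (λ j → con (+ 1)
        := con (+ 2) :* :- (con (+ 5) :* j) :+ con (+ 1) :* (con (+ 1) :+ con (+ 10) :* j)) refl (+ j) )
    (valuation-0 λ 5∣ → from-no (5 ℕ∣.∣? 1) (ℤ∣.∣⇒∣ᵤ (subst 5∣_ (solve 1 (λ j →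
        ((con (+ 1) :+ con (+ 10) :* j) :- con (+ 2) :* :- (con (+ 5) :* j)) :+ :- (con (+ 4) :* j) :* con (+ 5)
        := con (+ 1)) refl (+ j))
      (ℤ∣.∣m∣n⇒∣m+n 5∣ (divides (ℤ.- (+ 4 ℤ.* + j)) refl)))))
    where
    w : ℤ × ℤ
    -- The quotient `(m + i) / (2 + i)`. The modulus 25 makes `χ w = 1 + 20 j`; with modulus 5 it
    -- would be `1 + 4 j`, which 5 divides for `j = 1`.
    w = + 1 ℤ.+ + 10 ℤ.* + j , ℤ.- (+ 5 ℤ.* + j)

  -- `χ` takes `m - i` to `m + 2 = 4 + 25 j`, which is 4 modulo 5.
  valuation-lower : ∀ j → 0 isValuationOf conj (upper j)
  valuation-lower j = valuation-0 λ 5∣ → from-no (5 ℕ∣.∣? 4) (ℤ∣.∣⇒∣ᵤ (subst 5∣_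
    (trans (cong (λ m → m ℤ.- + 2 ℤ.* ℤ.- + 1 ℤ.+ ℤ.- (+ 5 ℤ.* + j) ℤ.* + 5) (centre≡ j))
      (solve 1 (λ j → (con (+ 2) :+ con (+ 25) :* j) :- con (+ 2) :* :- con (+ 1) :+ :- (con (+ 5) :* j) :* con (+ 5)
        := con (+ 4)) refl (+ j)))
    (ℤ∣.∣m∣n⇒∣m+n 5∣ (divides (ℤ.- (+ 5 ℤ.* + j)) refl))))

  -- The refuted equation is `(z / q) ^ n = R ^ N` with denominators cleared. It would make `n`
  -- divide `(1 + n b) 2 ^ k = 2 ^ k + n b 2 ^ k`, hence `2 ^ k`.
  no-root : ∀ n → 1 ℕ.< n → ¬ 2 ∣ n → ∀ j b k z q → ¬ q ≋ G.0# →
    let N = suc (n ℕ.* b) ℕ.* 2 ℕ.^ k in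
    ¬ (z ⊗^ n) ⊗ (conj (upper j) ⊗^ N) ≋ (q ⊗^ n) ⊗ (upper j ⊗^ N)
  no-root n@(suc _) 1<n 2∤n j b k z q q≢0 eq = ℕₚ.<-irrefl (sym (∣2^⇒≡1 k 2∤n n∣2^k)) 1<n
    where
    n∣N : n ∣ suc (n ℕ.* b) ℕ.* 2 ℕ.^ k
    n∣N = valuation-balance valuation-exists (valuation-upper j) (valuation-lower j) n _ z q q≢0 eq

    n∣2^k : n ∣ 2 ℕ.^ k
    n∣2^k = ℕ∣.∣m+n∣m⇒∣n (subst (n ∣_) (ℕₚ.+-comm (2 ℕ.^ k) _) n∣N)
      (ℕ∣.∣m⇒∣m*n (2 ℕ.^ k) (ℕ∣.m∣m*n b))

module Z = GaussianIntegers
open GaussianIntegers using (module ℤ[i])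

-- Subfields of the reals and straightedge-and-compass constructions

module Order {c ℓ₁ ℓ₂ ℓ₃} (R : RealNumbers c ℓ₁ ℓ₂ ℓ₃) where

  open Plane R
  open IntegerSolver commutativeRing morphism

  #⇒<⊎> : ∀ {x y} → x # y → x < y ⊎ y < x
  #⇒<⊎> {x} {y} = Equivalence.to (#⇔<⊎> x y)

  <⇒# : ∀ {x y} → x < y → x # y
  <⇒# {x} {y} x<y = Equivalence.from (#⇔<⊎> x y) (inj₁ x<y)

  <-asym : ∀ {x y} → x < y → ¬ y < x
  <-asym x<y y<x = <-irrefl refl (<-trans x<y y<x)

  -- The constructive substitute for trichotomy: case distinctions in the estimates compare a number
  -- with two separated thresholds.
  <-cotrans : ∀ {x y} → x < y → ∀ z → x < z ⊎ z < y
  <-cotrans {x} {y} x<y z = [ left , right ]′ (#-cotrans (<⇒# x<y) z)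
    where
    left : x # z → x < z ⊎ z < y
    left x#z = [ inj₁ , (λ z<x → inj₂ (<-trans z<x x<y)) ]′ (#⇒<⊎> x#z)
    right : z # y → x < z ⊎ z < y
    right z#y = [ inj₂ , (λ y<z → inj₁ (<-trans x<y y<z)) ]′ (#⇒<⊎> z#y)

  ¬#⇒≈ : ∀ {x y} → ¬ x # y → x ≈ y
  ¬#⇒≈ {x} {y} = proj₁ (tight x y)

  ≈⇒¬# : ∀ {x y} → x ≈ y → ¬ x # y
  ≈⇒¬# {x} {y} = proj₂ (tight x y)

  -- By tightness equality is the negation of apartness, so it may be proved by contradiction.
  ≈-stable : ∀ {x y} → ¬ ¬ x ≈ y → x ≈ y
  ≈-stable ¬¬p = ¬#⇒≈ λ x#y → ¬¬p λ x≈y → ≈⇒¬# x≈y x#y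

  -0≈0 : - 0# ≈ 0#
  -0≈0 = solve 0 (:- con (+ 0) := con (+ 0)) refl

  x-y≈0⇒x≈y : ∀ {x y} → x - y ≈ 0# → x ≈ y
  x-y≈0⇒x≈y {x} {y} p = trans (solve 2 (λ x y → x := (x :- y) :+ y) refl x y)
    (trans (+-congʳ p) (+-identityˡ y))

  neg-pos : ∀ {x} → x < 0# → 0# < - x
  neg-pos {x} x<0 = <-respʳ-≈ (+-identityˡ (- x)) (<⇒0<- x<0)

  #0⇒invertible : ∀ {x} → x # 0# → ∃ λ y → x * y ≈ 1#
  #0⇒invertible {x} x#0 = let y , yx≈1 , _ = #⇒invertible x#0 in
    y , trans (*-comm x y) (trans (*-congˡ (sym (0#-0#≈ x))) yx≈1)

  -- Each use ends in `⊥` or in a stable equality, where the double negation does no harm.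
  zero-or-invertible : ∀ x → ¬ ¬ (x ≈ 0# ⊎ (∃ λ y → x * y ≈ 1#))
  zero-or-invertible x k = k (inj₁ (¬#⇒≈ λ x#0 → k (inj₂ (#0⇒invertible x#0))))

  0≉1 : ¬ 0# ≈ 1#
  0≉1 p = <-irrefl p 0<1

  invertible⇒≉0 : ∀ {x y} → x * y ≈ 1# → ¬ x ≈ 0#
  invertible⇒≉0 {x} {y} xy≈1 x≈0 = 0≉1 (trans (sym (zeroˡ y)) (trans (*-congʳ (sym x≈0)) xy≈1))

  cancel-invertible : ∀ {x y z} → x * z ≈ 1# → x * y ≈ 0# → y ≈ 0#
  cancel-invertible {x} {y} {z} xz≈1 xy≈0 = trans (sym (*-identityˡ y)) (trans (*-congʳ (sym xz≈1))
    (trans (solve 3 (λ x y z → (x :* z) :* y := z :* (x :* y)) refl x y z)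
      (trans (*-congˡ xy≈0) (zeroʳ z))))

  no-zero-divisors : ∀ {x y} → ¬ x ≈ 0# → x * y ≈ 0# → y ≈ 0#
  no-zero-divisors {x} x≉0 xy≈0 = ≈-stable λ k → zero-or-invertible x
    [ x≉0 , (λ (_ , xz≈1) → k (cancel-invertible xz≈1 xy≈0)) ]′

  square-pos : ∀ {x} → x # 0# → 0# < x * x
  square-pos {x} x#0 = [ (λ x<0 → <-respʳ-≈ (solve 1 (λ x → :- x :* :- x := x :* x) refl x)
                           (*-pos (neg-pos x<0) (neg-pos x<0)))
                       , (λ 0<x → *-pos 0<x 0<x) ]′ (#⇒<⊎> x#0)

  square-nonneg : ∀ x → ¬ x * x < 0#
  square-nonneg x x²<0 = <-irrefl (trans (*-congʳ x≈0) (zeroˡ x)) x²<0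
    where
    x≈0 : x ≈ 0#
    x≈0 = ¬#⇒≈ λ x#0 → <-asym (square-pos x#0) x²<0

  squares≈0 : ∀ {x y} → x * x + y * y ≈ 0# → x ≈ 0#
  squares≈0 {x} {y} p = ¬#⇒≈ λ x#0 → square-nonneg y (<-respʳ-≈ p
    (<-respˡ-≈ (+-identityˡ (y * y)) (+-monoˡ-< (y * y) (square-pos x#0))))

module Subfields {c ℓ₁ ℓ₂ ℓ₃} (R : RealNumbers c ℓ₁ ℓ₂ ℓ₃) where

  open Plane R
  open Order R
  open IntegerSolver commutativeRing morphism
  module E = Gaussian commutativeRing morphism
  open E using (_⊕_; _⊗_; _⊗^_; ⊝; module G)
  open Algebra.Properties.Semiring.Exp G.semiring
    using () renaming (^-homo-* to ⊗^-homo-*; ^-congˡ to ⊗^-congˡ)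
  open Algebra.Properties.CommutativeSemiring.Exp G.commutativeSemiring
    using () renaming (^-distrib-* to ⊗^-distrib-⊗)

  -- Membership is ¬¬-stable, which makes inverses in simple extensions available
  -- without deciding equality.
  record Subfield {ℓ} (F : Pred Carrier ℓ) : Set (c ⊔ ℓ₁ ⊔ ℓ) where
    field
      resp     : ∀ {x y} → x ≈ y → F x → F y
      stable   : ∀ {x} → ¬ ¬ F x → F x
      one      : F 1#
      plus     : ∀ {x y} → F x → F y → F (x + y)
      neg      : ∀ {x} → F x → F (- x)
      times    : ∀ {x y} → F x → F y → F (x * y)
      inverse∈ : ∀ {x y} → F x → x * y ≈ 1# → F y

    zero∈ : F 0#
    zero∈ = resp (-‿inverseʳ 1#) (plus one (neg one))

    minus : ∀ {x y} → F x → F y → F (x - y)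
    minus p q = plus p (neg q)

  infix 8 _²
  _² : ∀ {ℓ} → Pred Carrier ℓ → Pred Point ℓ
  (F ²) (x , y) = F x × F y

  module _ {ℓ} {F : Pred Carrier ℓ} (K : Subfield F) where
    open Subfield K

    ²-resp : ∀ {z w} → z ≋ w → (F ²) z → (F ²) w
    ²-resp (p , q) (r , s) = resp p r , resp q s

    ²-⊕ : ∀ {z w} → (F ²) z → (F ²) w → (F ²) (z ⊕ w)
    ²-⊕ (p , q) (r , s) = plus p r , plus q s

    ²-⊗ : ∀ {z w} → (F ²) z → (F ²) w → (F ²) (z ⊗ w)
    ²-⊗ (p , q) (r , s) = minus (times p r) (times q s) , plus (times p s) (times q r)

    ²-⊝ : ∀ {z} → (F ²) z → (F ²) (⊝ z)
    ²-⊝ (p , q) = neg p , neg q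

    ²-^ : ∀ {z} m → (F ²) z → (F ²) (z ⊗^ m)
    ²-^ zero    p = one , zero∈
    ²-^ (suc m) p = ²-⊗ p (²-^ m p)

  infix 8 _⟨_⟩
  -- The double negation makes membership stable. The pair `a , b` need not be unique, since `s` may
  -- lie in `F`.
  _⟨_⟩ : ∀ {ℓ} → Pred Carrier ℓ → Carrier → Pred Carrier (c ⊔ ℓ₁ ⊔ ℓ)
  (F ⟨ s ⟩) x = ¬ ¬ (∃ λ a → ∃ λ b → F a × F b × x ≈ a + b * s)

  module _ {ℓ} {F : Pred Carrier ℓ} (K : Subfield F) (s : Carrier) where
    open Subfield K

    adjoin-⊆ : F ⊆ F ⟨ s ⟩
    adjoin-⊆ {x} x∈ k = k (x , 0# , x∈ , zero∈ ,
      solve 2 (λ x s → x := x :+ con (+ 0) :* s) refl x s)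

    adjoin-trivial : F s → F ⟨ s ⟩ ⊆ F
    adjoin-trivial s∈ x∈ = stable λ k → x∈ λ (a , b , a∈ , b∈ , x≈) →
      k (resp (sym x≈) (plus a∈ (times b∈ s∈)))

    adjoin-subfield : F (s * s) → Subfield (F ⟨ s ⟩)
    adjoin-subfield s²∈ = record
      { resp     = λ x≈y x∈ k → x∈ λ (a , b , a∈ , b∈ , x≈) → k (a , b , a∈ , b∈ , trans (sym x≈y) x≈)
      ; stable   = λ ¬¬x∈ k → ¬¬x∈ λ x∈ → x∈ k
      ; one      = adjoin-⊆ one
      ; plus     = λ x∈ y∈ k → x∈ λ (a , b , a∈ , b∈ , x≈) → y∈ λ (a′ , b′ , a′∈ , b′∈ , y≈) →
          k (a + a′ , b + b′ , plus a∈ a′∈ , plus b∈ b′∈ , trans (+-cong x≈ y≈)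
            (solve 5 (λ a b a′ b′ s → (a :+ b :* s) :+ (a′ :+ b′ :* s) := (a :+ a′) :+ (b :+ b′) :* s)
              refl a b a′ b′ s))
      ; neg      = λ x∈ k → x∈ λ (a , b , a∈ , b∈ , x≈) → k (- a , - b , neg a∈ , neg b∈ ,
          trans (-‿cong x≈) (solve 3 (λ a b s → :- (a :+ b :* s) := :- a :+ :- b :* s) refl a b s))
      ; times    = λ x∈ y∈ k → x∈ λ (a , b , a∈ , b∈ , x≈) → y∈ λ (a′ , b′ , a′∈ , b′∈ , y≈) →
          k (a * a′ + (b * b′) * (s * s) , a * b′ + b * a′ ,
             plus (times a∈ a′∈) (times (times b∈ b′∈) s²∈) , plus (times a∈ b′∈) (times b∈ a′∈) ,
             trans (*-cong x≈ y≈) (solve 5 (λ a b a′ b′ s → (a :+ b :* s) :* (a′ :+ b′ :* s)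
               := (a :* a′ :+ (b :* b′) :* (s :* s)) :+ (a :* b′ :+ b :* a′) :* s) refl a b a′ b′ s))
      ; inverse∈ = inverse⟨⟩
      }
      where
      -- The inverse of `a + b s` is `a - b s` over the norm `a² - b² s²`. If the norm vanishes,
      -- invertibility of `x` forces `a = b s`; then `x = 2 a` lies in `F`, and so does its inverse.
      inverse⟨⟩ : ∀ {x y} → (F ⟨ s ⟩) x → x * y ≈ 1# → (F ⟨ s ⟩) y
      inverse⟨⟩ {x} {y} x∈ xy≈1 k = x∈ λ (a , b , a∈ , b∈ , x≈) →
        let norm≈ : (a + b * s) * (a - b * s) ≈ a * a - (b * b) * (s * s)
            norm≈ = solve 3 (λ a b s → (a :+ b :* s) :* (a :- b :* s) := a :* a :- (b :* b) :* (s :* s))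
              refl a b s
            norm∈ : F (a * a - (b * b) * (s * s))
            norm∈ = minus (times a∈ a∈) (times (times b∈ b∈) s²∈)
        in zero-or-invertible (a * a - (b * b) * (s * s))
          [ (λ norm≈0 →
               let a-bs≈0 : a - b * s ≈ 0#
                   a-bs≈0 = cancel-invertible xy≈1 (trans (*-congʳ x≈) (trans norm≈ norm≈0))
                   x≈2a : x ≈ a + a
                   x≈2a = trans x≈ (trans (solve 3 (λ a b s → a :+ b :* s := (a :+ a) :- (a :- b :* s))
                     refl a b s) (trans (+-congˡ (-‿cong a-bs≈0)) (0#-0#≈ _)))
               in adjoin-⊆ (inverse∈ (resp (sym x≈2a) (plus a∈ a∈)) xy≈1) k)
          , (λ (v , Nv≈1) → k (a * v , - b * v , times a∈ (inverse∈ norm∈ Nv≈1) ,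
               times (neg b∈) (inverse∈ norm∈ Nv≈1) , trans (sym (*-identityʳ y)) (trans
                 (*-congˡ (trans (sym Nv≈1) (*-congʳ (trans (sym norm≈) (*-congʳ (sym x≈))))))
                 (trans (solve 6 (λ x y a b s v → y :* ((x :* (a :- b :* s)) :* v)
                     := (x :* y) :* (a :* v :+ (:- b :* v) :* s)) refl x y a b s v)
                   (trans (*-congʳ xy≈1) (*-identityˡ _))))))
          ]′

  module E-Solver = IntegerSolver E.gaussianRing E.gaussianHom

  module RootObstruction (n : ℕ) (z : Point) where

    -- All exponents `2 ^ k` occur at once because the step up the tower consumes them: a root of
    -- `z ^ (2 ^ k)` above yields, by its norm, a root of `z ^ (2 ^ suc k)` below.
    record Rootless (F : Pred Carrier (c ⊔ ℓ₁)) : Set (lsuc (c ⊔ ℓ₁)) where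
      field
        subfield : Subfield F
        base∈    : (F ²) z
        no-root  : ∀ k w → (F ²) w → ¬ w ⊗^ n ≋ z ⊗^ (2 ℕ.^ k)

    module _ {F : Pred Carrier (c ⊔ ℓ₁)} (K : Subfield F) (s : Carrier) (s²∈ : F (s * s)) where
      open Subfield K
      open E-Solver using () renaming (solve to solveᴱ; _:=_ to _:=ᴱ_; _:+_ to _:+ᴱ_; _:*_ to _:*ᴱ_; :-_ to :-ᴱ_)

      S : Point
      S = s , 0#

      S²∈ : (F ²) (S ⊗ S)
      S²∈ = resp (solve 1 (λ s → s :* s := s :* s :+ :- (con (+ 0) :* con (+ 0))) refl s) s²∈ ,
            resp (solve 1 (λ s → con (+ 0) := s :* con (+ 0) :+ con (+ 0) :* s) refl s) zero∈

      -- The same `A` and `B` serve both powers, because only `S ⊗ S` is ever reduced and it does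
      -- not see the sign of `S`.
      conjugate-powers : ∀ {a b} → (F ²) a → (F ²) b → ∀ m → ∃ λ A → ∃ λ B → (F ²) A × (F ²) B ×
        (a ⊕ b ⊗ S) ⊗^ m ≋ A ⊕ B ⊗ S × (a ⊕ ⊝ b ⊗ S) ⊗^ m ≋ A ⊕ ⊝ B ⊗ S
      conjugate-powers a∈ b∈ zero = G.1# , G.0# , (one , zero∈) , (zero∈ , zero∈) ,
        G.sym (G.trans (G.+-congˡ {G.1#} (G.zeroˡ S)) (G.+-identityʳ G.1#)) ,
        G.sym (G.trans (G.+-congˡ {G.1#} (G.trans (G.*-congʳ {S} {⊝ G.0#} {G.0#} (-0≈0 , -0≈0)) (G.zeroˡ S)))
                       (G.+-identityʳ G.1#))
      conjugate-powers {a} {b} a∈ b∈ (suc m) =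
        let A , B , A∈ , B∈ , p , q = conjugate-powers a∈ b∈ m in
        a ⊗ A ⊕ (b ⊗ B) ⊗ (S ⊗ S) , a ⊗ B ⊕ b ⊗ A ,
        ²-⊕ K (²-⊗ K a∈ A∈) (²-⊗ K (²-⊗ K b∈ B∈) S²∈) , ²-⊕ K (²-⊗ K a∈ B∈) (²-⊗ K b∈ A∈) ,
        G.trans (G.*-congˡ {a ⊕ b ⊗ S} p) (solveᴱ 5 (λ a b A B S → (a :+ᴱ b :*ᴱ S) :*ᴱ (A :+ᴱ B :*ᴱ S)
          :=ᴱ (a :*ᴱ A :+ᴱ (b :*ᴱ B) :*ᴱ (S :*ᴱ S)) :+ᴱ (a :*ᴱ B :+ᴱ b :*ᴱ A) :*ᴱ S) G.refl a b A B S) ,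
        G.trans (G.*-congˡ {a ⊕ ⊝ b ⊗ S} q) (solveᴱ 5 (λ a b A B S → (a :+ᴱ (:-ᴱ b) :*ᴱ S) :*ᴱ (A :+ᴱ (:-ᴱ B) :*ᴱ S)
          :=ᴱ (a :*ᴱ A :+ᴱ (b :*ᴱ B) :*ᴱ (S :*ᴱ S)) :+ᴱ (:-ᴱ (a :*ᴱ B :+ᴱ b :*ᴱ A)) :*ᴱ S) G.refl a b A B S)

      -- With (a + b s)ⁿ = A + B s over F, either B = 0 and the norm a² - b² s² is an
      -- n-th root of the square of A, or B ≠ 0 and s already lies in F.
      no-root-adjoin : (F ²) z → (∀ k w → (F ²) w → ¬ w ⊗^ n ≋ z ⊗^ (2 ℕ.^ k)) →
                       ∀ k w → ((F ⟨ s ⟩) ²) w → ¬ w ⊗^ n ≋ z ⊗^ (2 ℕ.^ k)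
      no-root-adjoin z∈ no-root k w (x∈ , y∈) wⁿ≋Z =
        x∈ λ (x₀ , x₁ , x₀∈ , x₁∈ , x≈) → y∈ λ (y₀ , y₁ , y₀∈ , y₁∈ , y≈) →
        let a = x₀ , y₀
            b = x₁ , y₁
            w≋ : w ≋ a ⊕ b ⊗ S
            w≋ = trans x≈ (solve 4 (λ x₀ x₁ y₁ s → x₀ :+ x₁ :* s
                     := x₀ :+ (x₁ :* s :+ :- (y₁ :* con (+ 0)))) refl x₀ x₁ y₁ s) ,
                 trans y≈ (solve 4 (λ y₀ x₁ y₁ s → y₀ :+ y₁ :* s
                     := y₀ :+ (x₁ :* con (+ 0) :+ y₁ :* s)) refl y₀ x₁ y₁ s)
            A , B , A∈ , B∈ , p , q = conjugate-powers {a} {b} (x₀∈ , y₀∈) (x₁∈ , y₁∈) n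
            Z≋ : Z ≋ A ⊕ B ⊗ S
            Z≋ = G.trans (G.sym wⁿ≋Z) (G.trans (⊗^-congˡ n w≋) p)
        in zero-or-invertible (proj₁ B)
          [ (λ B₁≈0 → zero-or-invertible (proj₂ B)
            [ (λ B₂≈0 → rational-case a b A B (x₀∈ , y₀∈) (x₁∈ , y₁∈) (B₁≈0 , B₂≈0) p q Z≋)
            , (λ (v , B₂v≈1) → s∈-case (resp (quotient {proj₂ A} {proj₂ B} {v} {proj₂ Z} B₂v≈1 (trans (proj₂ Z≋)
                 (solve 4 (λ A B s B′ → A :+ (B′ :* con (+ 0) :+ B :* s) := A :+ B :* s)
                   refl (proj₂ A) (proj₂ B) s (proj₁ B))))
                (times (minus (proj₂ Z∈) (proj₂ A∈)) (inverse∈ (proj₂ B∈) B₂v≈1)))) ]′)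
          , (λ (v , B₁v≈1) → s∈-case (resp (quotient {proj₁ A} {proj₁ B} {v} {proj₁ Z} B₁v≈1 (trans (proj₁ Z≋)
               (solve 4 (λ A B s B′ → A :+ (B :* s :+ :- (B′ :* con (+ 0))) := A :+ B :* s)
                 refl (proj₁ A) (proj₁ B) s (proj₂ B))))
              (times (minus (proj₁ Z∈) (proj₁ A∈)) (inverse∈ (proj₁ B∈) B₁v≈1)))) ]′
        where
        Z : Point
        Z = z ⊗^ (2 ℕ.^ k)

        Z∈ : (F ²) Z
        Z∈ = ²-^ K (2 ℕ.^ k) z∈

        s∈-case : F s → ⊥
        s∈-case s∈ = no-root k w (adjoin-trivial K s s∈ x∈ , adjoin-trivial K s s∈ y∈) wⁿ≋Z

        quotient : ∀ {A B v Z} → B * v ≈ 1# → Z ≈ A + B * s → (Z - A) * v ≈ s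
        quotient {A} {B} {v} Bv≈1 Z≈ = trans (*-congʳ (+-congʳ Z≈)) (trans
          (solve 4 (λ A B s v → ((A :+ B :* s) :- A) :* v := (B :* v) :* s) refl A B s v)
          (trans (*-congʳ Bv≈1) (*-identityˡ s)))

        rational-case : ∀ a b A B → (F ²) a → (F ²) b → B ≋ G.0# →
          (a ⊕ b ⊗ S) ⊗^ n ≋ A ⊕ B ⊗ S → (a ⊕ ⊝ b ⊗ S) ⊗^ n ≋ A ⊕ ⊝ B ⊗ S → Z ≋ A ⊕ B ⊗ S → ⊥
        rational-case a b A B a∈ b∈ B≋0 p q Z≋ = no-root (suc k) N N∈ (G.trans Nⁿ≋ (G.sym
          -- `2 ^ suc k` unfolds to `2 ^ k + (2 ^ k + 0)`, hence the extra trivial factor.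
          (G.trans (⊗^-homo-* z (2 ℕ.^ k) _) (G.*-congˡ {Z}
            (G.trans (⊗^-homo-* z (2 ℕ.^ k) 0) (G.*-identityʳ Z))))))
          where
          N : Point
          N = (a ⊕ b ⊗ S) ⊗ (a ⊕ ⊝ b ⊗ S)

          N∈ : (F ²) N
          N∈ = ²-resp K (solveᴱ 3 (λ a b S → a :*ᴱ a :+ᴱ (:-ᴱ (b :*ᴱ b)) :*ᴱ (S :*ᴱ S)
                 :=ᴱ (a :+ᴱ b :*ᴱ S) :*ᴱ (a :+ᴱ (:-ᴱ b) :*ᴱ S)) G.refl a b S)
               (²-⊕ K (²-⊗ K a∈ a∈) (²-⊗ K (²-⊝ K (²-⊗ K b∈ b∈)) S²∈))

          conjugate : A ⊕ ⊝ B ⊗ S ≋ Z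
          conjugate = G.trans (solveᴱ 3 (λ A B S → A :+ᴱ (:-ᴱ B) :*ᴱ S
              :=ᴱ (A :+ᴱ B :*ᴱ S) :+ᴱ B :*ᴱ (:-ᴱ (S :+ᴱ S))) G.refl A B S)
            (G.trans (G.+-cong (G.sym Z≋) (G.trans (G.*-congʳ {⊝ (S ⊕ S)} B≋0) (G.zeroˡ _)))
              (G.+-identityʳ Z))

          Nⁿ≋ : N ⊗^ n ≋ Z ⊗ Z
          Nⁿ≋ = G.trans (⊗^-distrib-⊗ (a ⊕ b ⊗ S) (a ⊕ ⊝ b ⊗ S) n)
            (G.*-cong (G.trans p (G.sym Z≋)) (G.trans q conjugate))

    adjoin-rootless : ∀ {F} → Rootless F → ∀ s → F (s * s) → Rootless (F ⟨ s ⟩)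
    adjoin-rootless {F} Φ s s²∈ = record
      { subfield = adjoin-subfield K s s²∈
      ; base∈    = adjoin-⊆ K s (proj₁ base∈) , adjoin-⊆ K s (proj₂ base∈)
      ; no-root  = no-root-adjoin K s s²∈ base∈ no-root
      }
      where
      open Rootless Φ renaming (subfield to K)

-- Intersection points lie in quadratic extensions

module Intersections {c ℓ₁ ℓ₂ ℓ₃} (R : RealNumbers c ℓ₁ ℓ₂ ℓ₃) where

  open Plane R
  open Order R
  open Subfields R
  open IntegerSolver commutativeRing morphism

  x≈y⇒x-y≈0 : ∀ {x y} → x ≈ y → x - y ≈ 0#
  x≈y⇒x-y≈0 {x} {y} p = trans (+-congʳ p) (-‿inverseʳ y)

  transport : ∀ {x y u v} → x ≈ y → x - y ≈ u - v → u ≈ v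
  transport x≈y p = x-y≈0⇒x≈y (trans (sym p) (x≈y⇒x-y≈0 x≈y))

  module _ {ℓ} (F : Pred Carrier ℓ) where

    -- A line as the solution set of an equation, so that the radical axis of two circles, which
    -- comes without two points, is treated alike. Both directions are recorded because distinctness
    -- of curves concerns their sets of points.
    record Linear (L : Pred Point ℓ₁) : Set (c ⊔ ℓ₁ ⊔ ℓ) where
      field
        p q e      : Carrier
        p∈         : F p
        q∈         : F q
        e∈         : F e
        nontrivial : ¬ (p ≈ 0# × q ≈ 0#)
        equation   : ∀ {P} → P ∈ L → p * proj₁ P + q * proj₂ P ≈ e
        solution   : ∀ {P} → p * proj₁ P + q * proj₂ P ≈ e → P ∈ L

    data Over : Curve → Set (c ⊔ ℓ₁ ⊔ ℓ) where
      line   : ∀ {A B} → (F ²) A → (F ²) B → ¬ A ≋ B → Over (line A B)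
      circle : ∀ {A B} → (F ²) A → (F ²) B → Over (circle A B)

    Quadratic : Point → Set (c ⊔ ℓ₁ ⊔ ℓ)
    Quadratic P = ¬ ¬ (∃ λ s → F (s * s) × ((F ⟨ s ⟩) ²) P)

  module _ {ℓ} {F : Pred Carrier ℓ} (K : Subfield F) where
    open Subfield K

    line-linear : ∀ {A B} → (F ²) A → (F ²) B → ¬ A ≋ B → Linear F ⟦ line A B ⟧
    line-linear {a₁ , a₂} {b₁ , b₂} (a₁∈ , a₂∈) (b₁∈ , b₂∈) A≢B = record
      { p = b₂ - a₂
      ; q = a₁ - b₁
      ; e = (b₂ - a₂) * a₁ + (a₁ - b₁) * a₂
      ; p∈ = minus b₂∈ a₂∈
      ; q∈ = minus a₁∈ b₁∈
      ; e∈ = plus (times (minus b₂∈ a₂∈) a₁∈) (times (minus a₁∈ b₁∈) a₂∈)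
      ; nontrivial = λ (p≈0 , q≈0) → A≢B (x-y≈0⇒x≈y q≈0 , sym (x-y≈0⇒x≈y p≈0))
      ; equation = λ {(x , y)} P∈ → transport P∈ (identity x y)
      ; solution = λ {(x , y)} eq → transport eq (sym (identity x y))
      }
      where
      identity : ∀ x y → (x - a₁) * (b₂ - a₂) - (y - a₂) * (b₁ - a₁)
                       ≈ ((b₂ - a₂) * x + (a₁ - b₁) * y) - ((b₂ - a₂) * a₁ + (a₁ - b₁) * a₂)
      identity x y = solve 6 (λ a₁ a₂ b₁ b₂ x y →
        (x :- a₁) :* (b₂ :- a₂) :- (y :- a₂) :* (b₁ :- a₁)
        := ((b₂ :- a₂) :* x :+ (a₁ :- b₁) :* y) :- ((b₂ :- a₂) :* a₁ :+ (a₁ :- b₁) :* a₂))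
        refl a₁ a₂ b₁ b₂ x y

    dist²∈ : ∀ {P Q} → (F ²) P → (F ²) Q → F (dist² P Q)
    dist²∈ (p , q) (r , s) = plus (times (minus p r) (minus p r)) (times (minus q s) (minus q s))

    in-quadratic : ∀ {P} → (F ²) P → Quadratic F P
    in-quadratic (x∈ , y∈) k =
      k (0# , resp (sym (zeroˡ 0#)) zero∈ , adjoin-⊆ K 0# x∈ , adjoin-⊆ K 0# y∈)

    -- Cramer's rule if the determinant is invertible; if it is 0, the common point makes the two
    -- lines coincide.
    linear∩linear : ∀ {L L′ P} → Linear F L → Linear F L′ → ¬ L ≐ L′ → P ∈ L → P ∈ L′ → Quadratic F P
    linear∩linear {L} {L′} {P@(x , y)} l l′ L≢L′ P∈L P∈L′ k =
      zero-or-invertible (l.p * l′.q - l′.p * l.q) [ parallel , crossing ]′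
      where
      module l  = Linear l
      module l′ = Linear l′

      eq  = l.equation P∈L
      eq′ = l′.equation P∈L′

      crossing : (∃ λ v → (l.p * l′.q - l′.p * l.q) * v ≈ 1#) → ⊥
      crossing (v , Dv≈1) = in-quadratic
        ( resp (coordinate (trans (solve 6 (λ p q p′ q′ x y → (p :* q′ :- p′ :* q) :* x
              := (p :* x :+ q :* y) :* q′ :- (p′ :* x :+ q′ :* y) :* q) refl l.p l.q l′.p l′.q x y)
            (+-cong (*-congʳ eq) (-‿cong (*-congʳ eq′)))))
            (times (minus (times l.e∈ l′.q∈) (times l′.e∈ l.q∈)) v∈)
        , resp (coordinate (trans (solve 6 (λ p q p′ q′ x y → (p :* q′ :- p′ :* q) :* y
              := (p′ :* x :+ q′ :* y) :* p :- (p :* x :+ q :* y) :* p′) refl l.p l.q l′.p l′.q x y)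
            (+-cong (*-congʳ eq′) (-‿cong (*-congʳ eq)))))
            (times (minus (times l′.e∈ l.p∈) (times l.e∈ l′.p∈)) v∈) ) k
        where
        D : Carrier
        D = l.p * l′.q - l′.p * l.q

        v∈ : F v
        v∈ = inverse∈ (minus (times l.p∈ l′.q∈) (times l′.p∈ l.q∈)) Dv≈1

        coordinate : ∀ {x u} → D * x ≈ u → u * v ≈ x
        coordinate {x} Dx≈u = trans (*-congʳ (sym Dx≈u))
          (trans (solve 3 (λ D x v → (D :* x) :* v := (D :* v) :* x) refl D x v)
            (trans (*-congʳ Dv≈1) (*-identityˡ x)))

      -- `Δ` and `Δ′` are the changes of the two linear forms from `P` to the point `X , Y`. With
      -- determinant 0 both `p Δ′` and `q Δ′` vanish, so nontriviality gives `Δ′ = 0`.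
      include : ∀ {L L′} (m : Linear F L) (m′ : Linear F L′) → P ∈ L → P ∈ L′ →
                Linear.p m * Linear.q m′ - Linear.p m′ * Linear.q m ≈ 0# → L ⊆ L′
      include m m′ P∈L P∈L′ D≈0 {X , Y} Q∈L = m′.solution (trans (x-y≈0⇒x≈y Δ′≈0) (m′.equation P∈L′))
        where
        module m  = Linear m
        module m′ = Linear m′

        Δ Δ′ : Carrier
        Δ  = (m.p * X + m.q * Y) - (m.p * x + m.q * y)
        Δ′ = (m′.p * X + m′.q * Y) - (m′.p * x + m′.q * y)

        Δ≈0 : Δ ≈ 0#
        Δ≈0 = x≈y⇒x-y≈0 (trans (m.equation Q∈L) (sym (m.equation P∈L)))

        pΔ′≈0 : m.p * Δ′ ≈ 0#
        pΔ′≈0 = trans (solve 8 (λ p q p′ q′ X Y x y →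
            p :* ((p′ :* X :+ q′ :* Y) :- (p′ :* x :+ q′ :* y))
            := p′ :* ((p :* X :+ q :* Y) :- (p :* x :+ q :* y)) :+ (p :* q′ :- p′ :* q) :* (Y :- y))
            refl m.p m.q m′.p m′.q X Y x y)
          (trans (+-cong (trans (*-congˡ Δ≈0) (zeroʳ _)) (trans (*-congʳ D≈0) (zeroˡ _))) (+-identityʳ 0#))

        qΔ′≈0 : m.q * Δ′ ≈ 0#
        qΔ′≈0 = trans (solve 8 (λ p q p′ q′ X Y x y →
            q :* ((p′ :* X :+ q′ :* Y) :- (p′ :* x :+ q′ :* y))
            := q′ :* ((p :* X :+ q :* Y) :- (p :* x :+ q :* y)) :+ (p :* q′ :- p′ :* q) :* (x :- X))
            refl m.p m.q m′.p m′.q X Y x y)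
          (trans (+-cong (trans (*-congˡ Δ≈0) (zeroʳ _)) (trans (*-congʳ D≈0) (zeroˡ _))) (+-identityʳ 0#))

        Δ′≈0 : Δ′ ≈ 0#
        Δ′≈0 = ≈-stable λ Δ′≉0 → m.nontrivial
          ( no-zero-divisors Δ′≉0 (trans (*-comm _ _) pΔ′≈0)
          , no-zero-divisors Δ′≉0 (trans (*-comm _ _) qΔ′≈0) )

      parallel : l.p * l′.q - l′.p * l.q ≈ 0# → ⊥
      parallel D≈0 = L≢L′ (include l l′ P∈L P∈L′ D≈0 , include l′ l P∈L′ P∈L
        (trans (solve 4 (λ p q p′ q′ → p′ :* q :- p :* q′ := :- (p :* q′ :- p′ :* q)) refl l.p l.q l′.p l′.q)
          (trans (-‿cong D≈0) -0≈0)))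

    -- s is the signed distance from the centre along the line, scaled by the length of (p , q).
    linear∩circle : ∀ {L A B P} → Linear F L → (F ²) A → (F ²) B →
                    P ∈ L → P ∈ ⟦ circle A B ⟧ → Quadratic F P
    linear∩circle {A = A@(a₁ , a₂)} {B} {x , y} l A∈@(a₁∈ , a₂∈) B∈ P∈L P∈circle k =
      zero-or-invertible (p * p + q * q)
        [ (λ N≈0 → nontrivial (squares≈0 N≈0 , squares≈0 (trans (+-comm _ _) N≈0)))
        , (λ (v , Nv≈1) → let v∈ = inverse∈ (plus (times p∈ p∈) (times q∈ q∈)) Nv≈1 in
            k (s , s²∈
              -- `P - A` is decomposed along the orthogonal vectors `(p , q)` and `(-q , p)`, with
              -- coefficients `t / N` and `s / N` for `N = p² + q²`.
              , (λ k → k (a₁ + (p * t) * v , - (q * v) , plus a₁∈ (times (times p∈ t∈) v∈) , neg (times q∈ v∈) ,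
                  x-y≈0⇒x≈y (trans (solve 7 (λ a₁ a₂ p q v x y →
                      x :- ((a₁ :+ (p :* (p :* (x :- a₁) :+ q :* (y :- a₂))) :* v)
                            :+ :- (q :* v) :* (p :* (y :- a₂) :- q :* (x :- a₁)))
                      := (x :- a₁) :* (con (+ 1) :- (p :* p :+ q :* q) :* v)) refl a₁ a₂ p q v x y)
                    (vanish Nv≈1 _))))
              , (λ k → k (a₂ + (q * t) * v , p * v , plus a₂∈ (times (times q∈ t∈) v∈) , times p∈ v∈ ,
                  x-y≈0⇒x≈y (trans (solve 7 (λ a₁ a₂ p q v x y →
                      y :- ((a₂ :+ (q :* (p :* (x :- a₁) :+ q :* (y :- a₂))) :* v)
                            :+ (p :* v) :* (p :* (y :- a₂) :- q :* (x :- a₁)))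
                      := (y :- a₂) :* (con (+ 1) :- (p :* p :+ q :* q) :* v)) refl a₁ a₂ p q v x y)
                    (vanish Nv≈1 _))))))
        ]′
      where
      open Linear l

      s t ρ : Carrier
      s = p * (y - a₂) - q * (x - a₁)
      t = p * (x - a₁) + q * (y - a₂)
      ρ = dist² B A

      -- `1# + 0#` is the value of the solver's constant `con (+ 1)`.
      vanish : ∀ {N v} → N * v ≈ 1# → ∀ u → u * ((1# + 0#) - N * v) ≈ 0#
      vanish Nv≈1 u = trans (*-congˡ (x≈y⇒x-y≈0 (trans (+-identityʳ 1#) (sym Nv≈1)))) (zeroʳ u)

      t∈ : F t
      t∈ = resp (trans (+-congʳ (sym (equation P∈L))) (solve 6 (λ a₁ a₂ p q x y →
          (p :* x :+ q :* y) :- (p :* a₁ :+ q :* a₂) := p :* (x :- a₁) :+ q :* (y :- a₂))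
          refl a₁ a₂ p q x y))
        (minus e∈ (plus (times p∈ a₁∈) (times q∈ a₂∈)))

      s²∈ : F (s * s)
      -- Lagrange's identity `s² + t² = (p² + q²) dist² P A`, where `dist² P A = ρ` because `P` is
      -- on the circle.
      s²∈ = resp (trans (+-congʳ (*-congˡ (sym P∈circle))) (solve 6 (λ a₁ a₂ p q x y →
          (p :* p :+ q :* q) :* ((x :- a₁) :* (x :- a₁) :+ (y :- a₂) :* (y :- a₂))
            :- (p :* (x :- a₁) :+ q :* (y :- a₂)) :* (p :* (x :- a₁) :+ q :* (y :- a₂))
          := (p :* (y :- a₂) :- q :* (x :- a₁)) :* (p :* (y :- a₂) :- q :* (x :- a₁)))
          refl a₁ a₂ p q x y))
        (minus (times (plus (times p∈ p∈) (times q∈ q∈)) (dist²∈ B∈ A∈)) (times t∈ t∈))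

    -- The difference of the two circle equations: the squares of the coordinates of `P` cancel, so
    -- two circles reduce to a line and a circle.
    radicalAxis : Point → Point → Point → Point → Pred Point ℓ₁
    radicalAxis A B A′ B′ P = dist² P A - dist² P A′ ≈ dist² B A - dist² B′ A′

    radical-linear : ∀ {A B A′ B′} → (F ²) A → (F ²) B → (F ²) A′ → (F ²) B′ → ¬ A ≋ A′ →
                     Linear F (radicalAxis A B A′ B′)
    radical-linear {A@(a₁ , a₂)} {B} {A′@(a₁′ , a₂′)} {B′} A∈@(a₁∈ , a₂∈) B∈ A′∈@(a₁′∈ , a₂′∈) B′∈ A≢A′ = record
      { p = a₁′ + a₁′ - (a₁ + a₁)
      ; q = a₂′ + a₂′ - (a₂ + a₂)
      ; e = (dist² B A - dist² B′ A′) + ((a₁′ * a₁′ + a₂′ * a₂′) - (a₁ * a₁ + a₂ * a₂))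
      ; p∈ = minus (plus a₁′∈ a₁′∈) (plus a₁∈ a₁∈)
      ; q∈ = minus (plus a₂′∈ a₂′∈) (plus a₂∈ a₂∈)
      ; e∈ = plus (minus (dist²∈ B∈ A∈) (dist²∈ B′∈ A′∈))
               (minus (plus (times a₁′∈ a₁′∈) (times a₂′∈ a₂′∈)) (plus (times a₁∈ a₁∈) (times a₂∈ a₂∈)))
      ; nontrivial = λ (p≈0 , q≈0) → A≢A′ (halve p≈0 , halve q≈0)
      ; equation = λ {(x , y)} P∈ → transport P∈ (identity x y _)
      ; solution = λ {(x , y)} eq → transport eq (sym (identity x y _))
      }
      where
      halve : ∀ {x y} → (y + y) - (x + x) ≈ 0# → x ≈ y
      halve {x} {y} p = sym (x-y≈0⇒x≈y (cancel-invertible {2#} {y - x} {½} (trans (*-comm 2# ½) ½*2≈1)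
        (trans (trans (distribʳ _ _ _) (+-cong (*-identityˡ _) (*-identityˡ _)))
          (trans (solve 2 (λ x y → (y :- x) :+ (y :- x) := (y :+ y) :- (x :+ x)) refl x y) p))))

      identity : ∀ x y r → (dist² (x , y) A - dist² (x , y) A′) - r
        ≈ ((a₁′ + a₁′ - (a₁ + a₁)) * x + (a₂′ + a₂′ - (a₂ + a₂)) * y)
          - (r + ((a₁′ * a₁′ + a₂′ * a₂′) - (a₁ * a₁ + a₂ * a₂)))
      identity x y r = solve 7 (λ a₁ a₂ b₁ b₂ x y r →
        (((x :- a₁) :* (x :- a₁) :+ (y :- a₂) :* (y :- a₂))
          :- ((x :- b₁) :* (x :- b₁) :+ (y :- b₂) :* (y :- b₂))) :- r
        := ((b₁ :+ b₁ :- (a₁ :+ a₁)) :* x :+ (b₂ :+ b₂ :- (a₂ :+ a₂)) :* y)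
          :- (r :+ ((b₁ :* b₁ :+ b₂ :* b₂) :- (a₁ :* a₁ :+ a₂ :* a₂)))) refl a₁ a₂ a₁′ a₂′ x y r

    dist²-cong : ∀ P {A A′} → A ≋ A′ → dist² P A ≈ dist² P A′
    dist²-cong (x , y) (p , q) =
      +-cong (*-cong (+-congˡ (-‿cong p)) (+-congˡ (-‿cong p)))
             (*-cong (+-congˡ (-‿cong q)) (+-congˡ (-‿cong q)))

    concentric : ∀ {A B A′ B′ P} → A ≋ A′ → P ∈ ⟦ circle A B ⟧ → P ∈ ⟦ circle A′ B′ ⟧ →
                 ⟦ circle A B ⟧ ⊆ ⟦ circle A′ B′ ⟧
    concentric {P = P} A≋A′ P∈ P∈′ {Q} Q∈ = trans (sym (dist²-cong Q A≋A′))
      (trans Q∈ (trans (sym P∈) (trans (dist²-cong P A≋A′) P∈′)))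

    intersection : ∀ {k l P} → Over F k → Over F l → ¬ ⟦ k ⟧ ≐ ⟦ l ⟧ →
                   P ∈ ⟦ k ⟧ → P ∈ ⟦ l ⟧ → Quadratic F P
    intersection (line A∈ B∈ A≢B) (line A′∈ B′∈ A′≢B′) =
      linear∩linear (line-linear A∈ B∈ A≢B) (line-linear A′∈ B′∈ A′≢B′)
    intersection {P = P} (line A∈ B∈ A≢B) (circle {A′} {B′} A′∈ B′∈) _ =
      linear∩circle {A = A′} {B′} {P} (line-linear A∈ B∈ A≢B) A′∈ B′∈
    intersection {P = P} (circle {A} {B} A∈ B∈) (line A′∈ B′∈ A′≢B′) _ P∈k P∈l =
      linear∩circle {A = A} {B} {P} (line-linear A′∈ B′∈ A′≢B′) A∈ B∈ P∈l P∈k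
    intersection {P = P} (circle {A} {B} A∈ B∈) (circle {A′} {B′} A′∈ B′∈) k≢l P∈k P∈l k =
      -- The goal is `⊥`, so both answers to the undecided question about the centres can be
      -- refuted: equal centres would make the circles equal, distinct centres lead to the radical
      -- axis.
      A≢A′ λ (p , q) → k≢l ( concentric {A} {B} {A′} {B′} {P} (p , q) P∈k P∈l
                          , concentric {A′} {B′} {A} {B} {P} (sym p , sym q) P∈l P∈k )
      where
      A≢A′ : ¬ ¬ A ≋ A′
      A≢A′ A≢A′ = linear∩circle {A = A} {B} {P} (radical-linear {A} {B} {A′} {B′} A∈ B∈ A′∈ B′∈ A≢A′) A∈ B∈
        (+-cong P∈k (-‿cong P∈l)) P∈k k

  module Obstruction (n : ℕ) (z : Point) where
    open RootObstruction n z

    given-∈ : ∀ {F P} → Rootless F → (base ∪ ｛ z ｝) P → (F ²) P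
    given-∈ Φ (inj₁ (inj₁ (p , q))) = resp (sym p) zero∈ , resp (sym q) zero∈
      where open Subfield (Rootless.subfield Φ)
    given-∈ Φ (inj₁ (inj₂ (p , q))) = resp (sym p) one , resp (sym q) zero∈
      where open Subfield (Rootless.subfield Φ)
    given-∈ Φ (inj₂ (p , q)) = resp (sym p) (proj₁ base∈) , resp (sym q) (proj₂ base∈)
      where
      open Rootless Φ
      open Subfield subfield

    -- Doubly negated existence of a rootless field above `F` with property `Q`, curried so that
    -- successive extensions compose as continuations.
    Extension : Pred Carrier (c ⊔ ℓ₁) → (Pred Carrier (c ⊔ ℓ₁) → Set (c ⊔ ℓ₁)) → Set _
    Extension F Q = ¬ (∀ {F′} → Rootless F′ → F ⊆ F′ → ¬ Q F′)

    mutual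
      -- The two functions thread one growing field through the whole construction; only an
      -- intersection enlarges it, by a single square root.
      constructible-extension : ∀ {F P} → Rootless F → C (base ∪ ｛ z ｝) P → Extension F (λ F′ → (F′ ²) P)
      constructible-extension Φ (given P∈) k = k Φ (λ x∈ → x∈) (given-∈ Φ P∈)
      constructible-extension Φ (meet c d k≢l P∈k P∈l) k =
        drawn-extension Φ c λ Φ₁ F⊆F₁ over₁ →
        drawn-extension Φ₁ d λ Φ₂ F₁⊆F₂ over₂ →
        let K = Rootless.subfield Φ₂ in
        intersection K (over-mono F₁⊆F₂ over₁) over₂ k≢l P∈k P∈l λ (s , s²∈ , P∈) →
        k (adjoin-rootless Φ₂ s s²∈) (λ x∈ → adjoin-⊆ K s (F₁⊆F₂ (F⊆F₁ x∈))) P∈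

      drawn-extension : ∀ {F k} → Rootless F → Drawn (base ∪ ｛ z ｝) k → Extension F (λ F′ → Over F′ k)
      drawn-extension Φ (line A B A≢B) k =
        constructible-extension Φ A λ Φ₁ F⊆F₁ A∈ →
        constructible-extension Φ₁ B λ Φ₂ F₁⊆F₂ B∈ →
        k Φ₂ (λ x∈ → F₁⊆F₂ (F⊆F₁ x∈)) (line (F₁⊆F₂ (proj₁ A∈) , F₁⊆F₂ (proj₂ A∈)) B∈ A≢B)
      drawn-extension Φ (circle A B A≢B) k =
        constructible-extension Φ A λ Φ₁ F⊆F₁ A∈ →
        constructible-extension Φ₁ B λ Φ₂ F₁⊆F₂ B∈ →
        k Φ₂ (λ x∈ → F₁⊆F₂ (F⊆F₁ x∈)) (circle (F₁⊆F₂ (proj₁ A∈) , F₁⊆F₂ (proj₂ A∈)) B∈)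

      over-mono : ∀ {F F′ : Pred Carrier (c ⊔ ℓ₁)} {k} → F ⊆ F′ → Over F k → Over F′ k
      over-mono F⊆F′ (line (a₁ , a₂) (b₁ , b₂) A≢B) = line (F⊆F′ a₁ , F⊆F′ a₂) (F⊆F′ b₁ , F⊆F′ b₂) A≢B
      over-mono F⊆F′ (circle (a₁ , a₂) (b₁ , b₂))   = circle (F⊆F′ a₁ , F⊆F′ a₂) (F⊆F′ b₁ , F⊆F′ b₂)

    no-constructible-root : ∀ {F w} → Rootless F → C (base ∪ ｛ z ｝) w → ¬ w E.⊗^ n ≋ z
    no-constructible-root {w = w} Φ w∈C wⁿ≋z = constructible-extension Φ w∈C λ Φ′ _ w∈ →
      Rootless.no-root Φ′ 0 w w∈ (E.G.trans wⁿ≋z (E.G.sym (E.G.*-identityʳ z)))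

-- Rational rotations, and the rationals as bottom of the tower

module Rotations {c ℓ₁ ℓ₂ ℓ₃} (R : RealNumbers c ℓ₁ ℓ₂ ℓ₃) where

  open Plane R
  open Order R
  open Subfields R
  open Intersections R
  open IntegerSolver commutativeRing morphism
  open E using (_⊗_; _⊗^_; module G)
  open Algebra.Properties.Semiring.Exp G.semiring
    using () renaming (^-congˡ to ⊗^-congˡ; ^-assocʳ to ⊗^-assocʳ)
  open Algebra.Properties.CommutativeSemiring.Exp G.commutativeSemiring
    using () renaming (^-distrib-* to ⊗^-distrib-⊗)

  +-pos-nonneg : ∀ {x y} → 0# < x → ¬ y < 0# → 0# < x + y
  +-pos-nonneg {x} {y} 0<x y≮0 = [ (λ -x<y → 0<-⇒< (<-respʳ-≈
      (solve 2 (λ x y → y :- :- x := (x :+ y) :- con (+ 0)) refl x y) (<⇒0<- -x<y)))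
    , (λ y<0 → ⊥-elim (y≮0 y<0)) ]′
    (<-cotrans (<-respˡ-≈ (+-identityˡ (- x)) (<-respʳ-≈ (-‿inverseʳ x) (+-monoˡ-< (- x) 0<x))) y)

  0<1+t² : ∀ t → 0# < 1# + t * t
  0<1+t² t = +-pos-nonneg 0<1 (square-nonneg t)

  -- cayley t = (1 + i t) / (1 - i t)
  cayley : Carrier → Point
  cayley t = (1# - t * t) * v , (t + t) * v
    where
    v : Carrier
    v = proj₁ (inverse (1# + t * t) (0<1+t² t))

  cayley-⊗ : ∀ t → cayley t ⊗ (1# , - t) ≋ (1# , t)
  cayley-⊗ t =
    trans (+-congʳ (*-identityʳ _)) (trans (solve 3 (λ o t v →
        (o :- t :* t) :* v :+ :- ((t :+ t) :* v :* :- t) := v :* (o :+ t :* t)) refl 1# t v) v-inverse) ,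
    trans (+-congˡ (*-identityʳ _)) (trans (+-congˡ (sym (*-identityˡ _))) (trans (solve 3 (λ o t v →
        (o :- t :* t) :* v :* :- t :+ o :* ((t :+ t) :* v)
          := t :* (v :* (o :+ t :* t))) refl 1# t v) (trans (*-congˡ v-inverse) (*-identityʳ t))))
    where
    v : Carrier
    v = proj₁ (inverse (1# + t * t) (0<1+t² t))

    v-inverse : v * (1# + t * t) ≈ 1#
    v-inverse = proj₂ (inverse (1# + t * t) (0<1+t² t))

  fromℤ≈0⇒≡0 : ∀ i → fromℤ i ≈ 0# → i ≡ + 0
  fromℤ≈0⇒≡0 (+ zero)  _ = ≡.refl
  fromℤ≈0⇒≡0 (+ suc n) p = ⊥-elim (<-irrefl (sym p) (0<suc n))
  fromℤ≈0⇒≡0 -[1+ n ]  p = ⊥-elim (<-irrefl (sym (trans (solve 1 (λ x → x := :- :- x) refl _)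
    (trans (-‿cong p) -0≈0))) (0<suc n))

  fromℤ-injective : ∀ {i j} → fromℤ i ≈ fromℤ j → i ≡ j
  fromℤ-injective {i} {j} p = ℤₚ.i-j≡0⇒i≡j i j (fromℤ≈0⇒≡0 (i ℤ.- j)
    (trans (fromℤ-+ i (ℤ.- j)) (trans (+-congˡ (fromℤ-neg j)) (x≈y⇒x-y≈0 p))))

  fromℤ≉0⇒invertible : ∀ {i} → ¬ i ≡ + 0 → ¬ ¬ (∃ λ v → fromℤ i * v ≈ 1#)
  fromℤ≉0⇒invertible {i} i≢0 k =
    zero-or-invertible (fromℤ i) [ (λ p → i≢0 (fromℤ≈0⇒≡0 i p)) , k ]′

  product≢0 : ∀ {i j} → ¬ i ≡ + 0 → ¬ j ≡ + 0 → ¬ i ℤ.* j ≡ + 0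
  product≢0 {i} {j} i≢0 j≢0 ij≡0 = [ i≢0 , j≢0 ]′ (ℤₚ.i*j≡0⇒i≡0∨j≡0 i ij≡0)

  Fraction : Pred Carrier ℓ₁
  Fraction x = ∃ λ q → ∃ λ p → ¬ q ≡ + 0 × fromℤ q * x ≈ fromℤ p

  -- The double negation provides stability; `Lift` raises the predicate to the level that
  -- `Rootless` prescribes.
  Rational : Pred Carrier (c ⊔ ℓ₁)
  Rational x = Lift c (¬ ¬ Fraction x)

  rational-subfield : Subfield Rational
  rational-subfield = record
    { resp     = λ x≈y (lift x∈) → lift λ k → x∈ λ (q , p , q≢0 , qx≈p) →
                   k (q , p , q≢0 , trans (*-congˡ (sym x≈y)) qx≈p)
    ; stable   = λ ¬¬x∈ → lift λ k → ¬¬x∈ λ (lift x∈) → x∈ k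
    ; one      = lift λ k → k (+ 1 , + 1 , (λ ()) , *-identityʳ _)
    ; plus     = λ {x} {y} (lift x∈) (lift y∈) → lift λ k →
                   x∈ λ (q , p , q≢0 , qx≈p) → y∈ λ (q′ , p′ , q′≢0 , q′y≈p′) →
                   k (q ℤ.* q′ , p ℤ.* q′ ℤ.+ p′ ℤ.* q , product≢0 q≢0 q′≢0 ,
                     trans (*-congʳ (fromℤ-* q q′)) (trans
                       (solve 4 (λ q q′ x y → (q :* q′) :* (x :+ y) := (q :* x) :* q′ :+ (q′ :* y) :* q)
                         refl (fromℤ q) (fromℤ q′) x y)
                       (trans (+-cong (trans (*-congʳ qx≈p) (sym (fromℤ-* p q′)))
                                      (trans (*-congʳ q′y≈p′) (sym (fromℤ-* p′ q))))
                         (sym (fromℤ-+ (p ℤ.* q′) (p′ ℤ.* q))))))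
    ; neg      = λ {x} (lift x∈) → lift λ k → x∈ λ (q , p , q≢0 , qx≈p) →
                   k (q , ℤ.- p , q≢0 , trans (solve 2 (λ q x → q :* :- x := :- (q :* x)) refl _ x)
                     (trans (-‿cong qx≈p) (sym (fromℤ-neg p))))
    ; times    = λ {x} {y} (lift x∈) (lift y∈) → lift λ k →
                   x∈ λ (q , p , q≢0 , qx≈p) → y∈ λ (q′ , p′ , q′≢0 , q′y≈p′) →
                   k (q ℤ.* q′ , p ℤ.* p′ , product≢0 q≢0 q′≢0 ,
                     trans (*-congʳ (fromℤ-* q q′)) (trans
                       (solve 4 (λ q q′ x y → (q :* q′) :* (x :* y) := (q :* x) :* (q′ :* y))
                         refl (fromℤ q) (fromℤ q′) x y)
                       (trans (*-cong qx≈p q′y≈p′) (sym (fromℤ-* p p′)))))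
    ; inverse∈ = λ {x} {y} (lift x∈) xy≈1 → lift λ k → x∈ λ (q , p , q≢0 , qx≈p) →
                   fromℤ≉0⇒invertible q≢0 λ (v , qv≈1) →
                   k (p , q , (λ p≡0 → invertible⇒≉0 xy≈1 (cancel-invertible qv≈1
                        (trans qx≈p (reflexive (≡.cong fromℤ p≡0))))) ,
                     trans (*-congʳ (sym qx≈p)) (trans (*-assoc _ x y) (trans (*-congˡ xy≈1) (*-identityʳ _))))
    }

  natural∈ : ∀ m → Rational (m · 1#)
  natural∈ zero    = Subfield.zero∈ rational-subfield
  natural∈ (suc m) = Subfield.plus rational-subfield (Subfield.one rational-subfield) (natural∈ m)

  -- `(1 + i / m) / (1 - i / m) = (m + i) / (m - i)` for `m = Z.centre j`.
  rotation : ℕ → Point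
  rotation j = cayley (1/ Z.centre j)

  cayley∈ : ∀ {ℓ} {F : Pred Carrier ℓ} → Subfield F → ∀ t → F t → (F ²) (cayley t)
  cayley∈ K t t∈ = times (minus one (times t∈ t∈)) v∈ , times (plus t∈ t∈) v∈
    where
    open Subfield K
    v∈ = inverse∈ (plus one (times t∈ t∈)) (trans (*-comm _ _) (proj₂ (inverse (1# + t * t) (0<1+t² t))))

  rotation∈ : ∀ j → (Rational ²) (rotation j)
  rotation∈ j = cayley∈ rational-subfield (1/ Z.centre j) (Subfield.inverse∈ rational-subfield
    (natural∈ (Z.centre j)) (trans (*-comm _ _) (1/-inverse (Z.centre j))))

  φ : ℤ × ℤ → Point
  φ (a , b) = fromℤ a , fromℤ b

  φ-⊗ : ∀ z w → φ (z ℤ[i].⊗ w) ≋ φ z ⊗ φ w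
  φ-⊗ (a , b) (c , d) =
    trans (fromℤ-+ (a ℤ.* c) (ℤ.- (b ℤ.* d)))
      (+-cong (fromℤ-* a c) (trans (fromℤ-neg (b ℤ.* d)) (-‿cong (fromℤ-* b d)))) ,
    trans (fromℤ-+ (a ℤ.* d) (b ℤ.* c)) (+-cong (fromℤ-* a d) (fromℤ-* b c))

  φ-^ : ∀ z m → φ (z ℤ[i].⊗^ m) ≋ φ z ⊗^ m
  φ-^ z zero    = +-identityʳ 1# , refl
  φ-^ z (suc m) = G.trans (φ-⊗ z (z ℤ[i].⊗^ m)) (G.*-congˡ {φ z} (φ-^ z m))

  -- `o` stands for the image of the integer 1, which is `1# + 0#` and equals `1#` only in the
  -- setoid.
  cayley-reciprocal : ∀ {t m o} → t * m ≈ 1# → o ≈ 1# → cayley t ⊗ (m , - o) ≋ (m , o)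
  cayley-reciprocal {t} {m} {o} tm≈1 o≈1 = G.trans (G.*-congˡ {cayley t} (G.sym lower≋))
    (G.trans (G.sym (G.*-assoc (cayley t) (1# , - t) (m , 0#)))
      (G.trans (G.*-congʳ {m , 0#} (cayley-⊗ t)) upper≋))
    where
    lower≋ : (1# , - t) ⊗ (m , 0#) ≋ (m , - o)
    lower≋ =
      trans (solve 3 (λ o t m → o :* m :+ :- (:- t :* con (+ 0)) := o :* m) refl 1# t m) (*-identityˡ m) ,
      trans (solve 3 (λ o t m → o :* con (+ 0) :+ :- t :* m := :- (t :* m)) refl 1# t m)
            (-‿cong (trans tm≈1 (sym o≈1)))

    upper≋ : (1# , t) ⊗ (m , 0#) ≋ (m , o)
    upper≋ =
      trans (solve 3 (λ o t m → o :* m :+ :- (t :* con (+ 0)) := o :* m) refl 1# t m) (*-identityˡ m) ,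
      trans (solve 3 (λ o t m → o :* con (+ 0) :+ t :* m := t :* m) refl 1# t m) (trans tm≈1 (sym o≈1))

  rotation-⊗ : ∀ j → rotation j ⊗ φ (ℤ[i].conj (Z.upper j)) ≋ φ (Z.upper j)
  rotation-⊗ j = cayley-reciprocal {1/ Z.centre j} {Z.centre j · 1#} {1 · 1#}
    (1/-inverse (Z.centre j)) (+-identityʳ 1#)

  module _ (n : ℕ) (1<n : 1 ℕ.< n) (2∤n : ¬ 2 ∣ n) where

    -- Elements of ℚ(i) are quotients of Gaussian integers, to which multiplicities apply.
    rational-rootless : ∀ j b {z} → z ≋ rotation j ⊗^ suc (n ℕ.* b) → RootObstruction.Rootless n z Rational
    rational-rootless j b {z} z≋ = record
      { subfield = rational-subfield
      ; base∈    = ²-resp rational-subfield (G.sym z≋) (²-^ rational-subfield (suc (n ℕ.* b)) (rotation∈ j))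
      ; no-root  = λ k (x , y) (lift x∈ , lift y∈) root → x∈ λ (q , p , q≢0 , qx≈p) →
          y∈ λ (q′ , p′ , q′≢0 , q′y≈p′) →
          -- Over the common denominator, `p / q + i p′ / q′` is `(p q′ + i p′ q) / (q q′)`.
          Z.no-root n 1<n 2∤n j b k (p ℤ.* q′ , p′ ℤ.* q) (q ℤ.* q′ , + 0)
            (λ eq → product≢0 q≢0 q′≢0 (proj₁ eq))
            (integral-equation k (x , y) (p ℤ.* q′ , p′ ℤ.* q) (q ℤ.* q′ , + 0)
              ( trans (+-cong (*-congʳ (fromℤ-* q q′)) refl) (trans
                  (solve 4 (λ q q′ x y → (q :* q′) :* x :+ :- (con (+ 0) :* y) := (q :* x) :* q′)
                    refl (fromℤ q) (fromℤ q′) x y) (trans (*-congʳ qx≈p) (sym (fromℤ-* p q′))))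
              , trans (+-cong (*-congʳ (fromℤ-* q q′)) refl) (trans
                  (solve 4 (λ q q′ x y → (q :* q′) :* y :+ con (+ 0) :* x := (q′ :* y) :* q)
                    refl (fromℤ q) (fromℤ q′) x y) (trans (*-congʳ q′y≈p′) (sym (fromℤ-* p′ q)))))
              root)
      }
      where
      -- `w ^ n = R ^ N` is multiplied by `h ^ n β ^ N`; then `h w = g` and `R β = α` clear both
      -- denominators.
      integral-equation : ∀ k w g h → φ h ⊗ w ≋ φ g → w ⊗^ n ≋ z ⊗^ (2 ℕ.^ k) →
        let N = suc (n ℕ.* b) ℕ.* 2 ℕ.^ k in
        (g ℤ[i].⊗^ n) ℤ[i].⊗ (ℤ[i].conj (Z.upper j) ℤ[i].⊗^ N) ℤ[i].≋
        (h ℤ[i].⊗^ n) ℤ[i].⊗ (Z.upper j ℤ[i].⊗^ N)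
      integral-equation k w g h hw≋g root = fromℤ-injective (proj₁ equation) , fromℤ-injective (proj₂ equation)
        where
        N : ℕ
        N = suc (n ℕ.* b) ℕ.* 2 ℕ.^ k

        α β : ℤ × ℤ
        α = Z.upper j
        β = ℤ[i].conj α

        wⁿ≋ : w ⊗^ n ≋ rotation j ⊗^ N
        wⁿ≋ = G.trans root (G.trans (⊗^-congˡ (2 ℕ.^ k) z≋) (⊗^-assocʳ (rotation j) (suc (n ℕ.* b)) (2 ℕ.^ k)))

        φ-monomial : ∀ u v → φ ((u ℤ[i].⊗^ n) ℤ[i].⊗ (v ℤ[i].⊗^ N)) ≋ (φ u ⊗^ n) ⊗ (φ v ⊗^ N)
        φ-monomial u v = G.trans (φ-⊗ (u ℤ[i].⊗^ n) (v ℤ[i].⊗^ N)) (G.*-cong (φ-^ u n) (φ-^ v N))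

        equation : φ ((g ℤ[i].⊗^ n) ℤ[i].⊗ (β ℤ[i].⊗^ N)) ≋ φ ((h ℤ[i].⊗^ n) ℤ[i].⊗ (α ℤ[i].⊗^ N))
        equation = G.trans (φ-monomial g β)
          (G.trans (G.*-congʳ {φ β ⊗^ N} (G.trans (⊗^-congˡ n (G.sym hw≋g))
            (G.trans (⊗^-distrib-⊗ (φ h) w n) (G.*-congˡ {φ h ⊗^ n} wⁿ≋))))
          (G.trans (G.*-assoc (φ h ⊗^ n) (rotation j ⊗^ N) (φ β ⊗^ N))
          (G.trans (G.*-congˡ {φ h ⊗^ n} (G.trans (G.sym (⊗^-distrib-⊗ (rotation j) (φ β) N))
            (⊗^-congˡ N (rotation-⊗ j))))
          (G.sym (φ-monomial h α)))))

-- The complex exponential on the imaginary axis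

module PowerSeries {a ℓ} (A : CommutativeRing a ℓ) (hom : ℤ-Algebra A) where

  open CommutativeRing A
  open IntegerSolver A hom
  open Algebra.Properties.Monoid.Mult +-monoid using () renaming (_×_ to _·_)

  -- The Cauchy product, with `u i * v (m - i)` as summands. Shifting `u` alone avoids subtraction
  -- of indices.
  conv : (ℕ → Carrier) → (ℕ → Carrier) → ℕ → Carrier
  conv u v zero    = u 0 * v 0
  conv u v (suc m) = u 0 * v (suc m) + conv (λ i → u (suc i)) v m

  conv-cong : ∀ {u u′ v v′} → (∀ i → u i ≈ u′ i) → (∀ i → v i ≈ v′ i) → ∀ m → conv u v m ≈ conv u′ v′ m
  conv-cong p q zero    = *-cong (p 0) (q 0)
  conv-cong p q (suc m) = +-cong (*-cong (p 0) (q (suc m))) (conv-cong (λ i → p (suc i)) q m)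

  conv-+ : ∀ u u′ v m → conv (λ i → u i + u′ i) v m ≈ conv u v m + conv u′ v m
  conv-+ u u′ v zero    = distribʳ _ _ _
  conv-+ u u′ v (suc m) = trans (+-cong (distribʳ _ _ _) (conv-+ (λ i → u (suc i)) (λ i → u′ (suc i)) v m))
    (solve 4 (λ a b c d → (a :+ b) :+ (c :+ d) := (a :+ c) :+ (b :+ d)) refl _ _ _ _)

  conv-scaleˡ : ∀ c u v m → conv (λ i → c * u i) v m ≈ c * conv u v m
  conv-scaleˡ c u v zero    = *-assoc _ _ _
  conv-scaleˡ c u v (suc m) = trans (+-cong (*-assoc _ _ _) (conv-scaleˡ c (λ i → u (suc i)) v m))
    (sym (distribˡ _ _ _))

  conv-scaleʳ : ∀ c u v m → conv u (λ i → c * v i) m ≈ c * conv u v m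
  conv-scaleʳ c u v zero    = solve 3 (λ u c v → u :* (c :* v) := c :* (u :* v)) refl _ c _
  conv-scaleʳ c u v (suc m) = trans
    (+-cong (solve 3 (λ u c v → u :* (c :* v) := c :* (u :* v)) refl _ c _) (conv-scaleʳ c (λ i → u (suc i)) v m))
    (sym (distribˡ _ _ _))

  numeral : ℕ → Carrier
  numeral m = m · 1#

  derivative : (ℕ → Carrier) → ℕ → Carrier
  derivative u i = numeral (suc i) * u (suc i)

  -- The product rule on coefficients. In the step one copy of `conv u⁺ v` is split off: its shifted
  -- tail and `derivative u⁺` add up to the shift of `derivative u`.
  leibniz : ∀ u v m → numeral (suc m) * conv u v (suc m) ≈ conv (derivative u) v m + conv u (derivative v) m
  leibniz u v zero    = solve 5 (λ u₀ u₁ v₀ v₁ n → n :* (u₀ :* v₁ :+ u₁ :* v₀)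
    := (n :* u₁) :* v₀ :+ u₀ :* (n :* v₁)) refl (u 0) (u 1) (v 0) (v 1) (numeral 1)
  leibniz u v (suc m) = trans
    (solve 4 (λ N p q r → (p :+ N) :* (q :+ r) := (p :+ N) :* q :+ (p :* r :+ N :* r)) refl
      (numeral (suc m)) 1# (u 0 * v (suc (suc m))) (conv u⁺ v (suc m)))
    (trans (+-congˡ (+-cong (*-identityˡ _) (leibniz u⁺ v m)))
    (trans (solve 7 (λ N u₀ v₂ a b c d → N :* (u₀ :* v₂) :+ ((a :+ b) :+ (c :+ d))
        := (a :+ (b :+ c)) :+ (u₀ :* (N :* v₂) :+ d)) refl
      (numeral (suc (suc m))) (u 0) (v (suc (suc m))) (u 1 * v (suc m))
      (conv (λ i → u (suc (suc i))) v m) (conv (derivative u⁺) v m) (conv u⁺ (derivative v) m))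
    (+-congʳ (+-cong (*-congʳ (sym (trans (*-congʳ (+-identityʳ 1#)) (*-identityˡ _))))
      (trans (sym (conv-+ (λ i → u (suc (suc i))) (derivative u⁺) v m))
        (conv-cong (λ i → sym (trans (distribʳ _ _ _) (+-congʳ (*-identityˡ _)))) (λ _ → refl) m))))))
    where
    u⁺ : ℕ → Carrier
    u⁺ i = u (suc i)

  -- u is the coefficient sequence cᵏ / k!.
  IsExp : Carrier → (ℕ → Carrier) → Set ℓ
  IsExp c u = u 0 ≈ 1# × ∀ k → numeral (suc k) * u (suc k) ≈ c * u k

  -- The product rule replaces the binomial theorem: from `u' = c u` and `v' = d v` follows
  -- `(u v)' = (c + d) u v`.
  conv-exp : ∀ {c d u v} → IsExp c u → IsExp d v → IsExp (c + d) (conv u v)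
  conv-exp {c} {d} {u} {v} (u₀ , u′) (v₀ , v′) = trans (*-cong u₀ v₀) (*-identityˡ 1#) , λ k →
    trans (leibniz u v k) (trans (+-cong
      (trans (conv-cong u′ (λ _ → refl) k) (conv-scaleˡ c u v k))
      (trans (conv-cong {u} (λ _ → refl) v′ k) (conv-scaleʳ d u v k))) (sym (distribʳ _ _ _)))

  IsExp-unique : (∀ k → ∃ λ r → r * numeral (suc k) ≈ 1#) →
                 ∀ {c u v} → IsExp c u → IsExp c v → ∀ k → u k ≈ v k
  IsExp-unique recip (u₀ , u′) (v₀ , v′) zero    = trans u₀ (sym v₀)
  IsExp-unique recip {c} {u} {v} eu@(u₀ , u′) ev@(v₀ , v′) (suc k) with recip k
  ... | r , rN≈1 = trans (divide (u (suc k))) (trans (*-congˡ (trans (u′ k)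
      (trans (*-congˡ (IsExp-unique recip eu ev k)) (sym (v′ k))))) (sym (divide (v (suc k)))))
    where
    divide : ∀ x → x ≈ r * (numeral (suc k) * x)
    divide x = trans (sym (*-identityˡ x)) (trans (*-congʳ (sym rN≈1)) (*-assoc _ _ _))

  sum : (ℕ → Carrier) → ℕ → Carrier
  sum u zero    = 0#
  sum u (suc m) = u 0 + sum (λ i → u (suc i)) m

  sum-cong : ∀ {u v} → (∀ i → u i ≈ v i) → ∀ m → sum u m ≈ sum v m
  sum-cong p zero    = refl
  sum-cong p (suc m) = +-cong (p 0) (sum-cong (λ i → p (suc i)) m)

  sum-+ : ∀ u m k → sum u (m ℕ.+ k) ≈ sum u m + sum (λ i → u (m ℕ.+ i)) k
  sum-+ u zero    k = sym (+-identityˡ _)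
  sum-+ u (suc m) k = trans (+-congˡ (sum-+ (λ i → u (suc i)) m k)) (sym (+-assoc _ _ _))

  sum-snoc : ∀ u m → sum u (suc m) ≈ sum u m + u m
  sum-snoc u zero    = trans (+-identityʳ _) (sym (+-identityˡ _))
  sum-snoc u (suc m) = trans (+-congˡ (sum-snoc (λ i → u (suc i)) m)) (sym (+-assoc _ _ _))

  sum-distrib : ∀ u v m → sum (λ i → u i + v i) m ≈ sum u m + sum v m
  sum-distrib u v zero    = sym (+-identityʳ 0#)
  sum-distrib u v (suc m) = trans (+-congˡ (sum-distrib (λ i → u (suc i)) (λ i → v (suc i)) m))
    (solve 4 (λ a b c d → (a :+ b) :+ (c :+ d) := (a :+ c) :+ (b :+ d)) refl _ _ _ _)

  sum-scale : ∀ c v m → sum (λ i → c * v i) m ≈ c * sum v m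
  sum-scale c v zero    = sym (zeroʳ c)
  sum-scale c v (suc m) = trans (+-congˡ (sum-scale c (λ i → v (suc i)) m)) (sym (distribˡ _ _ _))

  sum-conv : ∀ u v m → sum (conv u v) (suc m) ≈ u 0 * sum v (suc m) + sum (conv (λ i → u (suc i)) v) m
  sum-conv u v m = trans (+-congˡ (trans
    (sum-distrib (λ i → u 0 * v (suc i)) (conv (λ i → u (suc i)) v) m)
    (+-congʳ (sum-scale (u 0) (λ i → v (suc i)) m))))
    (trans (sym (+-assoc _ _ _)) (+-congʳ (sym (distribˡ _ _ _))))

  -- The extra length `k` is for the induction: peeling off a term of `u` lowers `m` while the range
  -- of `v` stays `m + k`.
  cauchy-defect : (ℕ → Carrier) → (ℕ → Carrier) → ℕ → ℕ → Carrier
  cauchy-defect u v m k = sum u m * sum v (m ℕ.+ k) - sum (conv u v) m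

  cauchy-defect-suc : ∀ u v m k → cauchy-defect u v (suc m) k ≈
    u 0 * sum (λ i → v (suc m ℕ.+ i)) k + cauchy-defect (λ i → u (suc i)) v m (suc k)
  cauchy-defect-suc u v m k = trans (+-congˡ (-‿cong (sum-conv u v m))) (trans
    (solve 5 (λ u₀ U V W X → (u₀ :+ U) :* V :- (u₀ :* W :+ X) := u₀ :* (V :- W) :+ (U :* V :- X)) refl
      (u 0) (sum (λ i → u (suc i)) m) (sum v (suc m ℕ.+ k)) (sum v (suc m)) (sum (conv (λ i → u (suc i)) v) m))
    (+-cong (*-congˡ (trans (+-congʳ (sum-+ v (suc m) k))
        (solve 2 (λ x y → (x :+ y) :- x := y) refl _ _)))
      (+-congʳ (*-congˡ (reflexive (≡.cong (sum v) (≡.sym (ℕₚ.+-suc m k))))))))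

-- The exponential series on the imaginary axis: addition theorem and behaviour at 0

module Exponential {c ℓ₁ ℓ₂ ℓ₃} (R : RealNumbers c ℓ₁ ℓ₂ ℓ₃) where

  open Plane R
  open Order R
  open Subfields R using (module E; module E-Solver)
  open E using (_⊕_; _⊗_; _⊗^_; ⊝; conj; conj-⊗; module G)
  open IntegerSolver commutativeRing morphism
  open PowerSeries E.gaussianRing E.gaussianHom public
  open Algebra.Properties.Semiring.Exp G.semiring
    using () renaming (^-congˡ to ⊗^-congˡ; ^-assocʳ to ⊗^-assocʳ)
  open Algebra.Properties.Semiring.Exp semiring using (^-homo-*)

  -- The maximum norm, which avoids square roots; the price is a factor 2 in products.
  ∥_∥<_ : Point → Carrier → Set ℓ₃
  ∥ p , q ∥< b = ∣ p ∣< b × ∣ q ∣< b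

  ∥∥-resp : ∀ {z w a b} → z ≋ w → a ≈ b → ∥ z ∥< a → ∥ w ∥< b
  ∥∥-resp (p , q) a≈b (r , s) = abs-resp p a≈b r , abs-resp q a≈b s

  ∥∥-weaken : ∀ {z a b} → ∥ z ∥< a → a < b → ∥ z ∥< b
  ∥∥-weaken (p , q) a<b = abs-<-trans p a<b , abs-<-trans q a<b

  ∥∥-⊕ : ∀ {z w a b} → ∥ z ∥< a → ∥ w ∥< b → ∥ z ⊕ w ∥< (a + b)
  ∥∥-⊕ (p , q) (r , s) = abs-+ p r , abs-+ q s

  ∥∥-⊝ : ∀ {z a} → ∥ z ∥< a → ∥ ⊝ z ∥< a
  ∥∥-⊝ (p , q) = abs-neg p , abs-neg q

  ∥∥-⊗ : ∀ {z w a b} → ∥ z ∥< a → ∥ w ∥< b → ∥ z ⊗ w ∥< (a * b + a * b)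
  ∥∥-⊗ (p , q) (r , s) = abs-+ (abs-* p r) (abs-neg (abs-* q s)) , abs-+ (abs-* p s) (abs-* q r)

  ∥0∥ : ∀ {a} → 0# < a → ∥ G.0# ∥< a
  ∥0∥ 0<a = abs-pos 0<a , abs-pos 0<a

  -- Peeling off the first term replaces `a` by `a / 2`, and `a + 2 (a / 2) = 2 a`.
  sum-geometric : ∀ {t a} → 0# < a → (∀ i → ∥ t i ∥< (a * ½ ^ i)) → ∀ m → ∥ sum t m ∥< (a + a)
  sum-geometric 0<a t< zero = ∥0∥ (+-pos 0<a 0<a)
  sum-geometric {t} {a} 0<a t< (suc m) = ∥∥-resp (refl , refl)
    (+-cong (*-identityʳ a) (trans (sym (distribˡ a ½ ½)) (trans (*-congˡ ½+½≈1) (*-identityʳ a))))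
    (∥∥-⊕ {t 0} {sum (λ i → t (suc i)) m} (t< 0)
      (sum-geometric (*-pos 0<a 0<½) (λ i → ∥∥-resp (refl , refl) (sym (*-assoc a ½ _)) (t< (suc i))) m))
    where
    ½+½≈1 : ½ + ½ ≈ 1#
    ½+½≈1 = trans (solve 2 (λ h o → h :+ h := h :* (con (+ 1) :+ con (+ 1))) refl ½ 1#)
      (trans (*-congˡ (+-cong (+-identityʳ 1#) (+-identityʳ 1#))) ½*2≈1)

  -- The factor (1/4)ⁱ on one side against (1/2)ⁱ on the other makes the defect geometric.
  cauchy-defect-bound : ∀ {u v a b} → 0# < a → 0# < b →
    (∀ i → ∥ u i ∥< (a * (½ ^ i * ½ ^ i))) → (∀ i → ∥ v i ∥< (b * ½ ^ i)) →
    ∀ m k → ∥ cauchy-defect u v m k ∥< ((8 · 1#) * ((a * b) * ½ ^ m))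
  cauchy-defect-bound {u} {v} {a} {b} 0<a 0<b u< v< zero k = ∥∥-resp
    (G.sym (E-Solver.solve 1 (λ s → E-Solver.con (+ 0) E-Solver.:* s E-Solver.:- E-Solver.con (+ 0)
      E-Solver.:= E-Solver.con (+ 0)) G.refl (sum v k))) refl
    (∥0∥ (*-pos (0<suc 7) (*-pos (*-pos 0<a 0<b) 0<1)))
  cauchy-defect-bound {u} {v} {a} {b} 0<a 0<b u< v< (suc m) k = ∥∥-resp
    (G.sym (cauchy-defect-suc u v m k)) total
    (∥∥-⊕ {u 0 ⊗ tail} {cauchy-defect (λ i → u (suc i)) v m (suc k)}
      (∥∥-⊗ {u 0} {tail} (u< 0) tail<)
      (cauchy-defect-bound (*-pos 0<a (*-pos 0<½ 0<½)) 0<b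
        (λ i → ∥∥-resp (refl , refl)
          (solve 3 (λ a h p → a :* ((h :* p) :* (h :* p)) := (a :* (h :* h)) :* (p :* p)) refl a ½ (½ ^ i))
          (u< (suc i))) v< m (suc k)))
    where
    tail : Point
    tail = sum (λ i → v (suc m ℕ.+ i)) k

    tail< : ∥ tail ∥< (b * ½ ^ suc m + b * ½ ^ suc m)
    tail< = sum-geometric (*-pos 0<b (½^-pos (suc m)))
      (λ i → ∥∥-resp (refl , refl) (trans (*-congˡ (^-homo-* ½ (suc m) i)) (sym (*-assoc b _ _))) (v< (suc m ℕ.+ i))) k

    -- Half of the constant 8 pays for the leading product, at most `4 a b ½ ^ suc m`; the other
    -- half pays for the induction hypothesis, where the shift of `u` has turned `a` into `a / 4`.
    total : ((a * (1# * 1#)) * (b * ½ ^ suc m + b * ½ ^ suc m) + (a * (1# * 1#)) * (b * ½ ^ suc m + b * ½ ^ suc m))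
            + (8 · 1#) * ((a * (½ * ½) * b) * ½ ^ m) ≈ (8 · 1#) * ((a * b) * ½ ^ suc m)
    total = trans (+-cong (+-cong (*-congʳ a1≈a) (*-congʳ a1≈a)) refl) (trans
      (solve 4 (λ a b h p → (a :* (b :* (h :* p) :+ b :* (h :* p)) :+ a :* (b :* (h :* p) :+ b :* (h :* p)))
          :+ con (+ 8) :* ((a :* (h :* h) :* b) :* p)
        := (con (+ 4) :+ con (+ 4) :* (h :* con (+ 2))) :* ((a :* b) :* (h :* p))) refl a b ½ (½ ^ m))
      (*-congʳ (trans (+-congˡ (*-congˡ (1/-inverse 2)))
        (trans (+-congˡ (*-identityʳ _)) (solve 0 (con (+ 4) :+ con (+ 4) := con (+ 8)) refl)))))
      where
      a1≈a : a * (1# * 1#) ≈ a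
      a1≈a = trans (*-congˡ (*-identityˡ 1#)) (*-identityʳ a)

  ι : Point
  ι = 0# , 1#

  expCoeff : Carrier → ℕ → Point
  expCoeff x k = ι ⊗^ k ⊗ (expTerm x k , 0#)

  numeral≋ : ∀ m → numeral m ≋ (m · 1# , 0#)
  numeral≋ zero    = refl , refl
  numeral≋ (suc m) = +-congˡ (proj₁ (numeral≋ m)) , trans (+-identityˡ _) (proj₂ (numeral≋ m))

  numeral-invertible : ∀ k → ∃ λ r → r ⊗ numeral (suc k) ≋ G.1#
  numeral-invertible k = (1/ suc k , 0#) , G.trans (G.*-congˡ {1/ suc k , 0#} (numeral≋ (suc k)))
    ( trans (solve 2 (λ r m → r :* m :+ :- (con (+ 0) :* con (+ 0)) := r :* m) refl _ _) (1/-inverse (suc k))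
    , solve 2 (λ r m → r :* con (+ 0) :+ con (+ 0) :* m := con (+ 0)) refl _ _ )

  expTerm-0 : ∀ x → expTerm x 0 ≈ 1#
  expTerm-0 x = trans (*-identityˡ _) (trans (solve 1 (λ v → v := v :* con (+ 1)) refl _) (1/-inverse 1))

  expCoeff-exp : ∀ x → IsExp (0# , x) (expCoeff x)
  expCoeff-exp x = G.trans (G.*-identityˡ (expTerm x 0 , 0#)) (expTerm-0 x , refl) , step
    where
    step : ∀ k → numeral (suc k) ⊗ expCoeff x (suc k) ≋ (0# , x) ⊗ expCoeff x k
    step k = G.trans (G.*-congʳ {expCoeff x (suc k)} (numeral≋ (suc k)))
      (G.trans (E-Solver.solve 4 (λ N i p e → N E-Solver.:* ((i E-Solver.:* p) E-Solver.:* e)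
          E-Solver.:= p E-Solver.:* (i E-Solver.:* (N E-Solver.:* e))) G.refl
          (suc k · 1# , 0#) ι (ι ⊗^ k) (expTerm x (suc k) , 0#))
      (G.trans (G.*-congˡ {ι ⊗^ k} scalar)
        (E-Solver.solve 3 (λ p x e → p E-Solver.:* (x E-Solver.:* e) E-Solver.:= x E-Solver.:* (p E-Solver.:* e))
          G.refl (ι ⊗^ k) (0# , x) (expTerm x k , 0#))))
      where
      recurrence : (suc k · 1#) * expTerm x (suc k) ≈ x * expTerm x k
      recurrence = trans (*-congˡ (expTerm-suc x k)) (trans
        (solve 4 (λ N e x r → N :* (e :* (x :* r)) := (x :* e) :* (r :* N)) refl (suc k · 1#) (expTerm x k) x (1/ suc k))
        (trans (*-congˡ (1/-inverse (suc k))) (*-identityʳ _)))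

      scalar : ι ⊗ ((suc k · 1# , 0#) ⊗ (expTerm x (suc k) , 0#)) ≋ (0# , x) ⊗ (expTerm x k , 0#)
      scalar =
        solve 5 (λ o N e x t → con (+ 0) :* (N :* e :+ :- (con (+ 0) :* con (+ 0)))
            :+ :- (o :* (N :* con (+ 0) :+ con (+ 0) :* e)) := con (+ 0) :* t :+ :- (x :* con (+ 0)))
          refl 1# (suc k · 1#) (expTerm x (suc k)) x (expTerm x k) ,
        trans (solve 3 (λ o N e → con (+ 0) :* (N :* con (+ 0) :+ con (+ 0) :* e)
            :+ o :* (N :* e :+ :- (con (+ 0) :* con (+ 0))) := o :* (N :* e))
          refl 1# (suc k · 1#) (expTerm x (suc k)))
        (trans (*-identityˡ _) (trans recurrence
          (solve 2 (λ x e → x :* e := con (+ 0) :* con (+ 0) :+ x :* e) refl x (expTerm x k))))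

  -- Multiplication by `i` only swaps the coordinates up to sign, so the factor 2 of `∥∥-⊗` is
  -- avoided.
  ι^-bound : ∀ {z a} k → ∥ z ∥< a → ∥ ι ⊗^ k ⊗ z ∥< a
  ι^-bound {z} zero    z<a = ∥∥-resp (G.sym (G.*-identityˡ z)) refl z<a
  ι^-bound {z} (suc k) z<a = let p , q = ι^-bound k z<a in
    ∥∥-resp (G.sym (G.trans (G.*-assoc ι (ι ⊗^ k) z) (rotate (ι ⊗^ k ⊗ z)))) refl (abs-neg q , p)
    where
    rotate : ∀ w → ι ⊗ w ≋ (- proj₂ w , proj₁ w)
    rotate (a , b) =
      trans (solve 3 (λ o a b → con (+ 0) :* a :+ :- (o :* b) := :- (o :* b)) refl 1# a b) (-‿cong (*-identityˡ b)) ,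
      trans (solve 3 (λ o a b → con (+ 0) :* b :+ o :* a := o :* a) refl 1# a b) (*-identityˡ a)

  x<x+y : ∀ {x y} → 0# < y → x < x + y
  x<x+y {x} {y} 0<y = 0<-⇒< (<-respʳ-≈ (solve 2 (λ x y → y := (x :+ y) :- x) refl x y) 0<y)

  y<x+y : ∀ {x y} → 0# < x → y < x + y
  y<x+y {x} {y} 0<x = <-respʳ-≈ (+-comm y x) (x<x+y 0<x)

  -- A common bound for the finitely many indices below `k`, not a lower bound.
  bounded-below : ∀ (f : ℕ → Carrier) k → ∃ λ b → 0# < b × (∀ j → j ℕ.< k → ∣ f j ∣< b)
  bounded-below f zero    = 1# , 0<1 , λ j ()
  bounded-below f (suc k) with bounded-below f k | abs-bound 1 (f k)
  ... | b , 0<b , f<b | suc m , _ , fk<m = b + suc m · 1# , +-pos 0<b (0<suc m) , bound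
    where
    bound : ∀ j → j ℕ.< suc k → ∣ f j ∣< (b + suc m · 1#)
    bound j j<1+k with ℕₚ.m≤n⇒m<n∨m≡n (ℕₚ.≤-pred j<1+k)
    ... | inj₁ j<k    = abs-<-trans (f<b j j<k) (x<x+y (0<suc m))
    ... | inj₂ ≡.refl = abs-<-trans fk<m (y<x+y 0<b)

  expTerm-bounded-everywhere : ∀ y → ∃ λ a → 0# < a × (∀ j → ∣ expTerm y j ∣< a)
  expTerm-bounded-everywhere y with expTerm-bounded y
  ... | a , k , 0<a , e<a with bounded-below (expTerm y) k
  ...   | b , 0<b , e<b = a + b , +-pos 0<a 0<b , bound
    where
    bound : ∀ j → ∣ expTerm y j ∣< (a + b)
    bound j with ℕₚ.<-≤-connex j k
    ... | inj₁ j<k = abs-<-trans (e<b j j<k) (y<x+y 0<a)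
    ... | inj₂ k≤j = abs-<-trans (e<a j k≤j) (x<x+y 0<b)

  abs-scale : ∀ {x a p} → 0# < p → ∣ x ∣< a → ∣ x * p ∣< (a * p)
  abs-scale {x} {a} {p} 0<p (u , v) = abs-resp (*-comm p x) (*-comm p a)
    (*-monoˡ-< 0<p u , <-respˡ-≈ (solve 2 (λ p x → p :* :- x := :- (p :* x)) refl p x) (*-monoˡ-< 0<p v))

  -- `x ^ i / i!` is `½ ^ i` times the bounded sequence `(2 x) ^ i / i!`; with `4 x` the same device
  -- gives the factor `¼ ^ i`.
  expCoeff-½^ : ∀ x → ∃ λ a → 0# < a × (∀ i → ∥ expCoeff x i ∥< (a * ½ ^ i))
  expCoeff-½^ x = let a , 0<a , e<a = expTerm-bounded-everywhere (2# * x) in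
    a , 0<a , λ i → ι^-bound i
      ( abs-resp (expTerm-double x i) refl (abs-scale (½^-pos i) (e<a i))
      , abs-pos (*-pos 0<a (½^-pos i)) )

  expCoeff-¼^ : ∀ x → ∃ λ a → 0# < a × (∀ i → ∥ expCoeff x i ∥< (a * (½ ^ i * ½ ^ i)))
  expCoeff-¼^ x = let a , 0<a , e<a = expTerm-bounded-everywhere (2# * (2# * x)) in
    a , 0<a , λ i → ι^-bound i
      ( abs-resp (trans (*-congʳ (expTerm-double (2# * x) i)) (expTerm-double x i)) (*-assoc a _ _)
          (abs-scale (½^-pos i) (abs-scale (½^-pos i) (e<a i)))
      , abs-pos (*-pos 0<a (*-pos (½^-pos i) (½^-pos i))) )

  infix 4 _⇝_
  _⇝_ : (ℕ → Point) → Point → Set _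
  u ⇝ l = ∀ ε → 0# < ε → ∃ λ N → ∀ n → N ℕ.≤ n → ∥ u n ⊕ ⊝ l ∥< ε

  abs-small⇒≈0 : ∀ {x} → (∀ ε → 0# < ε → ∣ x ∣< ε) → x ≈ 0#
  abs-small⇒≈0 {x} small = ¬#⇒≈ λ x#0 →
    [ (λ x<0 → <-irrefl refl (proj₂ (small (- x) (neg-pos x<0))))
    , (λ 0<x → <-irrefl refl (proj₁ (small x 0<x))) ]′ (#⇒<⊎> x#0)

  ½*ε+½*ε : ∀ ε → ½ * ε + ½ * ε ≈ ε
  ½*ε+½*ε ε = trans (solve 2 (λ h e → h :* e :+ h :* e := (h :* con (+ 2)) :* e) refl ½ ε)
    (trans (*-congʳ (1/-inverse 2)) (*-identityˡ ε))

  -- Strict bounds do not pass to limits, hence the slack between `b` and `b′`.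
  limit-bound : ∀ {u l w b b′} N → u ⇝ l → (∀ n → N ℕ.≤ n → ∥ u n ⊕ ⊝ w ∥< b) → b < b′ → ∥ l ⊕ ⊝ w ∥< b′
  limit-bound {u} {l} {w} {b} {b′} N u⇝l u<b b<b′ with u⇝l (b′ - b) (<⇒0<- b<b′)
  ... | M , near = ∥∥-resp
    (E-Solver.solve 3 (λ u l w → (u E-Solver.:- w) E-Solver.:+ E-Solver.:- (u E-Solver.:- l) E-Solver.:= l E-Solver.:- w)
      G.refl (u (N ℕ.+ M)) l w)
    (solve 2 (λ b b′ → b :+ (b′ :- b) := b′) refl b b′)
    (∥∥-⊕ {u (N ℕ.+ M) ⊕ ⊝ w} {⊝ (u (N ℕ.+ M) ⊕ ⊝ l)} (u<b (N ℕ.+ M) (ℕₚ.m≤m+n N M))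
      (∥∥-⊝ {u (N ℕ.+ M) ⊕ ⊝ l} (near (N ℕ.+ M) (ℕₚ.m≤n+m M N))))

  small⇒≋ : ∀ {z w} → (∀ ε → 0# < ε → ∥ z ⊕ ⊝ w ∥< ε) → z ≋ w
  small⇒≋ {z} {w} small =
    x-y≈0⇒x≈y (abs-small⇒≈0 λ ε 0<ε → proj₁ (small ε 0<ε)) ,
    x-y≈0⇒x≈y (abs-small⇒≈0 λ ε 0<ε → proj₂ (small ε 0<ε))

  ⇝-unique : ∀ {u l l′} → u ⇝ l → u ⇝ l′ → l ≋ l′
  ⇝-unique {u} {l} {l′} u⇝l u⇝l′ = small⇒≋ {l} {l′} λ ε 0<ε →
    let N , near = u⇝l′ (½ * ε) (*-pos 0<½ 0<ε) in
    limit-bound {u} {l} {l′} N u⇝l near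
      (<-respʳ-≈ (½*ε+½*ε ε) (x<x+y (*-pos 0<½ 0<ε)))

  ⇝-perturb : ∀ {u v l} → u ⇝ l → (∀ ε → 0# < ε → ∃ λ N → ∀ n → N ℕ.≤ n → ∥ u n ⊕ ⊝ (v n) ∥< ε) → v ⇝ l
  ⇝-perturb {u} {v} {l} u⇝l u~v ε 0<ε with u⇝l (½ * ε) (*-pos 0<½ 0<ε) | u~v (½ * ε) (*-pos 0<½ 0<ε)
  ... | N , near | M , close = N ℕ.+ M , λ n N+M≤n → ∥∥-resp
    (E-Solver.solve 3 (λ u v l → (u E-Solver.:- l) E-Solver.:+ E-Solver.:- (u E-Solver.:- v) E-Solver.:= v E-Solver.:- l)
      G.refl (u n) (v n) l) (½*ε+½*ε ε)
    (∥∥-⊕ {u n ⊕ ⊝ l} {⊝ (u n ⊕ ⊝ (v n))} (near n (ℕₚ.m+n≤o⇒m≤o N N+M≤n))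
      (∥∥-⊝ {u n ⊕ ⊝ (v n)} (close n (ℕₚ.m+n≤o⇒n≤o N N+M≤n))))

  ⇝-resp : ∀ {u v l} → (∀ n → u n ≋ v n) → u ⇝ l → v ⇝ l
  ⇝-resp {u} {v} {l} u≋v u⇝l ε 0<ε = let N , near = u⇝l ε 0<ε in
    N , λ n N≤n → ∥∥-resp (G.+-congʳ {⊝ l} (u≋v n)) refl (near n N≤n)

  point-bound : ∀ z → ∃ λ b → 0# < b × ∥ z ∥< b
  point-bound (p , q) with abs-bound 1 p | abs-bound 1 q
  ... | suc m , _ , p<m | suc k , _ , q<k = suc m · 1# + suc k · 1# , +-pos (0<suc m) (0<suc k) ,
    abs-<-trans p<m (x<x+y (0<suc k)) , abs-<-trans q<k (y<x+y (0<suc m))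

  -- In `u v - l m = (u - l) (v - m) + (u - l) m + l (v - m)` the hypothesis `d < 2` turns the
  -- quadratic term into a linear one.
  product-near : ∀ {u v l m a b d} → d < 2 · 1# → ∥ u ⊕ ⊝ l ∥< d → ∥ v ⊕ ⊝ m ∥< d → ∥ l ∥< a → ∥ m ∥< b →
    ∥ u ⊗ v ⊕ ⊝ (l ⊗ m) ∥< (((4 · 1#) + ((a + a) + (b + b))) * d)
  product-near {u} {v} {l} {m} {a} {b} {d} d<2 u~l v~m l<a m<b = ∥∥-resp
    (E-Solver.solve 4 (λ u v l m → (u E-Solver.:- l) E-Solver.:* (v E-Solver.:- m) E-Solver.:+
        ((u E-Solver.:- l) E-Solver.:* m E-Solver.:+ l E-Solver.:* (v E-Solver.:- m))
        E-Solver.:= u E-Solver.:* v E-Solver.:- l E-Solver.:* m) G.refl u v l m)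
    (solve 3 (λ a b d → (con (+ 2) :* d :+ con (+ 2) :* d) :+ ((d :* b :+ d :* b) :+ (a :* d :+ a :* d))
        := (con (+ 4) :+ ((a :+ a) :+ (b :+ b))) :* d) refl a b d)
    (∥∥-⊕ {(u ⊕ ⊝ l) ⊗ (v ⊕ ⊝ m)} {(u ⊕ ⊝ l) ⊗ m ⊕ l ⊗ (v ⊕ ⊝ m)}
      (∥∥-⊗ {u ⊕ ⊝ l} {v ⊕ ⊝ m} (∥∥-weaken u~l d<2) v~m)
      (∥∥-⊕ {(u ⊕ ⊝ l) ⊗ m} {l ⊗ (v ⊕ ⊝ m)}
        (∥∥-⊗ {u ⊕ ⊝ l} {m} u~l m<b) (∥∥-⊗ {l} {v ⊕ ⊝ m} l<a v~m)))

  ⇝-⊗ : ∀ {u v l m} → u ⇝ l → v ⇝ m → (λ n → u n ⊗ v n) ⇝ l ⊗ m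
  ⇝-⊗ {u} {v} {l} {m} u⇝l v⇝m ε 0<ε =
    let a , _ , l<a    = point-bound l
        b , _ , m<b    = point-bound m
        k , _ , small  = ½^-vanishes 0 ((4 · 1#) + ((a + a) + (b + b))) 0<ε
        N , near-u     = u⇝l (½ ^ k) (½^-pos k)
        M , near-v     = v⇝m (½ ^ k) (½^-pos k)
    in N ℕ.+ M , λ n N+M≤n → ∥∥-weaken
      (product-near {u n} {v n} {l} {m} (<-respʳ-≈ (+-congˡ (sym (+-identityʳ 1#))) (½^-<2 k))
        (near-u n (ℕₚ.m+n≤o⇒m≤o N N+M≤n)) (near-v n (ℕₚ.m+n≤o⇒n≤o N N+M≤n)) l<a m<b)
      small

  ι^-even : ∀ k → ι ⊗^ (2 ℕ.* k) ≋ ((- 1#) ^ k , 0#)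
  ι^-even k = G.trans (G.sym (⊗^-assocʳ ι 2 k)) (G.trans (⊗^-congˡ k ι²≋-1) (real-power k))
    where
    ι²≋-1 : ι ⊗^ 2 ≋ (- 1# , 0#)
    ι²≋-1 = G.trans (G.*-congˡ {ι} (G.*-identityʳ ι))
      ( trans (solve 1 (λ o → con (+ 0) :* con (+ 0) :+ :- (o :* o) := :- (o :* o)) refl 1#) (-‿cong (*-identityˡ 1#))
      , solve 1 (λ o → con (+ 0) :* o :+ o :* con (+ 0) := con (+ 0)) refl 1# )

    real-power : ∀ k → (- 1# , 0#) ⊗^ k ≋ ((- 1#) ^ k , 0#)
    real-power zero    = refl , refl
    real-power (suc k) = G.trans (G.*-congˡ { - 1# , 0#} (real-power k))
      ( solve 2 (λ s p → s :* p :+ :- (con (+ 0) :* con (+ 0)) := s :* p) refl _ _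
      , solve 2 (λ s p → s :* con (+ 0) :+ con (+ 0) :* p := con (+ 0)) refl _ _ )

  expCoeff-even : ∀ x k → expCoeff x (2 ℕ.* k) ≋ (cosTerm x k , 0#)
  expCoeff-even x k = G.trans (G.*-congʳ {expTerm x (2 ℕ.* k) , 0#} (ι^-even k))
    ( solve 2 (λ s e → s :* e :+ :- (con (+ 0) :* con (+ 0)) := s :* e) refl _ _
    , solve 2 (λ s e → s :* con (+ 0) :+ con (+ 0) :* e := con (+ 0)) refl _ _ )

  expCoeff-odd : ∀ x k → expCoeff x (suc (2 ℕ.* k)) ≋ (0# , sinTerm x k)
  expCoeff-odd x k = G.trans (G.*-congʳ {expTerm x (suc (2 ℕ.* k)) , 0#} (G.*-congˡ {ι} (ι^-even k)))
    ( solve 3 (λ o s e → (con (+ 0) :* s :+ :- (o :* con (+ 0))) :* e :+ :- ((con (+ 0) :* con (+ 0) :+ o :* s) :* con (+ 0))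
        := con (+ 0)) refl 1# _ _
    , trans (solve 3 (λ o s e → (con (+ 0) :* s :+ :- (o :* con (+ 0))) :* con (+ 0)
          :+ (con (+ 0) :* con (+ 0) :+ o :* s) :* e := o :* (s :* e)) refl 1# _ _) (*-identityˡ _) )

  -- Terms alternate between real and imaginary, so `m` cosine and `m` sine terms make up `2 m`
  -- terms; this is why limits run along even partial sums.
  sum-expCoeff : ∀ x m → sum (expCoeff x) (2 ℕ.* m) ≋ (partialSum (cosTerm x) m , partialSum (sinTerm x) m)
  sum-expCoeff x zero    = refl , refl
  sum-expCoeff x (suc m) = G.trans (G.reflexive (≡.cong (sum (expCoeff x)) (ℕₚ.*-suc 2 m)))
    (G.trans (sum-snoc (expCoeff x) (suc (2 ℕ.* m)))
    (G.trans (G.+-cong (G.trans (sum-snoc (expCoeff x) (2 ℕ.* m))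
        (G.+-cong (sum-expCoeff x m) (expCoeff-even x m))) (expCoeff-odd x m))
      (+-identityʳ _ , +-congʳ (+-identityʳ _))))

  pair-limit : ∀ {s t p q} → s ⟶ p → t ⟶ q → (λ n → s n , t n) ⇝ (p , q)
  pair-limit s⟶p t⟶q ε 0<ε =
    let N , near-s = s⟶p ε 0<ε
        M , near-t = t⟶q ε 0<ε
    in N ℕ.+ M , λ n N+M≤n → near-s n (ℕₚ.m+n≤o⇒m≤o N N+M≤n) , near-t n (ℕₚ.m+n≤o⇒n≤o N N+M≤n)

  -- Abstract, so that the limits defining cos and sin are never unfolded.
  abstract
    cis : Carrier → Point
    cis x = ∠ x

    ∠≋cis : ∀ x → ∠ x ≋ cis x
    ∠≋cis x = refl , refl

    expCoeff⇝cis : ∀ x → (λ m → sum (expCoeff x) (2 ℕ.* m)) ⇝ cis x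
    expCoeff⇝cis x = ⇝-resp {l = ∠ x} (λ m → G.sym (sum-expCoeff x m))
      (pair-limit (proj₂ (cos-series x)) (proj₂ (sin-series x)))

  -- Identities for `cis` thus reduce to checking the recurrence `IsExp` for a suitable sequence and
  -- uniqueness of limits.
  exp-limit : ∀ {x u} → IsExp (0# , x) u → (λ m → sum u (2 ℕ.* m)) ⇝ cis x
  exp-limit {x} {u} eu = ⇝-resp {l = cis x}
    (λ m → sum-cong (IsExp-unique numeral-invertible (expCoeff-exp x) eu) (2 ℕ.* m)) (expCoeff⇝cis x)

  IsExp-resp : ∀ {c d u} → c ≋ d → IsExp c u → IsExp d u
  IsExp-resp {u = u} c≋d (u₀ , u′) = u₀ , λ k → G.trans (u′ k) (G.*-congʳ {u k} c≋d)

  cis-cong : ∀ {x y} → x ≈ y → cis x ≋ cis y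
  cis-cong {x} {y} x≈y = ⇝-unique (expCoeff⇝cis x)
    (exp-limit {y} {expCoeff x} (IsExp-resp {u = expCoeff x} (refl , x≈y) (expCoeff-exp x)))

  -- The Cauchy product of the two series satisfies the recurrence for `x + y`, and its partial sums
  -- differ from the products of partial sums by the vanishing `cauchy-defect`.
  cis-+ : ∀ x y → cis (x + y) ≋ cis x ⊗ cis y
  cis-+ x y = ⇝-unique
    (exp-limit {x + y} {conv u v}
      (IsExp-resp {u = conv u v} (+-identityˡ 0# , refl) (conv-exp (expCoeff-exp x) (expCoeff-exp y))))
    (⇝-perturb {l = cis x ⊗ cis y} (⇝-⊗ {l = cis x} {cis y} (expCoeff⇝cis x) (expCoeff⇝cis y))
      (vanishing (expCoeff-¼^ x) (expCoeff-½^ y)))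
    where
    u v : ℕ → Point
    u = expCoeff x
    v = expCoeff y

    vanishing : (∃ λ a → 0# < a × (∀ i → ∥ u i ∥< (a * (½ ^ i * ½ ^ i)))) →
      (∃ λ b → 0# < b × (∀ i → ∥ v i ∥< (b * ½ ^ i))) → ∀ ε → 0# < ε → ∃ λ N → ∀ n → N ℕ.≤ n →
      ∥ sum u (2 ℕ.* n) ⊗ sum v (2 ℕ.* n) ⊕ ⊝ (sum (conv u v) (2 ℕ.* n)) ∥< ε
    vanishing (a , 0<a , u<a) (b , 0<b , v<b) ε 0<ε =
      -- The factor `2#` is the slack in `½^-antitone`, which bounds `½ ^ (2 n)` by `2 ½ ^ N`.
      let N , _ , small = ½^-vanishes 0 (((8 · 1#) * (a * b)) * 2#) 0<ε in
      N , λ n N≤n → ∥∥-weaken (∥∥-resp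
        (G.+-congʳ {⊝ (sum (conv u v) (2 ℕ.* n))} (G.*-congˡ {sum u (2 ℕ.* n)}
          (G.reflexive (≡.cong (sum v) (ℕₚ.+-identityʳ (2 ℕ.* n)))))) refl
        (cauchy-defect-bound 0<a 0<b u<a v<b (2 ℕ.* n) 0))
        (<-trans (<-respˡ-≈ (*-assoc _ _ _) (*-monoˡ-< (*-pos (0<suc 7) (*-pos 0<a 0<b))
            (½^-antitone (ℕₚ.≤⇒≤′ (ℕₚ.≤-trans N≤n (k≤2k n))))))
          (<-respˡ-≈ (*-assoc _ _ _) small))

  conj-cong : ∀ {z w} → z ≋ w → conj z ≋ conj w
  conj-cong (p , q) = p , -‿cong q

  conj-⊕ : ∀ z w → conj (z ⊕ w) ≋ conj z ⊕ conj w
  conj-⊕ (a , b) (c , d) = refl , solve 2 (λ b d → :- (b :+ d) := :- b :+ :- d) refl b d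

  sum-conj : ∀ u m → sum (λ i → conj (u i)) m ≋ conj (sum u m)
  sum-conj u zero    = refl , sym -0≈0
  sum-conj u (suc m) = G.trans (G.+-congˡ {conj (u 0)} (sum-conj (λ i → u (suc i)) m))
    (G.sym (conj-⊕ (u 0) (sum (λ i → u (suc i)) m)))

  ⇝-conj : ∀ {u l} → u ⇝ l → (λ n → conj (u n)) ⇝ conj l
  ⇝-conj {u} {l} u⇝l ε 0<ε = let N , near = u⇝l ε 0<ε in N , λ n N≤n →
    let p , q = near n N≤n in
    p , abs-resp (solve 2 (λ b d → :- (b :+ :- d) := :- b :+ :- :- d) refl (proj₂ (u n)) (proj₂ l)) refl (abs-neg q)

  -- The conjugated coefficients satisfy the recurrence for the conjugate `- i x` of `i x`.
  cis-neg : ∀ x → cis (- x) ≋ conj (cis x)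
  cis-neg x = ⇝-unique {λ m → sum (λ i → conj (u i)) (2 ℕ.* m)} {cis (- x)} {conj (cis x)}
    (exp-limit conj-exp)
    (⇝-resp {l = conj (cis x)} (λ m → G.sym (sum-conj u (2 ℕ.* m))) (⇝-conj {l = cis x} (expCoeff⇝cis x)))
    where
    u : ℕ → Point
    u = expCoeff x

    numeral-real : ∀ m → numeral m ≋ conj (numeral m)
    numeral-real m = refl , trans (proj₂ (numeral≋ m)) (sym (trans (-‿cong (proj₂ (numeral≋ m))) -0≈0))

    conj-exp : IsExp (0# , - x) (λ i → conj (u i))
    conj-exp = G.trans (conj-cong (proj₁ (expCoeff-exp x))) (refl , -0≈0) , λ k →
      G.trans (G.*-congʳ {conj (u (suc k))} (numeral-real (suc k)))
        (G.trans (G.sym (conj-⊗ (numeral (suc k)) (u (suc k))))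
          (G.trans (conj-cong (proj₂ (expCoeff-exp x) k)) (conj-⊗ (0# , x) (u k))))

  cis-0 : cis 0# ≋ G.1#
  cis-0 = ⇝-unique {λ m → sum δ (2 ℕ.* m)} {cis 0#} {G.1#} (exp-limit {0#} {δ} δ-exp) δ⇝1
    where
    δ : ℕ → Point
    δ zero    = G.1#
    δ (suc _) = G.0#

    δ-exp : IsExp (0# , 0#) δ
    δ-exp = G.refl , λ k → G.trans (G.zeroʳ (numeral (suc k))) (G.sym (G.zeroˡ (δ k)))

    sum-0 : ∀ m → sum (λ _ → G.0#) m ≋ G.0#
    sum-0 zero    = G.refl
    sum-0 (suc m) = G.trans (G.+-identityˡ (sum (λ _ → G.0#) m)) (sum-0 m)

    δ⇝1 : (λ m → sum δ (2 ℕ.* m)) ⇝ G.1#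
    -- The empty sum misses the constant term, so the estimate starts at index 1.
    δ⇝1 ε 0<ε = 1 , λ { (suc n) _ → ∥∥-resp
      (G.sym (G.trans (G.+-congʳ {⊝ G.1#} (G.trans (G.+-congˡ {G.1#} (sum-0 (n ℕ.+ suc (n ℕ.+ 0)))) (G.+-identityʳ G.1#)))
        (G.-‿inverseʳ G.1#)))
      refl (∥0∥ 0<ε) }

  cis-unit : ∀ x → cis x ⊗ conj (cis x) ≋ G.1#
  cis-unit x = G.trans (G.*-congˡ {cis x} (G.sym (cis-neg x)))
    (G.trans (G.sym (cis-+ x (- x))) (G.trans (cis-cong (-‿inverseʳ x)) cis-0))

  unit⇒S¹ : ∀ z → z ⊗ conj z ≋ G.1# → z ∈ S¹
  unit⇒S¹ (a , b) (p , _) = trans (solve 2 (λ a b → a :* a :+ b :* b := a :* a :+ :- (b :* :- b)) refl a b) p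

  cis∈S¹ : ∀ x → cis x ∈ S¹
  cis∈S¹ x = unit⇒S¹ (cis x) (cis-unit x)

  0<1/suc : ∀ k → 0# < 1/ suc k
  0<1/suc k = inverse-pos (0<suc k) (1/-inverse (suc k))

  div-< : ∀ {x a} k → 0# < a → x < a → x / suc k < a
  div-< {x} {a} k 0<a x<a = 0<-⇒< (<-respʳ-≈
    (trans (solve 4 (λ a x v N → v :* ((a :- x) :+ N :* a) := (v :* (con (+ 1) :+ N)) :* a :- x :* v) refl
        a x (1/ suc k) (k · 1#))
      (+-congʳ (trans (*-congʳ (trans (*-congˡ (+-congʳ (+-identityʳ 1#))) (1/-inverse (suc k)))) (*-identityˡ a))))
    (*-pos (0<1/suc k) (positive k)))
    where
    positive : ∀ k → 0# < (a - x) + k · 1# * a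
    positive zero    = <-respʳ-≈ (solve 2 (λ a x → a :- x := (a :- x) :+ con (+ 0) :* a) refl a x) (<⇒0<- x<a)
    positive (suc k) = +-pos (<⇒0<- x<a) (*-pos (0<suc k) 0<a)

  abs-pos⁻¹ : ∀ {x a} → ∣ x ∣< a → 0# < a
  abs-pos⁻¹ {x} {a} (p , q) = 0<x+x⇒0<x (<-respˡ-≈ (-‿inverseʳ x) (+-mono-< p q))

  abs-div : ∀ {x a} k → ∣ x ∣< a → ∣ x / suc k ∣< a
  abs-div {x} k x<a = div-< k (abs-pos⁻¹ x<a) (proj₁ x<a) ,
    <-respˡ-≈ (solve 2 (λ x v → :- x :* v := :- (x :* v)) refl x _) (div-< k (abs-pos⁻¹ x<a) (proj₂ x<a))

  expTerm-1 : ∀ h → expTerm h 1 ≈ h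
  expTerm-1 h = trans (expTerm-suc h 0) (trans (*-cong (expTerm-0 h) (trans (*-congˡ 1/1≈1) (*-identityʳ h))) (*-identityˡ h))
    where
    1/1≈1 : 1/ 1 ≈ 1#
    1/1≈1 = trans (solve 1 (λ v → v := v :* con (+ 1)) refl _) (1/-inverse 1)

  -- The quadratic term is below `r²`, and each later quotient of successive terms is below `½`.
  expTerm-small : ∀ {h r} → ∣ h ∣< r → r < ½ → ∀ k → ∣ expTerm h (2 ℕ.+ k) ∣< ((r * r) * ½ ^ k)
  expTerm-small {h} {r} h<r r<½ zero = abs-resp
    (trans (*-congʳ (sym (expTerm-1 h))) (sym (expTerm-suc h 1))) (sym (*-identityʳ _))
    (abs-* h<r (abs-div 1 h<r))
  expTerm-small {h} {r} h<r r<½ (suc k) = abs-resp (sym (expTerm-suc h (2 ℕ.+ k)))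
    (solve 3 (λ r h p → (r :* p) :* h := r :* (h :* p)) refl (r * r) ½ (½ ^ k))
    (abs-* (expTerm-small h<r r<½ k) (abs-<-trans (abs-div (2 ℕ.+ k) h<r) r<½))

  -- The tail after `1 + i h` is dominated by a geometric series of sum `2 r²`; the third `r²` is
  -- the slack for the limit.
  cis-near : ∀ {h r} → ∣ h ∣< r → r < ½ → ∥ cis h ⊕ ⊝ (1# , h) ∥< ((r * r + r * r) + r * r)
  cis-near {h} {r} h<r r<½ = limit-bound {λ m → sum u (2 ℕ.* m)} {cis h} {1# , h} 1 (expCoeff⇝cis h)
    partial (x<x+y 0<r²)
    where
    u : ℕ → Point
    u = expCoeff h

    0<r² : 0# < r * r
    0<r² = *-pos (abs-pos⁻¹ h<r) (abs-pos⁻¹ h<r)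

    u₁≋ : u 1 ≋ (0# , h)
    u₁≋ = G.trans (G.*-congʳ {expTerm h 1 , 0#} (G.*-identityʳ ι))
      ( solve 2 (λ o e → con (+ 0) :* e :+ :- (o :* con (+ 0)) := con (+ 0)) refl 1# (expTerm h 1)
      , trans (solve 2 (λ o e → con (+ 0) :* con (+ 0) :+ o :* e := o :* e) refl 1# (expTerm h 1))
          (trans (*-identityˡ _) (expTerm-1 h)) )

    tail : ℕ → Point
    tail m = sum (λ i → u (suc (suc i))) m

    split : ∀ m → sum u (suc (suc m)) ⊕ ⊝ (1# , h) ≋ tail m
    split m = G.trans (G.+-congʳ {⊝ (1# , h)} (G.+-cong (proj₁ (expCoeff-exp h)) (G.+-congʳ {tail m} u₁≋)))
      ( solve 2 (λ o t → (o :+ (con (+ 0) :+ t)) :+ :- o := t) refl 1# (proj₁ (tail m))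
      , solve 2 (λ h t → (con (+ 0) :+ (h :+ t)) :+ :- h := t) refl h (proj₂ (tail m)) )

    tail< : ∀ m → ∥ tail m ∥< (r * r + r * r)
    tail< m = sum-geometric 0<r² (λ i → ι^-bound (2 ℕ.+ i)
      (expTerm-small h<r r<½ i , abs-pos (*-pos 0<r² (½^-pos i)))) m

    partial : ∀ n → 1 ℕ.≤ n → ∥ sum u (2 ℕ.* n) ⊕ ⊝ (1# , h) ∥< (r * r + r * r)
    partial (suc m) _ = ∥∥-resp
      (G.trans (G.sym (split (2 ℕ.* m))) (G.+-congʳ {⊝ (1# , h)} (G.reflexive (≡.cong (sum u) (≡.sym (ℕₚ.*-suc 2 m))))))
      refl (tail< (2 ℕ.* m))

-- Angles of points of the circle, and density

module Surjectivity {c ℓ₁ ℓ₂ ℓ₃} (R : RealNumbers c ℓ₁ ℓ₂ ℓ₃) where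

  open Plane R
  open Order R
  open Subfields R using (module E; module E-Solver)
  open E using (_⊕_; _⊗_; ⊝; normSq-⊗; module G)
  open IntegerSolver commutativeRing morphism
  open Exponential R
  open Rotations R using (cayley; cayley-⊗; 0<1+t²; +-pos-nonneg)

  ½^-<1 : ∀ k → ½ ^ suc k < 1#
  ½^-<1 k = ½*-< (½^-<2 k)

  ½^-<½ : ∀ {k} → 2 ℕ.≤ k → ½ ^ k < ½
  ½^-<½ {suc (suc k)} _              = <-respʳ-≈ (*-identityʳ ½) (*-monoˡ-< 0<½ (½^-<1 k))
  ½^-<½ {suc zero}    (ℕ.s≤s ())

  S¹-⊗ : ∀ {z w} → z ∈ S¹ → w ∈ S¹ → z ⊗ w ∈ S¹
  S¹-⊗ {z} {w} p q = trans (normSq-⊗ z w) (trans (*-cong p q) (*-identityˡ 1#))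

  S¹-resp : ∀ {z w} → z ≋ w → z ∈ S¹ → w ∈ S¹
  S¹-resp (p , q) z∈ = trans (+-cong (*-cong (sym p) (sym p)) (*-cong (sym q) (sym q))) z∈

  -- `3 r² + r < 4 r`, since `r < 1`.
  cis-near-1 : ∀ {h r} → ∣ h ∣< r → r < ½ → ∥ cis h ⊕ ⊝ G.1# ∥< ((4 · 1#) * r)
  cis-near-1 {h} {r} h<r r<½ = ∥∥-weaken (∥∥-resp
    (G.trans (G.+-assoc (cis h) (⊝ (1# , h)) (0# , h)) (G.+-congˡ {cis h}
      ( solve 1 (λ o → :- o :+ con (+ 0) := :- o) refl 1#
      , solve 1 (λ h → :- h :+ h := :- con (+ 0)) refl h )))
    refl (∥∥-⊕ {cis h ⊕ ⊝ (1# , h)} {0# , h} (cis-near h<r r<½) (abs-pos 0<r , h<r)))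
    (0<-⇒< (<-respʳ-≈ (trans (solve 2 (λ o r → r :* (o :- r) :+ (r :* (o :- r) :+ r :* (o :- r))
          := (con (+ 3) :* o) :* r :- ((r :* r :+ r :* r) :+ r :* r)) refl 1# r)
        (trans (+-congʳ (*-congʳ (*-identityʳ _)))
          (solve 1 (λ r → con (+ 3) :* r :- ((r :* r :+ r :* r) :+ r :* r)
            := con (+ 4) :* r :- (((r :* r :+ r :* r) :+ r :* r) :+ r)) refl r)))
      (+-pos pos (+-pos pos pos))))
    where
    0<r : 0# < r
    0<r = abs-pos⁻¹ h<r

    ½<1 : ½ < 1#
    ½<1 = <-respˡ-≈ (*-identityʳ ½) (½*-< 1<2)

    pos : 0# < r * (1# - r)
    pos = *-pos 0<r (<⇒0<- (<-trans r<½ ½<1))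

  constant⇝ : ∀ l → (λ _ → l) ⇝ l
  constant⇝ l ε 0<ε = 0 , λ _ _ → ∥∥-resp (G.sym (G.-‿inverseʳ l)) refl (∥0∥ 0<ε)

  -- By the addition theorem, continuity at `α` reduces to continuity at 0.
  cis-continuous : ∀ {s α} → s ⟶ α → (λ k → cis (s k)) ⇝ cis α
  cis-continuous {s} {α} s⟶α = ⇝-resp {l = cis α}
    (λ k → G.trans (G.sym (cis-+ α (s k - α))) (cis-cong (solve 2 (λ a s → a :+ (s :- a) := s) refl α (s k))))
    (λ ε 0<ε → let N , near = ⇝-⊗ {l = cis α} {G.1#} (constant⇝ (cis α)) deviation⇝1 ε 0<ε in
      N , λ n N≤n → ∥∥-resp (G.+-congˡ {cis α ⊗ cis (s n - α)} (G.-‿cong (G.*-identityʳ (cis α)))) refl (near n N≤n))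
    where
    deviation⇝1 : (λ k → cis (s k - α)) ⇝ G.1#
    deviation⇝1 ε 0<ε = let k , 2≤k , small = ½^-vanishes 2 (4 · 1#) 0<ε
                            N , near        = s⟶α (½ ^ k) (½^-pos k)
      in N , λ n N≤n → ∥∥-weaken (cis-near-1 (near n N≤n) (½^-<½ 2≤k)) small

  module _ {z : Point} {r : Carrier} (z∈ : z ∈ S¹) where

    private
      κ d : Carrier
      κ = 1# - proj₁ z
      d = proj₂ z

      κ[2-κ]≈d² : κ * (2# - κ) ≈ d * d
      κ[2-κ]≈d² = trans (solve 3 (λ o c d → (o :- c) :* ((o :+ o) :- (o :- c)) := (o :* o :- (c :* c :+ d :* d)) :+ d :* d)
          refl 1# (proj₁ z) d)
        (trans (+-congʳ (trans (+-cong (*-identityˡ 1#) (-‿cong z∈)) (-‿inverseʳ 1#))) (+-identityˡ _))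

    -- On the circle `κ (2 - κ) = d²`. For `κ < 1` the second factor exceeds 1, so `0 ≤ κ ≤ d²`: the
    -- real deviation is quadratic in the imaginary part.
    S¹-near-1 : ∣ κ ∣< 1# → ∣ d ∣< r → ∣ κ ∣< (r * r)
    S¹-near-1 (κ<1 , _) d<r =
      [ (λ d²<κ → ⊥-elim ([ square-nonneg d , (λ 0<κ → <-asym d²<κ (κ<d² 0<κ)) ]′ (<-cotrans d²<κ 0#)))
      , (λ κ<r² → κ<r²) ]′ (<-cotrans (proj₁ (abs-* d<r d<r)) κ) ,
      [ (λ 0<-κ → ⊥-elim (κ≮0 0<-κ)) , (λ -κ<r² → -κ<r²) ]′
        (<-cotrans (*-pos (abs-pos⁻¹ d<r) (abs-pos⁻¹ d<r)) (- κ))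
      where
      0<2-κ : 0# < 2# - κ
      0<2-κ = <⇒0<- (<-trans κ<1 1<2)

      κ≮0 : ¬ 0# < - κ
      κ≮0 0<-κ = square-nonneg d (0<-⇒< (<-respʳ-≈ (trans
        (solve 2 (λ k t → :- k :* t := con (+ 0) :- k :* t) refl κ (2# - κ)) (+-congˡ (-‿cong κ[2-κ]≈d²)))
        (*-pos 0<-κ 0<2-κ)))

      κ<d² : 0# < κ → κ < d * d
      κ<d² 0<κ = 0<-⇒< (<-respʳ-≈ (trans (trans (solve 2 (λ o k → k :* (o :- k) := k :* ((o :+ o) :- k) :- o :* k) refl 1# κ)
          (+-congˡ (-‿cong (*-identityˡ κ)))) (+-congʳ κ[2-κ]≈d²))
        (*-pos 0<κ (<⇒0<- κ<1)))

  -- `real` merely selects the right half of the circle, where `S¹-near-1` lets `imag` control the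
  -- distance from 1.
  record Near (r : Carrier) (z : Point) : Set (ℓ₁ ⊔ ℓ₃) where
    constructor isNear
    field
      unit : z ∈ S¹
      real : ∣ 1# - proj₁ z ∣< 1#
      imag : ∣ proj₂ z ∣< r

  Near-resp : ∀ {r r′ z w} → r ≈ r′ → z ≋ w → Near r z → Near r′ w
  Near-resp r≈r′ z≋w (isNear unit real imag) =
    isNear (S¹-resp z≋w unit) (abs-resp (+-congˡ (-‿cong (proj₁ z≋w))) refl real) (abs-resp (proj₂ z≋w) r≈r′ imag)

  -- The effect of α ↦ α + Im (z / cis α) on the residual z / cis α.
  newton-step : ∀ {r z} → 0# < 1# - (64 · 1#) * r → Near (r + r) z → Near r (z ⊗ cis (- proj₂ z))
  newton-step {r} {z@(c , d)} 0<t (isNear unit real imag) = isNear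
    (S¹-⊗ {z} {cis (- d)} unit (cis∈S¹ (- d)))
    (abs-<-trans (abs-resp real≈ refl real<) real-small)
    (abs-<-trans (abs-resp imag≈ refl imag<) imag-small)
    where
    s t κ ρ₁ ρ₂ : Carrier
    s  = r + r
    t  = 1# - (64 · 1#) * r
    κ  = 1# - c
    ρ₁ = proj₁ (cis (- d)) - 1#
    ρ₂ = proj₂ (cis (- d)) - - d

    0<r : 0# < r
    0<r = 0<x+x⇒0<x (abs-pos⁻¹ imag)

    κ<s² : ∣ κ ∣< (s * s)
    κ<s² = S¹-near-1 unit real imag

    s<½ : s < ½
    s<½ = 0<-⇒< (<-respʳ-≈
      (trans (solve 3 (λ o h r → h :* (o :- con (+ 64) :* r) :+ con (+ 30) :* (h :* con (+ 2) :* r)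
          := h :* o :- con (+ 2) :* (h :* con (+ 2) :* r)) refl 1# ½ r)
        (+-cong (*-identityʳ ½) (-‿cong (trans (*-congˡ h2r≈r)
          (solve 1 (λ r → con (+ 2) :* r := r :+ r) refl r)))))
      (+-pos (*-pos 0<½ 0<t) (*-pos (0<suc 29) (<-respʳ-≈ (sym h2r≈r) 0<r))))
      where
      h2r≈r : ½ * (2 · 1#) * r ≈ r
      h2r≈r = trans (*-congʳ (1/-inverse 2)) (*-identityˡ r)

    ρ< : ∥ ρ₁ , ρ₂ ∥< ((s * s + s * s) + s * s)
    ρ< = cis-near (abs-neg imag) s<½

    1≈ : 1 · 1# ≈ 1#
    1≈ = +-identityʳ 1#

    -1<1 : - 1# < 1#
    -1<1 = <-trans (0<-⇒< (<-respʳ-≈ (solve 1 (λ o → o := con (+ 0) :- :- o) refl 1#) 0<1)) 0<1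

    c<2 : ∣ c ∣< (2 · 1#)
    c<2 =
      <-respˡ-≈ (solve 2 (λ o c → :- (o :- c) :+ o := c) refl 1# c)
        (<-respʳ-≈ (+-congˡ (sym 1≈)) (+-monoˡ-< 1# (proj₂ real))) ,
      <-respˡ-≈ (solve 2 (λ o c → (o :- c) :+ :- o := :- c) refl 1# c)
        (<-respʳ-≈ (+-congˡ (sym 1≈)) (+-mono-< (proj₁ real) -1<1))

    real< = abs-+ (abs-+ κ<s² (abs-neg (abs-* c<2 (proj₁ ρ<)))) (abs-+ (abs-neg (abs-* imag imag)) (abs-* imag (proj₂ ρ<)))
    imag< = abs-+ (abs-* κ<s² imag) (abs-+ (abs-* c<2 (proj₂ ρ<)) (abs-* imag (proj₁ ρ<)))

    real≈ : (κ + - (c * ρ₁)) + (- (d * d) + d * ρ₂) ≈ 1# - proj₁ (z ⊗ cis (- d))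
    real≈ = trans (solve 5 (λ o c d p q → ((o :- c) :+ :- (c :* (p :- o))) :+ (:- (d :* d) :+ d :* (q :- :- d))
        := (o :- (c :* p :+ :- (d :* q))) :+ (c :* o :- c)) refl 1# c d (proj₁ (cis (- d))) (proj₂ (cis (- d))))
      (trans (+-congˡ (trans (+-congʳ (*-identityʳ c)) (-‿inverseʳ c))) (+-identityʳ _))

    -- The linear terms in `d` cancel up to `κ d`, which is cubic because `κ` is quadratic.
    imag≈ : κ * d + (c * ρ₂ + d * ρ₁) ≈ proj₂ (z ⊗ cis (- d))
    imag≈ = solve 5 (λ o c d p q → (o :- c) :* d :+ (c :* (q :- :- d) :+ d :* (p :- o))
        := c :* q :+ d :* p) refl 1# c d (proj₁ (cis (- d))) (proj₂ (cis (- d)))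

    bound-c : Carrier
    bound-c = (2 · 1#) * ((s * s + s * s) + s * s)

    0<t′ : 0# < 1 · 1# - (64 · 1#) * r
    0<t′ = <-respʳ-≈ (+-congʳ (sym 1≈)) 0<t

    real-small : (s * s + bound-c) + (s * s + s * ((s * s + s * s) + s * s)) < 1#
    -- The left side is `32 r² + 24 r³`. Its distance from 1 is written with positive coefficients
    -- in `r` and `t = 1 - 64 r`.
    real-small = <-respʳ-≈ 1≈ (0<-⇒< (<-respʳ-≈
      (solve 1 (λ r → let s = r :+ r; s² = s :* s; t = con (+ 1) :- con (+ 64) :* r in
          t :+ r :* ((con (+ 63) :+ t) :+ r :* ((con (+ 31) :+ t) :+ con (+ 40) :* r))
          := con (+ 1) :- ((s² :+ con (+ 2) :* ((s² :+ s²) :+ s²)) :+ (s² :+ s :* ((s² :+ s²) :+ s²)))) refl r)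
      (+-pos 0<t′ (*-pos 0<r (+-pos (+-pos (0<suc 62) 0<t′)
        (*-pos 0<r (+-pos (+-pos (0<suc 30) 0<t′) (*-pos (0<suc 39) 0<r))))))))

    imag-small : s * s * s + (bound-c + s * ((s * s + s * s) + s * s)) < r
    -- Here the left side is `24 r² + 32 r³`; the constant 64 leaves ample room below `r`.
    imag-small = 0<-⇒< (<-respʳ-≈
      (solve 1 (λ r → let s = r :+ r; s² = s :* s; t = con (+ 1) :- con (+ 64) :* r in
          r :* (t :+ r :* ((con (+ 39) :+ t) :+ con (+ 32) :* r))
          := r :- (s² :* s :+ (con (+ 2) :* ((s² :+ s²) :+ s²) :+ s :* ((s² :+ s²) :+ s²)))) refl r)
      (*-pos 0<r (+-pos 0<t′ (*-pos 0<r (+-pos (+-pos (0<suc 38) 0<t′) (*-pos (0<suc 31) 0<r))))))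

  partialSum-bound : ∀ {t a} → 0# < a → (∀ j → ∣ t j ∣< (a * ½ ^ j)) → ∀ m → ∣ partialSum t m ∣< (a + a)
  partialSum-bound {t} {a} 0<a t< m = abs-resp (sym (partialSum≈ m)) refl (proj₁
    (sum-geometric {λ j → t j , 0#} 0<a (λ j → t< j , abs-pos (*-pos 0<a (½^-pos j))) m))
    where
    partialSum≈ : ∀ m → partialSum t m ≈ proj₁ (sum (λ j → t j , 0#) m)
    partialSum≈ zero    = refl
    partialSum≈ (suc m) = trans (+-congʳ (partialSum≈ m)) (sym (proj₁ (sum-snoc (λ j → t j , 0#) m)))

  -- Halving the imaginary part at every step suffices: the increments are then geometric, and the
  -- smallness condition persists.
  module Newton {z : Point} {r : Carrier} (64r<1 : (64 · 1#) * r < 1#) (z-near : Near r z) where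

    approx : ℕ → Carrier
    residual : ℕ → Point
    approx zero    = 0#
    approx (suc k) = approx k + proj₂ (residual k)
    residual k = z ⊗ cis (- approx k)

    0<r : 0# < r
    0<r = abs-pos⁻¹ (Near.imag z-near)

    0<step : ∀ k → 0# < 1# - (64 · 1#) * (r * ½ ^ suc k)
    0<step k = <⇒0<- (<-respˡ-≈ (*-assoc _ r (½ ^ suc k)) (<-trans
      (*-monoˡ-< (*-pos (0<suc 63) 0<r) (½^-<1 k))
      (<-respˡ-≈ (sym (*-identityʳ _)) 64r<1)))

    halves : ∀ k → r * ½ ^ k ≈ r * ½ ^ suc k + r * ½ ^ suc k
    halves k = trans (*-congˡ (sym (½*ε+½*ε (½ ^ k)))) (distribˡ r _ _)

    residual-near : ∀ k → Near (r * ½ ^ k) (residual k)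
    residual-near zero    = Near-resp (sym (*-identityʳ r))
      (G.sym (G.trans (G.*-congˡ {z} (G.trans (cis-cong -0≈0) cis-0)) (G.*-identityʳ z))) z-near
    residual-near (suc k) = Near-resp refl
      (G.trans (G.*-assoc z (cis (- approx k)) (cis (- proj₂ (residual k))))
        (G.*-congˡ {z} (G.trans (G.sym (cis-+ (- approx k) (- proj₂ (residual k))))
          (cis-cong (solve 2 (λ a d → :- a :+ :- d := :- (a :+ d)) refl (approx k) (proj₂ (residual k)))))))
      (newton-step (0<step k) (Near-resp (halves k) G.refl (residual-near k)))

    increments : ∀ j → ∣ proj₂ (residual j) ∣< (r * ½ ^ j)
    increments j = Near.imag (residual-near j)

    approx-partialSum : ∀ k → partialSum (λ j → proj₂ (residual j)) k ≈ approx k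
    approx-partialSum zero    = refl
    approx-partialSum (suc k) = +-congʳ (approx-partialSum k)

    limit : ∃ λ α → partialSum (λ j → proj₂ (residual j)) ⟶ α
    limit = complete _ (geometric⇒Cauchy (λ j → proj₂ (residual j)) r 0 0<r (λ j _ → increments j))

    angle : Carrier
    angle = proj₁ limit

    approx⟶angle : approx ⟶ angle
    approx⟶angle ε 0<ε = let N , near = proj₂ limit ε 0<ε in
      N , λ n N≤n → abs-resp (+-congʳ (approx-partialSum n)) refl (near n N≤n)

    -- The increments sum to less than `2 r`, and the third `r` is slack for the limit. This bound
    -- later makes the angles of small rotations small.
    angle-bound : ∣ angle ∣< ((r + r) + r)
    angle-bound = abs-resp (trans (+-congˡ -0≈0) (+-identityʳ angle)) refl (proj₁
      (limit-bound {λ k → approx k , 0#} {angle , 0#} {G.0#} 0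
        (pair-limit {approx} {λ _ → 0#} approx⟶angle (λ ε 0<ε → proj₁ (constant⇝ G.0# ε 0<ε) ,
          λ n N≤n → proj₁ (proj₂ (constant⇝ G.0# ε 0<ε) n N≤n)))
        (λ k _ → ∥∥-resp (G.sym (trans (+-congˡ -0≈0) (+-identityʳ _) , -‿inverseʳ 0#)) refl
          ( abs-resp (approx-partialSum k) refl (partialSum-bound 0<r increments k)
          , abs-pos (+-pos 0<r 0<r) ))
        (x<x+y 0<r)))

    residual⇝1 : residual ⇝ G.1#
    residual⇝1 ε 0<ε = let N , _ , small = ½^-vanishes 0 (r * 2#) 0<ε in
      N , λ k N≤k →
        let isNear unit real imag = residual-near k
            rₖ<ε : r * ½ ^ k < ε
            rₖ<ε = <-trans (*-monoˡ-< 0<r (½^-antitone (ℕₚ.≤⇒≤′ N≤k))) (<-respˡ-≈ (*-assoc r 2# _) small)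
        in abs-resp (solve 2 (λ o c → :- (o :- c) := c :- o) refl 1# (proj₁ (residual k))) refl
             (abs-neg (abs-<-trans (S¹-near-1 {residual k} unit real imag) (<-trans (square< k) rₖ<ε))) ,
           abs-resp (sym (trans (+-congˡ -0≈0) (+-identityʳ _))) refl (abs-<-trans imag rₖ<ε)
      where
      rₖ<1 : ∀ k → r * ½ ^ k < 1#
      rₖ<1 k = <-respˡ-≈ (sym (halves k)) (0<-⇒< (<-respʳ-≈
        (solve 2 (λ o x → (o :- con (+ 64) :* x) :+ con (+ 62) :* x := o :- (x :+ x)) refl 1# (r * ½ ^ suc k))
        (+-pos (0<step k) (*-pos (0<suc 61) (*-pos 0<r (½^-pos (suc k)))))))

      square< : ∀ k → (r * ½ ^ k) * (r * ½ ^ k) < r * ½ ^ k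
      square< k = <-respʳ-≈ (*-identityʳ _) (*-monoˡ-< (*-pos 0<r (½^-pos k)) (rₖ<1 k))

    -- `cis (approx k) ⊗ residual k` is constantly `z`, while its factors tend to `cis angle` and 1.
    cis-angle : cis angle ≋ z
    cis-angle = G.sym (⇝-unique {λ _ → z} {z} {cis angle} (constant⇝ z)
      (⇝-resp {λ k → cis (approx k) ⊗ residual k} {λ _ → z} {cis angle} cancels
        (λ ε 0<ε → let N , near = ⇝-⊗ {λ k → cis (approx k)} {residual} {cis angle} {G.1#}
                                    (cis-continuous approx⟶angle) residual⇝1 ε 0<ε
          in N , λ n N≤n → ∥∥-resp (G.+-congˡ {cis (approx n) ⊗ residual n} (G.-‿cong (G.*-identityʳ (cis angle))))
                             refl (near n N≤n))))
      where
      cancels : ∀ k → cis (approx k) ⊗ residual k ≋ z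
      cancels k = G.trans (E-Solver.solve 3 (λ a z b → a E-Solver.:* (z E-Solver.:* b) E-Solver.:= z E-Solver.:* (a E-Solver.:* b))
          G.refl (cis (approx k)) z (cis (- approx k)))
        (G.trans (G.*-congˡ {z} (G.trans (G.sym (cis-+ (approx k) (- approx k)))
          (G.trans (cis-cong (-‿inverseʳ (approx k))) cis-0))) (G.*-identityʳ z))

  Angled : Point → Set _
  Angled z = ∃ λ α → cis α ≋ z

  Angled-⊗ : ∀ {z w} → Angled z → Angled w → Angled (z ⊗ w)
  Angled-⊗ (α , p) (β , q) = α + β , G.trans (cis-+ α β) (G.*-cong p q)

  Angled-resp : ∀ {z w} → z ≋ w → Angled z → Angled w
  Angled-resp z≋w (α , p) = α , G.trans p z≋w

  cancel-unit : ∀ D D′ {z w} → D ⊗ D′ ≋ G.1# → z ⊗ D ≋ w ⊗ D → z ≋ w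
  cancel-unit D D′ {z} {w} DD′≋1 p = G.trans (expand z) (G.trans (G.*-congʳ {D′} p) (G.sym (expand w)))
    where
    expand : ∀ z → z ≋ (z ⊗ D) ⊗ D′
    expand z = G.trans (G.sym (G.*-identityʳ z)) (G.trans (G.*-congˡ {z} (G.sym DD′≋1)) (G.sym (G.*-assoc z D D′)))

  cayley-unique : ∀ {t z} → z ⊗ (1# , - t) ≋ (1# , t) → z ≋ cayley t
  cayley-unique {t} {z} p = cancel-unit (1# , - t) (v , t * v)
    ( trans (solve 3 (λ o t v → o :* v :+ :- (:- t :* (t :* v)) := v :* (o :+ t :* t)) refl 1# t v) v-inverse
    , trans (solve 3 (λ o t v → o :* (t :* v) :+ :- t :* v := o :* (t :* v) :- t :* v) refl 1# t v)
        (trans (+-congʳ (*-identityˡ _)) (-‿inverseʳ _)) )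
    (G.trans p (G.sym (cayley-⊗ t)))
    where
    v : Carrier
    v = proj₁ (inverse (1# + t * t) (0<1+t² t))

    v-inverse : v * (1# + t * t) ≈ 1#
    v-inverse = proj₂ (inverse (1# + t * t) (0<1+t² t))

  -- `1 + i t` and `1 - i t` have the same norm, and norms are multiplicative.
  cayley∈S¹ : ∀ t → cayley t ∈ S¹
  cayley∈S¹ t = trans (sym (*-identityʳ N)) (trans (*-congˡ (sym v-inverse))
    (trans (solve 3 (λ n v m → n :* (v :* m) := v :* (n :* m)) refl N v (1# + t * t))
      (trans (*-congˡ (trans (*-congˡ (+-cong (sym (*-identityˡ 1#)) (solve 1 (λ t → t :* t := :- t :* :- t) refl t)))
        (trans (sym (normSq-⊗ (cayley t) (1# , - t))) (trans
          (+-cong (*-cong (proj₁ (cayley-⊗ t)) (proj₁ (cayley-⊗ t))) (*-cong (proj₂ (cayley-⊗ t)) (proj₂ (cayley-⊗ t))))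
          (+-congʳ (*-identityˡ 1#)))))) v-inverse)))
    where
    N v : Carrier
    N = E.normSq (cayley t)
    v = proj₁ (inverse (1# + t * t) (0<1+t² t))

    v-inverse : v * (1# + t * t) ≈ 1#
    v-inverse = proj₂ (inverse (1# + t * t) (0<1+t² t))

  nonneg-*ˡ : ∀ {a q} → 0# < a → ¬ q < 0# → ¬ a * q < 0#
  nonneg-*ˡ {a} {q} 0<a q≮0 aq<0 with inverse a 0<a
  ... | b , ba≈1 = q≮0 (<-respˡ-≈ (trans (sym (*-assoc b a q)) (trans (*-congʳ ba≈1) (*-identityˡ q)))
    (<-respʳ-≈ (zeroʳ b) (*-monoˡ-< (inverse-pos 0<a ba≈1) aq<0)))

  nonneg-+ : ∀ {p} → ¬ p < 0# → ¬ p + p < 0#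
  nonneg-+ {p} p≮0 2p<0 = p≮0 (0<-⇒< (<-respʳ-≈ (sym (+-identityˡ (- p)))
    (0<x+x⇒0<x (<-respʳ-≈ (solve 1 (λ p → :- (p :+ p) := :- p :+ :- p) refl p) (neg-pos 2p<0)))))

  shrink-< : ∀ {x a q v} → v * (1# + q) ≈ 1# → 0# < 1# + q → ¬ q < 0# → 0# < a → x < a → x * v < a
  shrink-< {x} {a} {q} {v} inv 0<1+q q≮0 0<a x<a = 0<-⇒< (<-respʳ-≈
    (trans (solve 5 (λ o x a q v → v :* ((a :* o :- x) :+ a :* q) := a :* (v :* (o :+ q)) :- x :* v) refl 1# x a q v)
      (+-congʳ (trans (*-congˡ inv) (*-identityʳ a))))
    (*-pos (inverse-pos 0<1+q inv) (+-pos-nonneg (<⇒0<- (<-respʳ-≈ (sym (*-identityʳ a)) x<a)) (nonneg-*ˡ 0<a q≮0))))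

  abs-shrink : ∀ {x a q v} → v * (1# + q) ≈ 1# → 0# < 1# + q → ¬ q < 0# → ∣ x ∣< a → ∣ x * v ∣< a
  abs-shrink {x} {v = v} inv 0<1+q q≮0 x<a =
    shrink-< inv 0<1+q q≮0 (abs-pos⁻¹ x<a) (proj₁ x<a) ,
    <-respˡ-≈ (solve 2 (λ x v → :- x :* v := :- (x :* v)) refl x v)
      (shrink-< inv 0<1+q q≮0 (abs-pos⁻¹ x<a) (proj₂ x<a))

  cayley-near : ∀ {t τ} → ∣ t ∣< τ → (128 · 1#) * τ < 1# → Near (τ + τ) (cayley t)
  cayley-near {t} {τ} t<τ 128τ<1 = isNear (cayley∈S¹ t)
    (abs-<-trans (abs-resp real≈ refl (shrinkᵗ (abs-* (abs-+ t<τ t<τ) t<τ))) 2τ²<1)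
    (shrinkᵗ (abs-+ t<τ t<τ))
    where
    v : Carrier
    v = proj₁ (inverse (1# + t * t) (0<1+t² t))

    v-inverse : v * (1# + t * t) ≈ 1#
    v-inverse = proj₂ (inverse (1# + t * t) (0<1+t² t))

    shrinkᵗ : ∀ {x a} → ∣ x ∣< a → ∣ x * v ∣< a
    shrinkᵗ = abs-shrink v-inverse (0<1+t² t) (square-nonneg t)

    real≈ : ((t + t) * t) * v ≈ 1# - (1# - t * t) * v
    real≈ = trans (solve 3 (λ o t v → ((t :+ t) :* t) :* v := v :* (o :+ t :* t) :- (o :- t :* t) :* v) refl 1# t v)
      (+-congʳ v-inverse)

    0<τ : 0# < τ
    0<τ = abs-pos⁻¹ t<τ

    u : Carrier
    u = 1# - (128 · 1#) * τ

    2τ²<1 : (τ + τ) * τ < 1#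
    2τ²<1 = 0<-⇒< (<-respʳ-≈
      -- The variable `o` is `1#` and `con (+ 1)` is `1# + 0#`; the last term, a multiple of their
      -- difference, is removed next.
      (trans (solve 2 (λ o τ → (o :- con (+ 128) :* τ) :+ τ :* (con (+ 126) :+ ((con (+ 2) :* (o :- con (+ 128) :* τ)) :+ con (+ 254) :* τ))
          := o :- (τ :+ τ) :* τ :- con (+ 2) :* τ :* (con (+ 1) :- o)) refl 1# τ)
        (trans (+-congˡ (trans (-‿cong (trans (*-congˡ (trans (+-congʳ (+-identityʳ 1#)) (-‿inverseʳ 1#))) (zeroʳ _))) -0≈0))
          (+-identityʳ _)))
      (+-pos (<⇒0<- 128τ<1) (*-pos 0<τ (+-pos (0<suc 125)
        (+-pos (*-pos (0<suc 1) (<⇒0<- 128τ<1)) (*-pos (0<suc 253) 0<τ))))))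

  cayley-angle : ∀ {t τ} → ∣ t ∣< τ → (128 · 1#) * τ < 1# →
    ∃ λ α → ∣ α ∣< (((τ + τ) + (τ + τ)) + (τ + τ)) × cis α ≋ cayley t
  cayley-angle {t} {τ} t<τ 128τ<1 = N.angle , N.angle-bound , N.cis-angle
    where
    module N = Newton {cayley t} {τ + τ}
      (<-respˡ-≈ (solve 1 (λ τ → con (+ 128) :* τ := con (+ 64) :* (τ :+ τ)) refl τ) 128τ<1)
      (cayley-near t<τ 128τ<1)

  -- The half t / 2 and its complement t′ in the addition theorem of the tangent, both at
  -- most half as large as t.
  cayley-split : ∀ {t τ} → ∣ t ∣< τ → ∃ λ s → ∃ λ s′ → ∣ s ∣< (½ * τ) × ∣ s′ ∣< (½ * τ) ×
    cayley s ⊗ cayley s′ ≋ cayley t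
  cayley-split {t} {τ} t<τ = s , s′ , s<½τ , abs-shrink v-inverse 0<D 2s²≮0 s<½τ , cayley-unique
    (cancel-unit (m , 0#) (m⁻¹ , 0#)
      ( trans (solve 2 (λ m n → m :* n :+ :- (con (+ 0) :* con (+ 0)) := n :* m) refl m m⁻¹) m⁻¹m≈1
      , solve 2 (λ m n → m :* con (+ 0) :+ con (+ 0) :* n := con (+ 0)) refl m m⁻¹ )
      (G.trans (G.trans (G.*-assoc (cayley s ⊗ cayley s′) (1# , - t) (m , 0#))
        (G.*-congˡ {cayley s ⊗ cayley s′} (G.sym lower)))
      (G.trans (E-Solver.solve 4 (λ a b c d → (a E-Solver.:* b) E-Solver.:* (c E-Solver.:* d)
          E-Solver.:= (a E-Solver.:* c) E-Solver.:* (b E-Solver.:* d)) G.refl (cayley s) (cayley s′) (1# , - s) (1# , - s′))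
      (G.trans (G.*-cong (cayley-⊗ s) (cayley-⊗ s′)) upper))))
    where
    s : Carrier
    s = ½ * t

    s<½τ : ∣ s ∣< (½ * τ)
    s<½τ = abs-resp (*-comm t ½) (*-comm τ ½) (abs-scale 0<½ t<τ)

    2s²≮0 : ¬ s * s + s * s < 0#
    2s²≮0 = nonneg-+ (square-nonneg s)

    0<D : 0# < 1# + (s * s + s * s)
    0<D = +-pos-nonneg 0<1 2s²≮0

    -- Solving `(s + s′) / (1 - s s′) = 2 s` gives `s′ = s / (1 + 2 s²)`; `m` is the denominator
    -- `1 - s s′`.
    v s′ m : Carrier
    v  = proj₁ (inverse _ 0<D)
    s′ = s * v
    m  = 1# - s * s′

    v-inverse : v * (1# + (s * s + s * s)) ≈ 1#
    v-inverse = proj₂ (inverse _ 0<D)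

    0<m : 0# < m
    0<m = <-respʳ-≈ (trans (solve 3 (λ o s v → v :* (o :+ s :* s) := v :* (o :+ (s :* s :+ s :* s)) :- s :* (s :* v)) refl 1# s v)
        (+-congʳ v-inverse))
      (*-pos (inverse-pos 0<D v-inverse) (0<1+t² s))

    m⁻¹ : Carrier
    m⁻¹ = proj₁ (inverse m 0<m)

    m⁻¹m≈1 : m⁻¹ * m ≈ 1#
    m⁻¹m≈1 = proj₂ (inverse m 0<m)

    s+s′≈tm : s + s′ ≈ t * m
    s+s′≈tm = sym (trans (*-congʳ (sym (½*ε+½*ε t)))
      (trans (solve 3 (λ o s v → (s :+ s) :* (o :- s :* (s :* v))
          := s :* o :+ s :* (o :- (v :* (o :+ (s :* s :+ s :* s)))) :+ s :* v :* o) refl 1# s v)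
        (+-cong (trans (+-cong (*-identityʳ s) (trans (*-congˡ (trans (+-congˡ (-‿cong v-inverse)) (-‿inverseʳ 1#))) (zeroʳ s)))
            (+-identityʳ s)) (*-identityʳ _))))

    lower : (1# , - s) ⊗ (1# , - s′) ≋ (1# , - t) ⊗ (m , 0#)
    lower =
      trans (+-congʳ (*-identityˡ 1#)) (trans (solve 3 (λ o s s′ → o :+ :- (:- s :* :- s′) := o :- s :* s′) refl 1# s s′)
        (trans (sym (*-identityˡ m)) (solve 3 (λ o m t → o :* m := o :* m :+ :- (:- t :* con (+ 0))) refl 1# m t))) ,
      trans (+-cong (*-identityˡ _) (*-identityʳ _)) (trans (solve 2 (λ s s′ → :- s′ :+ :- s := :- (s :+ s′)) refl s s′)
        (trans (-‿cong s+s′≈tm) (solve 3 (λ o m t → :- (t :* m) := o :* con (+ 0) :+ :- t :* m) refl 1# m t)))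

    upper : (1# , s) ⊗ (1# , s′) ≋ (1# , t) ⊗ (m , 0#)
    upper =
      trans (+-congʳ (*-identityˡ 1#))
        (trans (sym (*-identityˡ m)) (solve 3 (λ o m t → o :* m := o :* m :+ :- (t :* con (+ 0))) refl 1# m t)) ,
      trans (+-cong (*-identityˡ _) (*-identityʳ _)) (trans (+-comm s′ s)
        (trans s+s′≈tm (solve 3 (λ o m t → t :* m := o :* con (+ 0) :+ t :* m) refl 1# m t)))

  -- Each splitting halves `τ`; after `k` of them the iteration near 1 applies, and the angles of
  -- the factors add up.
  cayley-angled : ∀ k {t τ} → ∣ t ∣< τ → ((128 · 1#) * τ) * ½ ^ k < 1# → Angled (cayley t)
  cayley-angled zero    t<τ small =
    let α , _ , α≋ = cayley-angle t<τ (<-respˡ-≈ (*-identityʳ _) small) in α , α≋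
  cayley-angled (suc k) {t} {τ} t<τ small =
    let s , s′ , s< , s′< , split = cayley-split t<τ
        small′ = <-respˡ-≈ (solve 3 (λ τ h p → (con (+ 128) :* τ) :* (h :* p) := (con (+ 128) :* (h :* τ)) :* p)
                   refl τ ½ (½ ^ k)) small
    in Angled-resp split (Angled-⊗ (cayley-angled k s< small′) (cayley-angled k s′< small′))

  angled-cayley : ∀ t → Angled (cayley t)
  angled-cayley t =
    let n , _ , t<n   = abs-bound 0 t
        k , _ , small = ½^-vanishes 0 ((128 · 1#) * (n · 1#)) 0<1
    in cayley-angled k t<n small

  -- Stereographic projection from `-1`: `z` is the Cayley transform of `y / (1 + x)`, the tangent
  -- of the half angle.
  angled-right : ∀ {z} → z ∈ S¹ → 0# < 1# + proj₁ z → Angled z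
  angled-right {z@(x , y)} z∈ 0<1+x = Angled-resp {cayley (y * v)} (G.sym {z} (cayley-unique {y * v} {z}
    ( trans (solve 4 (λ o x y v → x :* o :+ :- (y :* :- (y :* v)) := x :* o :+ ((x :* x :+ y :* y) :- x :* x) :* v) refl 1# x y v)
        (trans (+-cong (*-identityʳ x) (trans (*-congʳ (+-congʳ z∈))
            (trans (*-congʳ (+-congʳ (sym (*-identityˡ 1#))))
              (solve 3 (λ o x v → (o :* o :- x :* x) :* v := (o :- x) :* (v :* (o :+ x))) refl 1# x v))))
          (trans (+-congˡ (trans (*-congˡ v-inverse) (*-identityʳ _))) (solve 2 (λ o x → x :+ (o :- x) := o) refl 1# x)))
    , trans (+-congʳ (solve 3 (λ x y v → x :* :- (y :* v) := :- (y :* (v :* x))) refl x y v))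
        (trans (solve 4 (λ o x y v → :- (y :* (v :* x)) :+ y :* o
            := (y :* v) :* o :+ y :* (o :- v :* (o :+ x))) refl 1# x y v)
          (trans (+-cong (*-identityʳ _) (trans (*-congˡ (trans (+-congˡ (-‿cong v-inverse)) (-‿inverseʳ 1#))) (zeroʳ y)))
            (+-identityʳ _))) ))) (angled-cayley (y * v))
    where
    v : Carrier
    v = proj₁ (inverse (1# + x) 0<1+x)

    v-inverse : v * (1# + x) ≈ 1#
    v-inverse = proj₂ (inverse (1# + x) 0<1+x)

  -- Comparing `x` with `-1 < 0` leaves either a point away from `-1`, or one whose antipode is; the
  -- antipode is undone by `i² = -1`.
  angled : ∀ z → z ∈ S¹ → Angled z
  angled z@(x , y) z∈ = [ (λ -1<x → angled-right z∈ (<-respʳ-≈ (solve 2 (λ o x → x :- :- o := o :+ x) refl 1# x) (<⇒0<- -1<x)))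
    , (λ x<0 → Angled-resp i²-z (Angled-⊗ (Angled-⊗ angled-i angled-i) (angled-right
        (trans (solve 2 (λ x y → :- x :* :- x :+ :- y :* :- y := x :* x :+ y :* y) refl x y) z∈)
        (+-pos 0<1 (neg-pos x<0))))) ]′
    (<-cotrans (0<-⇒< (<-respʳ-≈ (solve 1 (λ o → o := con (+ 0) :- :- o) refl 1#) 0<1)) x)
    where
    angled-i : Angled ι
    angled-i = angled-right (trans (solve 1 (λ o → con (+ 0) :* con (+ 0) :+ o :* o := o :* o) refl 1#) (*-identityˡ 1#))
      (<-respʳ-≈ (sym (+-identityʳ 1#)) 0<1)

    i²-z : (ι ⊗ ι) ⊗ ⊝ z ≋ z
    i²-z =
      trans (solve 3 (λ o x y → (con (+ 0) :* con (+ 0) :+ :- (o :* o)) :* :- x :+ :- ((con (+ 0) :* o :+ o :* con (+ 0)) :* :- y)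
          := o :* o :* x) refl 1# x y) (trans (*-congʳ (*-identityˡ 1#)) (*-identityˡ x)) ,
      trans (solve 3 (λ o x y → (con (+ 0) :* con (+ 0) :+ :- (o :* o)) :* :- y :+ (con (+ 0) :* o :+ o :* con (+ 0)) :* :- x
          := o :* o :* y) refl 1# x y) (trans (*-congʳ (*-identityˡ 1#)) (*-identityˡ y))

-- Density of the powers of small rotations

module Density {c ℓ₁ ℓ₂ ℓ₃} (R : RealNumbers c ℓ₁ ℓ₂ ℓ₃) where

  open Plane R
  open Order R
  open Subfields R using (module E; module E-Solver)
  open E using (_⊕_; _⊗_; _⊗^_; ⊝; module G)
  open IntegerSolver commutativeRing morphism
  open Exponential R
  open Rotations R using (cayley; rotation; 0<1+t²)
  open Surjectivity R
  open Algebra.Properties.Semiring.Exp G.semiring using () renaming (^-congˡ to ⊗^-congˡ)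
  open Algebra.Properties.Monoid.Mult +-monoid using (×-assocˡ; ×-homo-+; ×-congˡ)

  ·≈* : ∀ k x → k · x ≈ (k · 1#) * x
  ·≈* zero    x = sym (zeroˡ x)
  ·≈* (suc k) x = trans (+-cong (sym (*-identityˡ x)) (·≈* k x)) (sym (distribʳ x 1# (k · 1#)))

  cis-· : ∀ k x → cis (k · x) ≋ cis x ⊗^ k
  cis-· zero    x = cis-0
  cis-· (suc k) x = G.trans (cis-+ x (k · x)) (G.*-congˡ {cis x} (cis-· k x))

  cis-/ : ∀ x n .{{_ : NonZero n}} → cis (x / n) ⊗^ n ≋ cis x
  cis-/ x n = G.trans (G.sym (cis-· n (x / n))) (cis-cong (trans (·≈* n (x / n))
    (trans (solve 3 (λ n x v → n :* (x :* v) := x :* (v :* n)) refl (n · 1#) x (1/ n))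
      (trans (*-congˡ (1/-inverse n)) (*-identityʳ x)))))

  rotation^∈S¹ : ∀ j k → rotation j ⊗^ k ∈ S¹
  rotation^∈S¹ j zero    = trans (+-cong (*-identityˡ 1#) (zeroˡ 0#)) (+-identityʳ 1#)
  rotation^∈S¹ j (suc k) = S¹-⊗ {rotation j} {rotation j ⊗^ k} (cayley∈S¹ _) (rotation^∈S¹ j k)

  -- `cos 2x = 1 - 2 sin² x`, whatever the sign of `cos x`. Applied to `π`, this supplies the
  -- period.
  cis-double-zero : ∀ {x} → sin x ≈ 0# → cis (x + x) ≋ G.1#
  cis-double-zero {x} sin≈0 = G.trans (cis-+ x x)
    ( trans (solve 2 (λ c s → c :* c :+ :- (s :* s) := (c :* c :+ s :* s) :- (con (+ 2) :* s) :* s) refl _ _)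
        (trans (+-cong (cis∈S¹ x) (trans (-‿cong (trans (*-congˡ s≈0) (zeroʳ _))) -0≈0)) (+-identityʳ 1#))
    , trans (solve 2 (λ c s → c :* s :+ s :* c := (con (+ 2) :* c) :* s) refl _ _) (trans (*-congˡ s≈0) (zeroʳ _)) )
    where
    s≈0 : proj₂ (cis x) ≈ 0#
    s≈0 = trans (sym (proj₂ (∠≋cis x))) sin≈0

  -- Periods are added until the angle exceeds `b`, so that the progression of multiples can climb
  -- to it from below.
  large-angle : ∀ {p} → 0# < p → cis p ≋ G.1# → ∀ {z} → z ∈ S¹ → ∀ b → ∃ λ β → b < β × cis β ≋ z
  large-angle {p} 0<p cis-p {z} z∈ b =
    let β , β≋     = angled z z∈
        q , qp≈1   = inverse p 0<p
        k , b-β<k  = archimedean ((b - β) * q)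
    in β + k · p ,
       0<-⇒< (<-respʳ-≈ (trans (+-cong (sym (·≈* k p)) (-‿cong (trans (solve 4 (λ p b β q → p :* ((b :- β) :* q) := (b :- β) :* (q :* p))
             refl p b β q) (trans (*-congˡ qp≈1) (*-identityʳ _)))))
           (solve 3 (λ K b β → K :- (b :- β) := (β :+ K) :- b) refl (k · p) b β))
         (<⇒0<- (<-respʳ-≈ (*-comm p _) (*-monoˡ-< 0<p b-β<k)))) ,
       G.trans (cis-+ β (k · p)) (G.trans (G.*-cong β≋ (periods k)) (G.*-identityʳ z))
    where
    periods : ∀ k → cis (k · p) ≋ G.1#
    periods zero    = cis-0
    periods (suc k) = G.trans (cis-+ p (k · p)) (G.trans (G.*-cong cis-p (periods k)) (G.*-identityˡ G.1#))

  -- Repeated subtraction of `σ`. The test compares `τ` with both `σ` and `2 σ`, whence the error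
  -- `2 σ`.
  nearest-multiple : ∀ {σ τ} → 0# < σ → 0# < τ → ∃ λ b → ∣ τ - b · σ ∣< (σ + σ)
  nearest-multiple {σ} {τ} 0<σ 0<τ =
    let i , iσ≈1   = inverse σ 0<σ
        N , τi<N   = archimedean (τ * i)
    in go N τ 0<τ (<-respʳ-≈ (trans (*-comm σ _) (sym (·≈* N σ)))
         (<-respˡ-≈ (trans (solve 3 (λ σ τ i → σ :* (τ :* i) := τ :* (i :* σ)) refl σ τ i)
           (trans (*-congˡ iσ≈1) (*-identityʳ τ))) (*-monoˡ-< 0<σ τi<N)))
    where
    go : ∀ N τ → 0# < τ → τ < N · σ → ∃ λ b → ∣ τ - b · σ ∣< (σ + σ)
    go zero    τ 0<τ τ<0  = ⊥-elim (<-asym 0<τ τ<0)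
    go (suc N) τ 0<τ τ<Nσ = [ (λ σ<τ →
        let b , close = go N (τ - σ) (<⇒0<- σ<τ) (0<-⇒< (<-respʳ-≈
              (solve 3 (λ σ τ x → (σ :+ x) :- τ := x :- (τ :- σ)) refl σ τ (N · σ)) (<⇒0<- τ<Nσ)))
        in suc b , abs-resp (solve 3 (λ σ τ x → (τ :- σ) :- x := τ :- (σ :+ x)) refl σ τ (b · σ)) refl close)
      , (λ τ<2σ → 0 , abs-resp (sym (trans (+-congˡ -0≈0) (+-identityʳ τ))) refl
          (τ<2σ , <-trans (0<-⇒< (<-respʳ-≈ (solve 1 (λ τ → τ := con (+ 0) :- :- τ) refl τ) 0<τ)) (+-pos 0<σ 0<σ))) ]′
      (<-cotrans (x<x+y 0<σ) τ)

  -- `cis-near` with radius `2 h` keeps the sine within `12 h²` of `h`, and `12 h² < h`.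
  sin-pos : ∀ {h} → 0# < h → (16 · 1#) * h < 1# → 0# < proj₂ (cis h)
  sin-pos {h} 0<h 16h<1 = 0<-⇒< (<-respʳ-≈
      (solve 2 (λ h s → h :- (h :- s) := s :- con (+ 0)) refl h (proj₂ (cis h)))
    (<⇒0<- (<-trans (<-respˡ-≈ (solve 2 (λ s h → :- (s :- h) := h :- s) refl (proj₂ (cis h)) h) (proj₂ (proj₂ close))) cubic<h)))
    where
    u : Carrier
    u = 1# - (16 · 1#) * h

    0<u : 0# < u
    0<u = <⇒0<- 16h<1

    2h<½ : h + h < ½
    2h<½ = 0<-⇒< (<-respʳ-≈
      (trans (solve 3 (λ o e h → e :* (o :- con (+ 16) :* h) :+ con (+ 6) :* (e :* con (+ 2) :* h)
          := e :* o :- con (+ 2) :* (e :* con (+ 2) :* h)) refl 1# ½ h)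
        (+-cong (*-identityʳ ½) (-‿cong (trans (*-congˡ e2h≈h) (solve 1 (λ h → con (+ 2) :* h := h :+ h) refl h)))))
      (+-pos (*-pos 0<½ 0<u) (*-pos (0<suc 5) (<-respʳ-≈ (sym e2h≈h) 0<h))))
      where
      e2h≈h : ½ * (2 · 1#) * h ≈ h
      e2h≈h = trans (*-congʳ (1/-inverse 2)) (*-identityˡ h)

    close : ∥ cis h ⊕ ⊝ (1# , h) ∥< (((h + h) * (h + h) + (h + h) * (h + h)) + (h + h) * (h + h))
    close = cis-near (x<x+y 0<h , <-trans (0<-⇒< (<-respʳ-≈ (solve 1 (λ h → h := con (+ 0) :- :- h) refl h) 0<h)) (+-pos 0<h 0<h)) 2h<½

    cubic<h : ((h + h) * (h + h) + (h + h) * (h + h)) + (h + h) * (h + h) < h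
    cubic<h = 0<-⇒< (<-respʳ-≈
      (trans (solve 2 (λ o h → h :* ((o :- con (+ 16) :* h) :+ con (+ 4) :* h)
          := h :* o :- (((h :+ h) :* (h :+ h) :+ (h :+ h) :* (h :+ h)) :+ (h :+ h) :* (h :+ h))) refl 1# h)
        (+-congʳ (*-identityʳ h)))
      (*-pos 0<h (+-pos 0<u (*-pos (0<suc 3) 0<h))))

  -- A negative `α` in this range has negative sine, and an `α` within `½ ^ k` of 0 has sine below
  -- `4 ½ ^ k`, less than the given one. Cotransitivity leaves only positive `α`.
  positive-angle : ∀ {α} → 0# < proj₂ (cis α) → (16 · 1#) * (- α) < 1# → 0# < α
  positive-angle {α} 0<y 16α<1 =
    let k , 2≤k , small = ½^-vanishes 2 (4 · 1#) 0<y in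
    [ (λ 0<α → 0<α)
    , (λ α<ρ → ⊥-elim ([ negative
      , (λ -α<ρ → <-asym small (<-respˡ-≈ (trans (+-congˡ -0≈0) (+-identityʳ _))
          (proj₁ (proj₂ (cis-near-1 (α<ρ , -α<ρ) (½^-<½ 2≤k)))))) ]′ (<-cotrans (½^-pos k) (- α)))) ]′
    (<-cotrans (½^-pos k) α)
    where
    negative : 0# < - α → ⊥
    negative 0<-α = <-asym 0<y (0<-⇒< (<-respʳ-≈ (trans (proj₂ (cis-neg α)) (sym (+-identityˡ _)))
      (sin-pos 0<-α 16α<1)))

  cayley-imag-pos : ∀ {t} → 0# < t → 0# < proj₂ (cayley t)
  cayley-imag-pos {t} 0<t = *-pos (+-pos 0<t 0<t) (inverse-pos (0<1+t² t) (proj₂ (inverse (1# + t * t) (0<1+t² t))))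

  neg<pos : ∀ {x y} → 0# < x → 0# < y → - x < y
  neg<pos {x} 0<x 0<y = <-trans (0<-⇒< (<-respʳ-≈ (solve 1 (λ x → x := con (+ 0) :- :- x) refl x) 0<x)) 0<y

  1/centre-small : ∀ {τ} → 0# < τ → ∃ λ j → 1/ Z.centre j < τ
  1/centre-small {τ} 0<τ =
    let i , iτ≈1 = inverse τ 0<τ
        j , i<j  = archimedean i
        v = 1/ Z.centre j
        0<v = 0<1/suc (suc (25 ℕ.* j))
    in j , 0<-⇒< (<-respʳ-≈
      (trans (solve 4 (λ v τ m i → (v :* τ) :* (m :- i) := τ :* (v :* m) :- v :* (i :* τ)) refl v τ (Z.centre j · 1#) i)
        (+-cong (trans (*-congˡ (1/-inverse (Z.centre j))) (*-identityʳ τ)) (-‿cong (trans (*-congˡ iτ≈1) (*-identityʳ v)))))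
      (*-pos (*-pos 0<v 0<τ) (<⇒0<- (<-trans i<j (j<centre j)))))
    where
    j<centre : ∀ j → j · 1# < Z.centre j · 1#
    j<centre j = <-respʳ-≈ (trans (sym (×-homo-+ 1# j (2 ℕ.+ 24 ℕ.* j)))
        (×-congˡ (≡.trans (ℕₚ.+-suc j _) (≡.cong suc (ℕₚ.+-suc j _)))))
      (x<x+y (0<suc (suc (24 ℕ.* j))))

  -- With `e = 1 / η`, the single bound `128 (1 + e) τ < 1` implies both.
  small-parameter : ∀ {η} → 0# < η → ∃ λ τ → 0# < τ × (128 · 1#) * τ < 1# × (128 · 1#) * τ < η
  small-parameter {η} 0<η = choose (inverse η 0<η)
    where
    choose : (∃ λ e → e * η ≈ 1#) → ∃ λ τ → 0# < τ × (128 · 1#) * τ < 1# × (128 · 1#) * τ < η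
    choose (e , eη≈1) = bounds (½^-vanishes 0 ((128 · 1#) * (1# + e)) 0<1)
      where
      0<e : 0# < e
      0<e = inverse-pos 0<η eη≈1

      bounds : (∃ λ k → 0 ℕ.≤ k × ((128 · 1#) * (1# + e)) * ½ ^ k < 1#) →
               ∃ λ τ → 0# < τ × (128 · 1#) * τ < 1# × (128 · 1#) * τ < η
      bounds (k , _ , small) = τ , 0<τ , <-trans (<-respʳ-≈ (sym split) (x<x+y (*-pos (0<suc 127) (*-pos 0<e 0<τ)))) small ,
        <-respˡ-≈ (trans (solve 3 (λ η e τ → η :* (con (+ 128) :* (e :* τ)) := (e :* η) :* (con (+ 128) :* τ)) refl η e τ)
            (trans (*-congʳ eη≈1) (*-identityˡ _)))
          (<-respʳ-≈ (*-identityʳ η) (*-monoˡ-< 0<η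
            (<-trans (<-respʳ-≈ (sym split) (y<x+y (*-pos (0<suc 127) 0<τ))) small)))
        where
        τ : Carrier
        τ = ½ ^ k

        0<τ : 0# < τ
        0<τ = ½^-pos k

        split : ((128 · 1#) * (1# + e)) * τ ≈ (128 · 1#) * τ + (128 · 1#) * (e * τ)
        split = trans (solve 3 (λ o e τ → (con (+ 128) :* (o :+ e)) :* τ := con (+ 128) :* (o :* τ) :+ con (+ 128) :* (e :* τ))
          refl 1# e τ) (+-congʳ (*-congˡ (*-identityˡ τ)))

  -- The angle is within `6 τ` of 0. As `16 · 6 τ = 96 τ < 1`, its sign is that of the imaginary
  -- part.
  cayley-small-angle : ∀ {t τ η} → 0# < t → t < τ → (128 · 1#) * τ < 1# → (128 · 1#) * τ < η →
    ∃ λ α → 0# < α × α < η × cis α ≋ cayley t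
  cayley-small-angle {t} {τ} {η} 0<t t<τ 128τ<1 128τ<η =
    bounds (cayley-angle (t<τ , neg<pos 0<t 0<τ) 128τ<1)
    where
    0<τ : 0# < τ
    0<τ = <-trans 0<t t<τ

    6τ : Carrier
    6τ = ((τ + τ) + (τ + τ)) + (τ + τ)

    bounds : (∃ λ α → ∣ α ∣< 6τ × cis α ≋ cayley t) → ∃ λ α → 0# < α × α < η × cis α ≋ cayley t
    bounds (α , (α<6τ , -α<6τ) , α≋) = α ,
      positive-angle (<-respʳ-≈ (sym (proj₂ α≋)) (cayley-imag-pos 0<t))
        (<-trans (*-monoˡ-< (0<suc 15) -α<6τ) (<-trans (0<-⇒< (<-respʳ-≈
          (solve 1 (λ τ → con (+ 32) :* τ := con (+ 128) :* τ :- con (+ 16) :* (((τ :+ τ) :+ (τ :+ τ)) :+ (τ :+ τ))) refl τ)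
          (*-pos (0<suc 31) 0<τ))) 128τ<1)) ,
      <-trans α<6τ (<-trans (0<-⇒< (<-respʳ-≈
          (solve 1 (λ τ → con (+ 122) :* τ := con (+ 128) :* τ :- (((τ :+ τ) :+ (τ :+ τ)) :+ (τ :+ τ))) refl τ)
          (*-pos (0<suc 121) 0<τ))) 128τ<η) ,
      α≋

  small-rotation : ∀ {η} → 0# < η → ∃ λ j → ∃ λ α → 0# < α × α < η × cis α ≋ rotation j
  small-rotation {η} 0<η = choose (small-parameter 0<η)
    where
    choose : (∃ λ τ → 0# < τ × (128 · 1#) * τ < 1# × (128 · 1#) * τ < η) →
             ∃ λ j → ∃ λ α → 0# < α × α < η × cis α ≋ rotation j
    choose (τ , 0<τ , 128τ<1 , 128τ<η) =
      let j , v<τ = 1/centre-small 0<τ in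
      j , cayley-small-angle {1/ Z.centre j} (0<1/suc (suc (25 ℕ.* j))) v<τ 128τ<1 128τ<η

  S¹-bound : ∀ {z} → z ∈ S¹ → ∥ z ∥< 2#
  S¹-bound {x , y} z∈ = coordinate z∈ , coordinate (trans (+-comm _ _) z∈)
    where
    coordinate< : ∀ {x y} → x * x + y * y ≈ 1# → x < 2#
    coordinate< {x} {y} eq = [ (λ 1<x → ⊥-elim (square-nonneg y (0<-⇒< (<-respʳ-≈
        (trans (solve 3 (λ o x y → (x :- o) :* (x :- o) :+ con (+ 2) :* (o :* (x :- o))
            := con (+ 0) :- y :* y :+ ((x :* x :+ y :* y) :- o :* o)) refl 1# x y)
          (trans (+-congˡ (trans (+-cong eq (-‿cong (*-identityˡ 1#))) (-‿inverseʳ 1#))) (+-identityʳ _)))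
        (+-pos (*-pos (<⇒0<- 1<x) (<⇒0<- 1<x)) (*-pos (0<suc 1) (*-pos 0<1 (<⇒0<- 1<x))))))))
      , (λ x<2 → x<2) ]′ (<-cotrans 1<2 x)

    coordinate : ∀ {x y} → x * x + y * y ≈ 1# → ∣ x ∣< 2#
    coordinate {x} {y} eq = coordinate< eq , coordinate< (trans (+-congʳ (solve 1 (λ x → :- x :* :- x := x :* x) refl x)) eq)

  ∥∥⇒dist² : ∀ {P Q ε} → 0# < ε → ∥ P ⊕ ⊝ Q ∥< (½ * ε) → dist² P Q < ε * ε
  ∥∥⇒dist² {P} {Q} {ε} 0<ε (p , q) = <-trans (+-mono-< (proj₁ (abs-* p p)) (proj₁ (abs-* q q)))
    (<-respʳ-≈ (trans (solve 1 (λ e → (e :* e :+ e :* e) :+ (e :* e :+ e :* e) := (e :+ e) :* (e :+ e)) refl (½ * ε))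
        (*-cong (½*ε+½*ε ε) (½*ε+½*ε ε)))
      (x<x+y (+-pos 0<e² 0<e²)))
    where
    0<e² : 0# < (½ * ε) * (½ * ε)
    0<e² = *-pos (*-pos 0<½ 0<ε) (*-pos 0<½ 0<ε)

  -- `16 = 2 · 2 · 4`: the factor of a product in the maximum norm, the bound for `Q`, and
  -- `cis-near-1`.
  cis-close : ∀ {Q h η ε} → Q ∈ S¹ → ∣ h ∣< η → η < ½ → (16 · 1#) * η < ε → ∥ Q ⊗ cis h ⊕ ⊝ Q ∥< ε
  cis-close {Q} {h} {η} Q∈ h<η η<½ small = ∥∥-weaken (∥∥-resp
    (G.trans (G.distribˡ Q (cis h) (⊝ G.1#)) (G.+-congˡ {Q ⊗ cis h}
      (G.trans (E-Solver.solve 2 (λ q o → q E-Solver.:* (E-Solver.:- o) E-Solver.:= E-Solver.:- (q E-Solver.:* o)) G.refl Q G.1#)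
        (G.-‿cong (G.*-identityʳ Q)))))
    (trans (solve 2 (λ o η → (o :+ o) :* (con (+ 4) :* η) :+ (o :+ o) :* (con (+ 4) :* η) := o :* (con (+ 16) :* η)) refl 1# η)
      (*-identityˡ _))
    (∥∥-⊗ {Q} {cis h ⊕ ⊝ G.1#} (S¹-bound Q∈) (cis-near-1 h<η η<½))) small

  numeral-pos : ∀ n .{{_ : NonZero n}} → 0# < n · 1#
  numeral-pos (suc n) = 0<suc n

  0<1/ : ∀ n .{{_ : NonZero n}} → 0# < 1/ n
  0<1/ (suc n) = 0<1/suc n

  -- The exponents `1 + n b` have the angles `α + b σ` with `σ = n α`; one of them is within
  -- `2 σ < η` of `β`.
  approximating-power : ∀ n .{{_ : NonZero n}} {z Q α β η} →
    0# < α → α < β → (n · 1#) * α < ½ * η → cis α ≋ z → cis β ≋ Q →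
    ∃ λ b → ∃ λ h → ∣ h ∣< η × z ⊗^ suc (n ℕ.* b) ≋ Q ⊗ cis h
  approximating-power n {z} {Q} {α} {β} {η} 0<α α<β nα<½η α≋ β≋ = choose (nearest-multiple 0<σ (<⇒0<- α<β))
    where
    σ : Carrier
    σ = n · α

    0<σ : 0# < σ
    0<σ = <-respʳ-≈ (sym (·≈* n α)) (*-pos (numeral-pos n) 0<α)

    σ<½η : σ < ½ * η
    σ<½η = <-respˡ-≈ (sym (·≈* n α)) nα<½η

    choose : (∃ λ b → ∣ (β - α) - b · σ ∣< (σ + σ)) →
             ∃ λ b → ∃ λ h → ∣ h ∣< η × z ⊗^ suc (n ℕ.* b) ≋ Q ⊗ cis h
    choose (b , close) = b , m · α - β , abs-<-trans (abs-resp
        (trans (solve 3 (λ α β x → :- ((β :- α) :- x) := (α :+ x) :- β) refl α β (b · σ))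
          (+-congʳ (+-congˡ (trans (×-assocˡ α b n) (×-congˡ (ℕₚ.*-comm b n))))))
        refl (abs-neg close)) (<-respʳ-≈ (½*ε+½*ε η) (+-mono-< σ<½η σ<½η)) ,
      G.trans (⊗^-congˡ m (G.sym α≋)) (G.trans (G.sym (cis-· m α))
        (G.trans (cis-cong (solve 2 (λ x β → x := β :+ (x :- β)) refl (m · α) β))
          (G.trans (cis-+ β (m · α - β)) (G.*-congʳ {cis (m · α - β)} β≋))))
      where
      m : ℕ
      m = suc (n ℕ.* b)

  rotations-dense : ∀ {p} → 0# < p → cis p ≋ G.1# → ∀ n .{{_ : NonZero n}} {Q} → Q ∈ S¹ → ∀ ε → 0# < ε →
    ∃ λ j → ∃ λ b → dist² (rotation j ⊗^ suc (n ℕ.* b)) Q < ε * ε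
  rotations-dense {p} 0<p cis-p n {Q} Q∈ ε 0<ε = choose (½^-vanishes 2 (16 · 1#) (*-pos 0<½ 0<ε))
    where
    choose : (∃ λ k → 2 ℕ.≤ k × (16 · 1#) * ½ ^ k < ½ * ε) →
             ∃ λ j → ∃ λ b → dist² (rotation j ⊗^ suc (n ℕ.* b)) Q < ε * ε
    -- An angle below `η / (2 n)` makes the step `n α` less than `η / 2`.
    choose (k , 2≤k , small) = rotate (small-rotation {½ * η * 1/ n} (*-pos (*-pos 0<½ (½^-pos k)) (0<1/ n)))
      where
      η : Carrier
      η = ½ ^ k

      rotate : (∃ λ j → ∃ λ α → 0# < α × α < ½ * η * 1/ n × cis α ≋ rotation j) →
               ∃ λ j → ∃ λ b → dist² (rotation j ⊗^ suc (n ℕ.* b)) Q < ε * ε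
      rotate (j , α , 0<α , α< , α≋) = aim (large-angle 0<p cis-p {Q} Q∈ α)
        where
        nα<½η : (n · 1#) * α < ½ * η
        nα<½η = <-respʳ-≈ (trans (solve 3 (λ N x v → N :* (x :* v) := x :* (v :* N)) refl (n · 1#) (½ * η) (1/ n))
          (trans (*-congˡ (1/-inverse n)) (*-identityʳ _))) (*-monoˡ-< (numeral-pos n) α<)

        aim : (∃ λ β → α < β × cis β ≋ Q) → ∃ λ j → ∃ λ b → dist² (rotation j ⊗^ suc (n ℕ.* b)) Q < ε * ε
        aim (β , α<β , β≋) = conclude (approximating-power n {rotation j} {Q} 0<α α<β nα<½η α≋ β≋)
          where
          conclude : (∃ λ b → ∃ λ h → ∣ h ∣< η × rotation j ⊗^ suc (n ℕ.* b) ≋ Q ⊗ cis h) →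
                     ∃ λ j → ∃ λ b → dist² (rotation j ⊗^ suc (n ℕ.* b)) Q < ε * ε
          conclude (b , h , h<η , P≋) = j , b , ∥∥⇒dist² {rotation j ⊗^ suc (n ℕ.* b)} {Q} 0<ε
            (∥∥-resp (G.+-congʳ {⊝ Q} (G.sym P≋)) refl (cis-close {Q} Q∈ h<η (½^-<½ 2≤k) small))

-- From the absence of constructible roots to non-sectable angles

module Sections {c ℓ₁ ℓ₂ ℓ₃} (R : RealNumbers c ℓ₁ ℓ₂ ℓ₃) where

  open Plane R hiding (_<_)
  open Subfields R using (module E)
  open E using (_⊗^_; module G)
  open Exponential R using (cis; ∠≋cis)
  open Rotations R using (rotation; rational-rootless)
  open Surjectivity R using (angled)
  open Density R using (cis-/; rotation^∈S¹)
  open Intersections R using (module Obstruction)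
  open Algebra.Properties.Semiring.Exp G.semiring using () renaming (^-congˡ to ⊗^-congˡ)

  ≋-transport-^ : ∀ n {x y u v} → x ≋ u → y ≋ v → u ⊗^ n ≋ v → x ⊗^ n ≋ y
  ≋-transport-^ n x≋u y≋v uⁿ≋v = G.trans (⊗^-congˡ n x≋u) (G.trans uⁿ≋v (G.sym y≋v))

  -- The quotient is written as in the unfolding of _-Sectable_: any other name for it
  -- makes the type checker compare the limits hidden in cos and sin.
  ∠-/ : ∀ (α : Carrier) n .{{_ : NonZero n}} → ∠ (RealProperties._/_ R α n) ⊗^ n ≋ ∠ α
  ∠-/ α n = ≋-transport-^ n {∠ (RealProperties._/_ R α n)} {∠ α} {cis (α / n)} {cis α}
    (∠≋cis (RealProperties._/_ R α n)) (∠≋cis α) (cis-/ α n)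

  angle-of : ∀ {P z} → z ∈ S¹ → P ≋ z → ∃ λ α → P ≋ ∠ α
  angle-of {P} {z} z∈ P≋z = choose (angled z z∈)
    where
    choose : (∃ λ α → cis α ≋ z) → ∃ λ α → P ≋ ∠ α
    choose (α , α≋) = α , G.trans {P} {z} {∠ α} P≋z
      (G.trans {z} {cis α} {∠ α} (G.sym {cis α} {z} α≋) (G.sym {∠ α} {cis α} (∠≋cis α)))

  module _ (n : ℕ) (1<n : 1 ℕ.< n) (2∤n : ¬ 2 ∣ n) (j b : ℕ) where

    rotation-no-root : ∀ {z w} → z ≋ rotation j ⊗^ suc (n ℕ.* b) → w ⊗^ n ≋ z → ¬ C (base ∪ ｛ z ｝) w
    rotation-no-root {z} {w} z≋ wⁿ≋z w∈C =
      Obstruction.no-constructible-root n z {w = w} (rational-rootless n 1<n 2∤n j b z≋) w∈C wⁿ≋z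

    rotation-non-sectable : .{{_ : NonZero n}} → ∀ {P} → P ≋ rotation j ⊗^ suc (n ℕ.* b) → NonSectable n P
    rotation-non-sectable {P} P≋ = angle-of {P} {rotation j ⊗^ suc (n ℕ.* b)} (rotation^∈S¹ j (suc (n ℕ.* b))) P≋ ,
      λ α P≋∠α → rotation-no-root {∠ α} {∠ (RealProperties._/_ R α n)}
        (G.trans {∠ α} {P} {rotation j ⊗^ suc (n ℕ.* b)} (G.sym {P} {∠ α} P≋∠α) P≋) (∠-/ α n)

-- Cantor's enumeration of pairs, and assembly of the dense set

antidiagonal : ℕ × ℕ → ℕ × ℕ
antidiagonal (zero  , b) = suc b , zero
antidiagonal (suc j , b) = j , suc b

enumerate : ℕ → ℕ × ℕ
enumerate zero    = zero , zero
enumerate (suc k) = antidiagonal (enumerate k)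

-- The walk is traced back: induction on the antidiagonal `s = j + b`, and within it on `b`.
enumerate-surjective : ∀ j b → ∃ λ k → enumerate k ≡ (j , b)
enumerate-surjective j b = go (j ℕ.+ b) b j ≡.refl
  where
  go : ∀ s b j → j ℕ.+ b ≡ s → ∃ λ k → enumerate k ≡ (j , b)
  go s       (suc b) j       eq = let k , p = go s b (suc j) (≡.trans (≡.sym (ℕₚ.+-suc j b)) eq) in
                                  suc k , ≡.cong antidiagonal p
  go zero    zero    zero    eq = zero , ≡.refl
  go (suc s) zero    (suc j) eq = let k , p = go s j zero (≡.trans (≡.sym (ℕₚ.+-identityʳ j)) (ℕₚ.suc-injective eq)) in
                                  suc k , ≡.cong antidiagonal p

open import Data.Nat.Base using (_<_)

propositionA2 : ∀ {c ℓ₁ ℓ₂ ℓ₃} (R : RealNumbers c ℓ₁ ℓ₂ ℓ₃) →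
    let open Plane R hiding (_<_) in
    ∀ π → IsPi π →
    ∀ (n : ℕ) .{{_ : NonZero n}} → 1 < n → ¬ (2 ∣ n) →
    Constructible ((2 · π) / n) →
    Σ (Pred Point ℓ₁) λ D →
    D ⊆ S¹ × Countable D × DenseInS¹ D × D ⊆ NonSectable n
propositionA2 {ℓ₁ = ℓ₁} R π (0<π , sinπ≈0 , _) n 1<n 2∤n _ =
  D , (λ {P} → D⊆S¹ {P}) , (point , λ P → mk⇔ (λ P∈D → P∈D) (λ P∈D → P∈D)) , dense , λ {P} → non-sectable {P}
  where
  open Plane R
  open Subfields R using (module E)
  open E using (_⊗^_; module G)
  open Rotations R using (rotation)
  open Surjectivity R using (S¹-resp)
  open Density R using (rotation^∈S¹; rotations-dense; cis-double-zero)
  open Sections R using (rotation-non-sectable)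

  power : ℕ × ℕ → Point
  power (j , b) = rotation j ⊗^ suc (n ℕ.* b)

  point : ℕ → Point
  point k = power (enumerate k)

  -- Closing the range of `point` under `≋` makes countability hold by definition.
  D : Pred Point ℓ₁
  D P = ∃ λ k → P ≋ point k

  D⊆S¹ : D ⊆ S¹
  D⊆S¹ {P} (k , P≋) = S¹-resp {point k} {P} (G.sym {P} {point k} P≋)
    (rotation^∈S¹ (proj₁ (enumerate k)) (suc (n ℕ.* proj₂ (enumerate k))))

  dense : DenseInS¹ D
  dense Q Q∈ ε 0<ε =
    let j , b , close = rotations-dense (+-pos 0<π 0<π) (cis-double-zero {π} sinπ≈0) n {Q} Q∈ ε 0<ε
        k , k≡jb      = enumerate-surjective j b
    in power (j , b) , (k , G.reflexive (≡.cong power (≡.sym k≡jb))) , close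

  non-sectable : D ⊆ NonSectable n
  non-sectable {P} (k , P≋) =
    rotation-non-sectable n 1<n 2∤n (proj₁ (enumerate k)) (proj₂ (enumerate k)) {P} P≋
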